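{- Telephone Broadcast is fixed-parameter tractable parameterized by the distance to clique $k$ of the input graph $G=(V,E)$, and can be solved in time $2^{O(k^2)}\, n^{O(1)}$, where $n=|V|-k$.
   Context: All graphs are finite, undirected and loopless. Telephone model: at the start exactly one vertex, the source $s$, is informed; in each round every informed vertex may send the message to at most one of its uninformed neighbors, which is informed by the end of that round. For a connected graph $G$ and $s\in V(G)$, $b(G,s)$ is the minimum number of rounds needed to inform all vertices of $G$ starting from $s$. Telephone Broadcast: given a connected graph $G=(V,E)$, $s\in V$, and $t\in\mathbb{Z}^+$, determine whether $b(G,s)\le t$. The distance to clique of $G=(V,E)$ is the minimum size $k$ of a set $X\subseteq V$ such that $G-X$ is a clique (complete graph). Such a set $X$ is called a modulator. -}

module Defs where

open import Data.Bool using (Bool; true; false; T)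
open import Data.Fin using (Fin; toℕ)
open import Data.Fin.Subset using (Subset; _∈_; _∉_; ⁅_⁆; ⊤; ∣_∣)
open import Data.List using (List; []; _∷_; replicate)
import Data.List as List
open import Data.Maybe using (Maybe; just)
open import Data.Nat using (ℕ; zero; suc; _+_; _*_; _^_; _≤_; _>_)
open import Data.Nat.Binary using (ℕᵇ; 2[1+_]; 1+[2_]; fromℕ) renaming (zero to 0ᵇ)
open import Data.Product using (_×_; ∃-syntax; Σ-syntax)
open import Data.Sum using (_⊎_)
open import Data.Vec using (Vec; []; _∷_; lookup)
open import Function.Bundles using (_⇔_)
open import Relation.Binary.Construct.Closure.ReflexiveTransitive using (Star)
open import Relation.Binary.PropositionalEquality using (_≡_; _≢_)

IsMinimum : (ℕ → Set) → ℕ → Set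
IsMinimum P m = P m × (∀ j → P j → m ≤ j)

------------------------------------------------------------------------
-- Graphs

record Graph (v : ℕ) : Set where
  field
    adj        : Fin v → Fin v → Bool
    adj-sym    : ∀ x y → adj x y ≡ adj y x
    adj-irrefl : ∀ x → adj x x ≡ false

  _~_ : Fin v → Fin v → Set
  x ~ y = T (adj x y)

Connected : ∀ {v} → Graph v → Set
Connected G = ∀ x y → Star (Graph._~_ G) x y

IsModulator : ∀ {v} → Graph v → Subset v → Set
IsModulator G X = ∀ x y → x ∉ X → y ∉ X → x ≢ y → Graph._~_ G x y

IsDistanceToClique : ∀ {v} → Graph v → ℕ → Set
IsDistanceToClique G = IsMinimum (λ k → ∃[ X ] (IsModulator G X × ∣ X ∣ ≡ k))

------------------------------------------------------------------------
-- The telephone model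

-- One round, taking the informed set I to the informed set J.  That every
-- vertex makes at most one call is the functionality of `call`.
record Round {v} (G : Graph v) (I J : Subset v) : Set where
  open Graph G
  field
    call       : Fin v → Maybe (Fin v)
    informed   : ∀ {x y} → call x ≡ just y → x ∈ I
    uninformed : ∀ {x y} → call x ≡ just y → y ∉ I
    neighbor   : ∀ {x y} → call x ≡ just y → x ~ y
    result     : ∀ y → y ∈ J ⇔ (y ∈ I ⊎ ∃[ x ] call x ≡ just y)

data Rounds {v} (G : Graph v) : ℕ → Subset v → Subset v → Set where
  done : ∀ {I} → Rounds G 0 I I
  next : ∀ {t I J K} → Round G I J → Rounds G t J K → Rounds G (suc t) I K

-- IsBroadcastTime G s b says that b = b(G, s).
IsBroadcastTime : ∀ {v} → Graph v → Fin v → ℕ → Set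
IsBroadcastTime G s = IsMinimum (λ r → Rounds G r ⁅ s ⁆ ⊤)

------------------------------------------------------------------------
-- Model of computation: a first-order, call-by-value functional language
-- whose values are binary trees (pure Lisp).  There is no primitive
-- arithmetic and no primitive equality test.  Every rule is a
-- constant-time operation on pointers, for a fixed program, so running
-- times are polynomially related to those of Turing machines and RAMs.

infixr 5 _∙_

data Tree : Set where
  nil : Tree
  _∙_ : Tree → Tree → Tree

size : Tree → ℕ
size nil     = 1
size (l ∙ r) = suc (size l + size r)

-- Expressions with n free variables (de Bruijn indices), calling m global,
-- mutually recursive functions of the given arities.
data Exp {m : ℕ} (arity : Fin m → ℕ) (n : ℕ) : Set where
  var    : Fin n → Exp arity n
  nil    : Exp arity n
  cons   : Exp arity n → Exp arity n → Exp arity n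
  case   : Exp arity n → Exp arity n → Exp arity (2 + n) → Exp arity n
  let-in : Exp arity n → Exp arity (suc n) → Exp arity n
  call   : (f : Fin m) → Vec (Exp arity n) (arity f) → Exp arity n

record Program : Set where
  field
    {functions} : ℕ
    arity       : Fin functions → ℕ
    body        : ∀ f → Exp arity (arity f)
    main        : Exp arity 1

module Semantics (p : Program) where
  open Program p

  -- ρ ⊢ e ⇓ a ⟨ c ⟩: in the environment ρ, e evaluates to a in c steps.
  -- The rules are syntax-directed, hence deterministic.
  infix 4 _⊢_⇓_⟨_⟩ _⊢*_⇓_⟨_⟩

  data _⊢_⇓_⟨_⟩ {n} (ρ : Vec Tree n) : Exp arity n → Tree → ℕ → Set
  data _⊢*_⇓_⟨_⟩ {n} (ρ : Vec Tree n) :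
    ∀ {j} → Vec (Exp arity n) j → Vec Tree j → ℕ → Set

  data _⊢_⇓_⟨_⟩ ρ where
    var : ∀ i → ρ ⊢ var i ⇓ lookup ρ i ⟨ 1 ⟩
    nil : ρ ⊢ nil ⇓ nil ⟨ 1 ⟩
    cons : ∀ {e₁ e₂ a₁ a₂ c₁ c₂} →
      ρ ⊢ e₁ ⇓ a₁ ⟨ c₁ ⟩ → ρ ⊢ e₂ ⇓ a₂ ⟨ c₂ ⟩ →
      ρ ⊢ cons e₁ e₂ ⇓ a₁ ∙ a₂ ⟨ suc (c₁ + c₂) ⟩
    case-nil : ∀ {e e₁ e₂ a c₁ c₂} →
      ρ ⊢ e ⇓ nil ⟨ c₁ ⟩ → ρ ⊢ e₁ ⇓ a ⟨ c₂ ⟩ →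
      ρ ⊢ case e e₁ e₂ ⇓ a ⟨ suc (c₁ + c₂) ⟩
    case-cons : ∀ {e e₁ e₂ l r a c₁ c₂} →
      ρ ⊢ e ⇓ l ∙ r ⟨ c₁ ⟩ → l ∷ r ∷ ρ ⊢ e₂ ⇓ a ⟨ c₂ ⟩ →
      ρ ⊢ case e e₁ e₂ ⇓ a ⟨ suc (c₁ + c₂) ⟩
    let-in : ∀ {e₁ e₂ a₁ a₂ c₁ c₂} →
      ρ ⊢ e₁ ⇓ a₁ ⟨ c₁ ⟩ → a₁ ∷ ρ ⊢ e₂ ⇓ a₂ ⟨ c₂ ⟩ →
      ρ ⊢ let-in e₁ e₂ ⇓ a₂ ⟨ suc (c₁ + c₂) ⟩
    call : ∀ {f es as a c₁ c₂} →
      ρ ⊢* es ⇓ as ⟨ c₁ ⟩ → as ⊢ body f ⇓ a ⟨ c₂ ⟩ →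
      ρ ⊢ call f es ⇓ a ⟨ suc (c₁ + c₂) ⟩

  data _⊢*_⇓_⟨_⟩ ρ where
    []  : ρ ⊢* [] ⇓ [] ⟨ 0 ⟩
    _∷_ : ∀ {j e a c₁ c₂} {es : Vec (Exp arity _) j} {as} →
      ρ ⊢ e ⇓ a ⟨ c₁ ⟩ → ρ ⊢* es ⇓ as ⟨ c₂ ⟩ →
      ρ ⊢* e ∷ es ⇓ a ∷ as ⟨ c₁ + c₂ ⟩

_on_outputs_in-time_ : Program → Tree → Tree → ℕ → Set
p on a outputs b in-time c = a ∷ [] ⊢ Program.main p ⇓ b ⟨ c ⟩
  where open Semantics p

------------------------------------------------------------------------
-- Encoding of data as trees

encodeBool : Bool → Tree
encodeBool false = nil
encodeBool true  = nil ∙ nil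

encodeList : List Tree → Tree
encodeList []       = nil
encodeList (a ∷ as) = a ∙ encodeList as

encodeUnary : ℕ → Tree
encodeUnary n = encodeList (replicate n nil)

-- Bijective base 2, least significant digit first.
encodeBinary : ℕᵇ → Tree
encodeBinary 0ᵇ       = nil
encodeBinary 1+[2 x ] = encodeBool false ∙ encodeBinary x
encodeBinary 2[1+ x ] = encodeBool true ∙ encodeBinary x

encodeGraph : ∀ {v} → Graph v → Tree
encodeGraph {v} G =
  encodeList (List.map (λ x → encodeList (List.map (λ y → encodeBool (adj x y))
                                                   (List.allFin v)))
                       (List.allFin v))
  where open Graph G

------------------------------------------------------------------------
-- Parameterized problems

-- The parameter is a relation: Param x k says that x has parameter value k.
-- A program is given encode x only, not k.
record ParameterizedProblem : Set₁ where
  field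
    Instance : Set
    encode   : Instance → Tree
    Yes      : Instance → Set
    Param    : Instance → ℕ → Set

module _ (P : ParameterizedProblem) where
  open ParameterizedProblem P

  DecidesWithin : Program → Instance → ℕ → Set
  DecidesWithin p x bound =
    ∃[ answer ] ∃[ time ]
      ((p on encode x outputs encodeBool answer in-time time)
       × (answer ≡ true ⇔ Yes x)
       × time ≤ bound)

  SolvableInTime : (Instance → ℕ → ℕ) → Set
  SolvableInTime bound =
    ∃[ p ] (∀ x k → Param x k → DecidesWithin p x (bound x k))

  -- As a closed term of type ℕ → ℕ, f is computable.
  FixedParameterTractable : Set
  FixedParameterTractable =
    Σ[ f ∈ (ℕ → ℕ) ] Σ[ d ∈ ℕ ]
      SolvableInTime (λ x k → f k * size (encode x) ^ d)

------------------------------------------------------------------------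
-- Telephone Broadcast parameterized by the distance to clique

record BroadcastInstance : Set where
  field
    order      : ℕ
    graph      : Graph order
    connected  : Connected graph
    source     : Fin order
    t          : ℕ
    t-positive : t > 0

-- The source is written in unary, which is no longer than a row of the
-- adjacency matrix; t is unbounded and therefore written in binary.
TelephoneBroadcast : ParameterizedProblem
TelephoneBroadcast = record
  { Instance = BroadcastInstance
  ; encode   = λ x → encodeGraph (graph x) ∙
                     encodeUnary (toℕ (source x)) ∙
                     encodeBinary (fromℕ (t x))
  ; Yes      = λ x → ∃[ b ] (IsBroadcastTime (graph x) (source x) b × b ≤ t x)
  ; Param    = λ x k → IsDistanceToClique (graph x) k
  }
  where open BroadcastInstance

{-# OPTIONS --safe #-}

-- Put the source and the ends of a maximal matching of non-edges into X: then
-- |X| ≤ 2k + 1 and the other vertices form a clique K.  Informing the vertices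
-- of X one by one and doubling the informed part of K in between gives
-- b(G, s) ≤ |X| + log |K| + O(1), so t may be lowered to T = O(k + log n).
--
-- Label the vertices of K in a broadcast of T rounds as follows: those calling
-- into X (at most |X|, each with its own label), those called by x (at most T
-- for each x ∈ X), and the others.  Allow a vertex of K to exchange calls with
-- y ∈ X only if y is adjacent to all vertices with its label.  The broadcast
-- respects this restriction, and under the restriction vertices with the same
-- label are interchangeable, so that only the numbers of informed vertices per
-- label matter.  Choosing the labels vertex by vertex and then simulating the
-- calls one by one is a nondeterministic process with T^O(k) 2^O(k²) n^O(1)
-- states, and T^k ≤ k^k 2^T = 2^O(k²) n^O(1).  The program explores it in
-- breadth, with duplicate states removed.

module Submission where

open import Data.Bool using (Bool; true; false; if_then_else_; not; _∧_) renaming (T to IsTrue)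
import Data.Bool.Properties as Bool
open import Data.Fin using (Fin; zero; suc; toℕ)
open import Data.Fin.Properties using (toℕ<n; toℕ-injective)
import Data.Fin.Properties as Fin
open import Data.Fin.Subset using (Subset; ⊤; ⊥; ⁅_⁆)
import Data.Fin.Subset as Subset
open import Data.Fin.Subset.Properties using
  ( x∈⁅x⁆; x∈⁅y⁆⇒x≡y; x≢y⇒x∉⁅y⁆; x∉∁p⇒x∈p; x∈p⇒∣p-x∣<∣p∣; x∈p∧x≢y⇒x∈p-y
  ; ∣⁅x⁆∣≡1; ∣∁p∣≡n∸∣p∣ )
open import Data.List using
  ( List; []; _∷_; _++_; map; length; take; replicate; tabulate; allFin; upTo
  ; cartesianProductWith )
open import Data.List.Membership.DecPropositional using (_∈?_)
open import Data.List.Membership.Propositional using (_∈_; _∉_)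
open import Data.List.Membership.Propositional.Properties using
  ( ∈-allFin; ∈-map⁺; ∈-map⁻; ∈-++⁺ˡ; ∈-++⁺ʳ; ∈-++⁻; ∈-∃++; ∈-upTo⁺; ∈-cartesianProductWith⁺ )
open import Data.List.Properties using
  ( length-map; length-++; length-tabulate; length-upTo; length-take; map-id; map-∘
  ; map-tabulate; take-map )
open import Data.List.Relation.Binary.Permutation.Propositional using
  (_↭_; refl; prep; swap; ↭-refl; ↭-sym; ↭-trans)
import Data.List.Relation.Binary.Permutation.Propositional.Properties as Perm
open import Data.List.Relation.Unary.All using (All; []; _∷_)
import Data.List.Relation.Unary.All as All
open import Data.List.Relation.Unary.All.Properties using (¬Any⇒All¬)
open import Data.List.Relation.Unary.AllPairs using ([]; _∷_)
open import Data.List.Relation.Unary.Any using (here; there)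
open import Data.List.Relation.Unary.Unique.Propositional using (Unique)
open import Data.List.Relation.Unary.Unique.Propositional.Properties using (allFin⁺)
open import Data.Maybe using (Maybe; just; nothing)
import Data.Maybe.Properties as Maybe
open import Data.Nat
open import Data.Nat.Binary using (ℕᵇ; 2[1+_]; 1+[2_]; fromℕ) renaming (zero to 0ᵇ)
import Data.Nat.Binary as Binary
open import Data.Nat.Binary.Properties using (toℕ-fromℕ)
open import Data.Nat.DivMod using (m≡m%n+[m/n]*n; m%n<n; m/n*n≤m)
open import Data.Nat.Properties
open import Data.Nat.Tactic.RingSolver using (solve-∀)
open import Data.Product using (_×_; _,_; proj₁; proj₂; ∃-syntax; Σ-syntax)
open import Data.Sum using (_⊎_; inj₁; inj₂; [_,_]′)
open import Data.Vec using (Vec; []; _∷_; lookup; _[_]≔_)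
open import Data.Vec.Properties using
  ( []=⇒lookup; lookup⇒[]=; lookup∘update; lookup∘update′; lookup-replicate
  ; tabulate∘lookup; tabulate-cong )
open import Function using (_∘_; _$_; id)
open import Function.Bundles using (_⇔_; mk⇔; Equivalence)
open import Relation.Binary.Construct.Closure.ReflexiveTransitive using (Star; ε; _◅_)
open import Relation.Binary.PropositionalEquality
open import Relation.Nullary using (Dec; yes; no; ¬_; contradiction)
open import Relation.Nullary.Decidable using (does; map′; dec-true; dec-false; from-yes)
open import Defs

-- The parameter is not part of the input, so the program has to find a modulator itself; a matching
-- of non-edges is within a factor of two of the optimum. The exponent `k²` comes from the
-- descriptions: each of the `3q + 1` labels, where `q = |X|`, takes one of `q + 2^q` of them. Only
-- the label of the last kind, of which there is one, has counters as large as `n`; the counters of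
-- the other `3q` must stay near `k + log n`, and this is why the deadline is lowered before
-- anything else. The deadline is written in binary and may exceed every function of `n`, so its
-- digits are cut before it becomes a unary counter.
--
-- The running time is estimated loosely on purpose. Functions of the form `2^O(k²) n^O(1)` with
-- `n = |V| - k` are closed under sums, products and fixed powers, and `|V|` is itself of this form.
-- So it suffices to bound the number of states, their sizes and a few other quantities by one
-- number `Z` of this form, and the number of calls by a polynomial in `Z`. Unary numbers and linear
-- membership tests then do no harm.

-- Evaluation steps bounded by function calls

weight  : ∀ {m} {arity : Fin m → ℕ} {n} → Exp arity n → ℕ
weight* : ∀ {m} {arity : Fin m → ℕ} {n j} → Vec (Exp arity n) j → ℕ
weight (var i)         = 1
weight nil             = 1
weight (cons e e₁)     = suc (weight e + weight e₁)
weight (case e e₁ e₂)  = suc (weight e + (weight e₁ + weight e₂))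
weight (let-in e e₁)   = suc (weight e + weight e₁)
weight (call f es)     = suc (weight* es)
weight* []       = 0
weight* (e ∷ es) = weight e + weight* es

-- One activation of a function body evaluates each of its nodes at most once,
-- so the running time is bounded by the number of calls, up to the factor β.
module CallCounting (p : Program) (β : ℕ)
                    (body≤β : ∀ f → weight (Program.body p f) ≤ β) where
  open Program p
  open Semantics p

  infix 4 _⊢_↦_#_ _⊢*_↦_#_

  -- The nodes of `e` are paid for by `weight e` and every call by one `β`, so costs compose as
  -- numbers of calls alone. The number of steps is a field and not an index, which lets `lax`
  -- weaken a bound at any point.
  record _⊢_↦_#_ {k : ℕ} (ρ : Vec Tree k) (e : Exp arity k) (a : Tree) (n : ℕ) : Set where
    constructor evaluates
    field
      {steps}    : ℕ
      derivation : ρ ⊢ e ⇓ a ⟨ steps ⟩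
      bounded    : steps ≤ weight e + n * β

  record _⊢*_↦_#_ {k j : ℕ} (ρ : Vec Tree k) (es : Vec (Exp arity k) j)
                  (as : Vec Tree j) (n : ℕ) : Set where
    constructor evaluates*
    field
      {steps}    : ℕ
      derivation : ρ ⊢* es ⇓ as ⟨ steps ⟩
      bounded    : steps ≤ weight* es + n * β

  private
    +-shuffle : ∀ a b m n {x y} → x ≤ a + m * β → y ≤ b + n * β →
                x + y ≤ a + b + (m + n) * β
    +-shuffle a b m n x≤ y≤ =
      ≤-trans (+-mono-≤ x≤ y≤) (≤-reflexive (eq a b m n β))
      where
      eq : ∀ a b m n β → (a + m * β) + (b + n * β) ≡ a + b + (m + n) * β
      eq = solve-∀

  lax : ∀ {k} {ρ : Vec Tree k} {e a m n} → ρ ⊢ e ↦ a # m → m ≤ n → ρ ⊢ e ↦ a # n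
  lax {e = e} (evaluates d b) m≤n =
    evaluates d (≤-trans b (+-monoʳ-≤ (weight e) (*-monoˡ-≤ β m≤n)))

  `var : ∀ {k} {ρ : Vec Tree k} {i} → ρ ⊢ var i ↦ lookup ρ i # 0
  `var = evaluates (var _) ≤-refl

  `nil : ∀ {k} {ρ : Vec Tree k} → ρ ⊢ nil ↦ nil # 0
  `nil = evaluates nil ≤-refl

  `cons : ∀ {k} {ρ : Vec Tree k} {e₁ e₂ a₁ a₂ m n} →
          ρ ⊢ e₁ ↦ a₁ # m → ρ ⊢ e₂ ↦ a₂ # n → ρ ⊢ cons e₁ e₂ ↦ a₁ ∙ a₂ # m + n
  `cons {e₁ = e₁} {e₂} {m = m} {n} (evaluates d b) (evaluates d′ b′) =
    evaluates (cons d d′) (s≤s (+-shuffle (weight e₁) (weight e₂) m n b b′))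

  `let : ∀ {k} {ρ : Vec Tree k} {e₁ e₂ a₁ a₂ m n} →
         ρ ⊢ e₁ ↦ a₁ # m → a₁ ∷ ρ ⊢ e₂ ↦ a₂ # n → ρ ⊢ let-in e₁ e₂ ↦ a₂ # m + n
  `let {e₁ = e₁} {e₂} {m = m} {n} (evaluates d b) (evaluates d′ b′) =
    evaluates (let-in d d′) (s≤s (+-shuffle (weight e₁) (weight e₂) m n b b′))

  `case-nil : ∀ {k} {ρ : Vec Tree k} {e e₁ e₂ a m n} →
              ρ ⊢ e ↦ nil # m → ρ ⊢ e₁ ↦ a # n → ρ ⊢ case e e₁ e₂ ↦ a # m + n
  `case-nil {e = e} {e₁} {e₂} {m = m} {n} (evaluates d b) (evaluates d′ b′) =
    evaluates (case-nil d d′)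
      (s≤s (≤-trans (+-shuffle (weight e) (weight e₁) m n b b′)
             (+-monoˡ-≤ _ (+-monoʳ-≤ (weight e) (m≤m+n (weight e₁) (weight e₂))))))

  `case-cons : ∀ {k} {ρ : Vec Tree k} {e e₁ e₂ l r a m n} →
               ρ ⊢ e ↦ l ∙ r # m → l ∷ r ∷ ρ ⊢ e₂ ↦ a # n →
               ρ ⊢ case e e₁ e₂ ↦ a # m + n
  `case-cons {e = e} {e₁} {e₂} {m = m} {n} (evaluates d b) (evaluates d′ b′) =
    evaluates (case-cons d d′)
      (s≤s (≤-trans (+-shuffle (weight e) (weight e₂) m n b b′)
             (+-monoˡ-≤ _ (+-monoʳ-≤ (weight e) (m≤n+m (weight e₂) (weight e₁))))))

  `[] : ∀ {k} {ρ : Vec Tree k} → ρ ⊢* [] ↦ [] # 0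
  `[] = evaluates* [] ≤-refl

  infixr 5 _`∷_
  _`∷_ : ∀ {k j} {ρ : Vec Tree k} {e} {es : Vec _ j} {a as m n} →
         ρ ⊢ e ↦ a # m → ρ ⊢* es ↦ as # n → ρ ⊢* e ∷ es ↦ a ∷ as # m + n
  _`∷_ {e = e} {es} {m = m} {n} (evaluates d b) (evaluates* d′ b′) =
    evaluates* (d ∷ d′) (+-shuffle (weight e) (weight* es) m n b b′)

  `call : ∀ {k} {ρ : Vec Tree k} {f es as a m n} →
          ρ ⊢* es ↦ as # m → as ⊢ body f ↦ a # n → ρ ⊢ call f es ↦ a # suc (m + n)
  `call {f = f} {es} {m = m} {n} (evaluates* d b) (evaluates d′ b′) =
    evaluates (call d d′)
      (s≤s (≤-trans (+-shuffle (weight* es) (weight (body f)) m n b b′)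
        (≤-trans (+-monoˡ-≤ _ (+-monoʳ-≤ (weight* es) (body≤β f)))
                 (≤-reflexive (+-assoc (weight* es) β _)))))

  -- Both branches share the bound `n`, so the cost does not depend on the outcome of the test. The
  -- two `nil` are the components of the tree that encodes `true`.
  `if : ∀ {k} {ρ : Vec Tree k} {A : Set} (f : A → Tree) {e e₁ e₂ b x y m n} →
        ρ ⊢ e ↦ encodeBool b # m → ρ ⊢ e₁ ↦ f y # n → nil ∷ nil ∷ ρ ⊢ e₂ ↦ f x # n →
        ρ ⊢ case e e₁ e₂ ↦ f (if b then x else y) # m + n
  `if f {b = false} t d₁ d₂ = `case-nil t d₁
  `if f {b = true}  t d₁ d₂ = `case-cons t d₂

-- The program

pattern eqᶠ = zero
pattern nthᶠ = suc eqᶠ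
pattern adjᶠ = suc nthᶠ
pattern memᶠ = suc adjᶠ
pattern filtᶠ = suc memᶠ
pattern edgeᶠ = suc filtᶠ
pattern ruleHoldᶠ = suc edgeᶠ
pattern ruleIdleᶠ = suc ruleHoldᶠ
pattern ruleAssignᶠ = suc ruleIdleᶠ
pattern ruleᶠ = suc ruleAssignᶠ
pattern consAllᶠ = suc ruleᶠ
pattern variantsᶠ = suc consAllᶠ
pattern resetᶠ = suc variantsᶠ
pattern tickᶠ = suc resetᶠ
pattern succsᶠ = suc tickᶠ
pattern addAllᶠ = suc succsᶠ
pattern expandᶠ = suc addAllᶠ
pattern iterᶠ = suc expandᶠ
pattern doneᶠ = suc iterᶠ
pattern acceptᶠ = suc doneᶠ
pattern vertsᶠ = suc acceptᶠ
pattern findᶠ = suc vertsᶠ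
pattern greedyᶠ = suc findᶠ
pattern incᶠ = suc greedyᶠ
pattern bitsᶠ = suc incᶠ
pattern appendᶠ = suc bitsᶠ
pattern takeᶠ = suc appendᶠ
pattern unaryᶠ = suc takeᶠ
pattern lenᶠ = suc unaryᶠ
pattern baseᶠ = suc lenᶠ
pattern solveᶠ = suc baseᶠ

pattern x0 = var zero
pattern x1 = var (suc zero)
pattern x2 = var (suc (suc zero))
pattern x3 = var (suc (suc (suc zero)))
pattern x4 = var (suc (suc (suc (suc zero))))
pattern x5 = var (suc (suc (suc (suc (suc zero)))))
pattern x6 = var (suc (suc (suc (suc (suc (suc zero))))))
pattern x7 = var (suc (suc (suc (suc (suc (suc (suc zero)))))))
pattern x8 = var (suc (suc (suc (suc (suc (suc (suc (suc zero))))))))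
pattern x9 = var (suc (suc (suc (suc (suc (suc (suc (suc (suc zero)))))))))
pattern x10 = var (suc (suc (suc (suc (suc (suc (suc (suc (suc (suc zero))))))))))
pattern x11 = var (suc (suc (suc (suc (suc (suc (suc (suc (suc (suc (suc zero)))))))))))
pattern x12 = var (suc (suc (suc (suc (suc (suc (suc (suc (suc (suc (suc (suc zero))))))))))))
pattern x13 = var (suc (suc (suc (suc (suc (suc (suc (suc (suc (suc (suc (suc (suc zero)))))))))))))
pattern x14 = var (suc (suc (suc (suc (suc (suc (suc (suc (suc (suc (suc (suc (suc (suc zero))))))))))))))

-- The entries follow the order of the patterns from `eqᶠ` to `solveᶠ`.
arities : Fin 31 → ℕ
arities = lookup (2 ∷ 2 ∷ 2 ∷ 2 ∷ 2 ∷ 2 ∷ 3 ∷ 2 ∷ 4 ∷ 2 ∷ 2 ∷ 2 ∷ 1 ∷ 3 ∷ 1 ∷ 2 ∷ 2 ∷ 2 ∷ 1 ∷ 1 ∷ 2 ∷ 2 ∷ 4 ∷ 1 ∷ 1 ∷ 2 ∷ 2 ∷ 1 ∷ 1 ∷ 3 ∷ 5 ∷ [])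

private
  tt′ : ∀ {n} → Exp arities n
  tt′ = cons nil nil

-- The pair branch of a `case` binds the head as `x0` and the tail as `x1` and shifts all other
-- indices by two; `let-in` shifts them by one. The lemmas with names ending in `-ok` say what each
-- body computes.
bodies : ∀ f → Exp arities (arities f)
bodies eqᶠ =
  case x0 (case x1 tt′ nil)
    (case x3 nil
      (case (call eqᶠ (x2 ∷ x0 ∷ [])) nil (call eqᶠ (x5 ∷ x3 ∷ []))))
bodies nthᶠ =
  case x0 (case x1 nil x0) (case x3 nil (call nthᶠ (x3 ∷ x1 ∷ [])))
bodies adjᶠ =
  case x0 nil (case x3 nil (call nthᶠ (x0 ∷ x3 ∷ [])))
bodies memᶠ =
  case x1 nil (case (call eqᶠ (x2 ∷ x0 ∷ [])) (call memᶠ (x2 ∷ x1 ∷ [])) tt′)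
bodies filtᶠ =
  case x1 nil
    (case (call adjᶠ (x2 ∷ x0 ∷ [])) (call filtᶠ (x2 ∷ x1 ∷ []))
      (cons x2 (call filtᶠ (x4 ∷ x3 ∷ []))))
bodies edgeᶠ =
  case x0 nil (case x3 nil
    (case x2
      (case x0 (call adjᶠ (x3 ∷ x1 ∷ [])) (call memᶠ (x5 ∷ x3 ∷ [])))
      (case x2 (call memᶠ (x3 ∷ x5 ∷ [])) tt′)))
bodies ruleHoldᶠ =
  case x2 nil (case x1 nil (case x1 nil (case x1 nil
    (case (call edgeᶠ (x9 ∷ x6 ∷ [])) nil
      (case x4 nil
        (cons (cons x12 (cons nil nil))
              (cons x10 (cons x8 (cons x1 (cons (cons nil x4) x5))))))))))
bodies ruleIdleᶠ =
  case x1 nil (case x1 nil (case x1 nil (case x1 nil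
    (case x1 nil
      (cons (cons x10 (cons tt′ x8)) (cons x8 (cons x6 (cons x4 (cons x2 x1)))))))))
bodies ruleAssignᶠ =
  case x3 nil (case x1 nil (case x2 nil (case x0 nil (case x4 nil (case x7 nil
    (cons (cons x12 (cons nil x14))
          (cons (cons tt′ (call filtᶠ (x13 ∷ x7 ∷ []))) (cons x3 (cons (cons nil x0) x1)))))))))
bodies ruleᶠ =
  case x0 nil (case x1 nil
    (case x0
      (case x1 (call ruleIdleᶠ (x2 ∷ x5 ∷ [])) (call ruleAssignᶠ (x4 ∷ x0 ∷ x1 ∷ x7 ∷ [])))
      (call ruleHoldᶠ (x4 ∷ x3 ∷ x7 ∷ []))))
bodies consAllᶠ =
  case x1 nil (case x0 nil
    (cons (cons x0 (cons x4 x1)) (call consAllᶠ (x4 ∷ x3 ∷ []))))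
bodies variantsᶠ =
  case x1 nil
    (let-in (call consAllᶠ (x0 ∷ call variantsᶠ (x2 ∷ x1 ∷ []) ∷ []))
      (case (call ruleᶠ (x3 ∷ x1 ∷ [])) x0 (cons (cons x0 (cons x1 x4)) x2)))
bodies resetᶠ =
  case x0 nil (case x0 nil (case x1 nil (case x1 nil (case x1 nil
    (cons (cons x6 (cons x4 (cons x2 (cons x0 x0)))) (call resetᶠ (x9 ∷ [])))))))
bodies tickᶠ =
  case x0 nil (case x0 x4 (case x3 nil
    (case x0
      (case x1 (cons (cons (cons x3 x5) (call resetᶠ (x7 ∷ []))) x8) x10)
      x10)))
bodies succsᶠ =
  case x0 nil (cons x2 (call tickᶠ (x0 ∷ x1 ∷ call variantsᶠ (x0 ∷ x1 ∷ []) ∷ [])))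
bodies addAllᶠ =
  case x0 x1
    (case (call memᶠ (x0 ∷ x3 ∷ []))
      (call addAllᶠ (x1 ∷ cons x0 x3 ∷ []))
      (call addAllᶠ (x3 ∷ x5 ∷ [])))
bodies expandᶠ =
  case x0 x1 (call expandᶠ (x1 ∷ call addAllᶠ (call succsᶠ (x0 ∷ []) ∷ x3 ∷ []) ∷ []))
bodies iterᶠ =
  case x0 x1 (call iterᶠ (x1 ∷ call expandᶠ (x3 ∷ nil ∷ []) ∷ []))
bodies doneᶠ =
  case x0 tt′ (case x0 nil (case x1 nil (case x1 nil
    (case x0 (call doneᶠ (x7 ∷ [])) nil))))
bodies acceptᶠ =
  case x0 nil (case x0 nil (case x0 nil (case x1 nil
    (case x1
      (case (call doneᶠ (x5 ∷ [])) (call acceptᶠ (x7 ∷ [])) tt′)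
      (call acceptᶠ (x9 ∷ []))))))
bodies vertsᶠ =
  case x0 nil (cons (cons x3 x0) (call vertsᶠ (x1 ∷ cons nil x3 ∷ [])))
bodies findᶠ =
  case x1 nil
    (case (call adjᶠ (x2 ∷ x0 ∷ [])) (cons x0 x1)
      (case (call findᶠ (x4 ∷ x3 ∷ [])) nil (cons x0 (cons x4 x1))))
bodies greedyᶠ =
  case x1 (cons x2 x3)
    (case (call eqᶠ (x0 ∷ x2 ∷ []))
      (case (call findᶠ (x0 ∷ x4 ∷ []))
        (call greedyᶠ (x2 ∷ x1 ∷ cons x0 x4 ∷ x5 ∷ []))
        (call greedyᶠ (x4 ∷ x3 ∷ x1 ∷ cons x0 (cons x2 x7) ∷ [])))
      (call greedyᶠ (x4 ∷ x3 ∷ x6 ∷ x7 ∷ [])))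
bodies incᶠ =
  case x0 (cons nil nil) (case x0 (cons tt′ x1) (cons nil (call incᶠ (x3 ∷ []))))
bodies bitsᶠ =
  case x0 nil (call incᶠ (call bitsᶠ (x1 ∷ []) ∷ []))
bodies appendᶠ =
  case x0 x1 (cons x0 (call appendᶠ (x1 ∷ x3 ∷ [])))
bodies takeᶠ =
  case x0 nil (case x3 nil (cons x0 (call takeᶠ (x3 ∷ x1 ∷ []))))
bodies unaryᶠ =
  case x0 nil
    (let-in (call unaryᶠ (x1 ∷ []))
      (let-in (call appendᶠ (x0 ∷ x0 ∷ []))
        (case x2 (cons nil x0) (cons nil (cons nil x2)))))
bodies lenᶠ =
  case x0 nil (cons nil (call lenᶠ (x1 ∷ [])))
bodies baseᶠ =
  case x0 nil
    (cons (cons (cons nil x0) (cons nil (cons tt′ (cons nil nil))))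
      (cons (cons (cons tt′ (cons x0 nil)) (cons x4 (cons nil (cons nil nil))))
        (cons (cons (cons tt′ x3) (cons tt′ (cons nil (cons nil nil))))
          (call baseᶠ (x1 ∷ x3 ∷ x4 ∷ [])))))
bodies solveᶠ =
  let-in (cons x0 x2)
    -- Lists serve as unary counters: this one has the length of the round limit. The digits of the
    -- deadline are cut to this length before the conversion to unary, which on all digits would
    -- take time linear in `t` and hence exponential in the input.
    (let-in (call appendᶠ (x0 ∷ cons nil (call bitsᶠ (x2 ∷ [])) ∷ []))
      (let-in (call takeᶠ (x0 ∷ call unaryᶠ (call takeᶠ (x0 ∷ x5 ∷ []) ∷ []) ∷ []))
        (call acceptᶠ (call iterᶠ
          ( call appendᶠ (x4 ∷ call appendᶠ (x0 ∷ call appendᶠ (x7 ∷ x7 ∷ []) ∷ []) ∷ [])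
          ∷ cons
              (cons (cons x0 (cons nil x4))
                (cons (cons (cons tt′ nil) (cons (call lenᶠ (x4 ∷ [])) (cons nil (cons nil nil))))
                  (cons (cons (cons nil x3) (cons nil (cons nil (cons tt′ nil))))
                    (cons (cons (cons tt′ (cons x3 nil)) (cons x0 (cons nil (cons nil nil))))
                      (cons (cons (cons tt′ x2) (cons tt′ (cons nil (cons nil nil))))
                        (call baseᶠ (x5 ∷ x2 ∷ x0 ∷ [])))))))
              nil
          ∷ []) ∷ []))))

broadcaster : Program
broadcaster = record
  { arity = arities
  ; body  = bodies
  ; main  =
      case x0 nil (case x1 nil
        (let-in (call vertsᶠ (x2 ∷ nil ∷ []))
          (let-in (call nthᶠ (x1 ∷ x0 ∷ []))
            (case (call greedyᶠ (x0 ∷ x1 ∷ nil ∷ nil ∷ [])) nil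
              (call solveᶠ (x2 ∷ x0 ∷ x1 ∷ x5 ∷ x3 ∷ []))))))
  }

-- The value 100 is a round upper bound on the weights of the bodies, checked by computation; it
-- enters the running time as a constant factor.
open CallCounting broadcaster 100
  (from-yes (Fin.all? (λ f → weight (bodies f) ≤? 100))) public

-- Evaluation of the program

-- The ring solver proves equations only; naming the difference `c` reduces an inequality to one.
slack : ∀ {a b} c → a + c ≡ b → a ≤ b
slack {a} c refl = m≤m+n a c

eqᵇ : Tree → Tree → Bool
eqᵇ nil     nil       = true
eqᵇ nil     (_ ∙ _)   = false
eqᵇ (_ ∙ _) nil       = false
eqᵇ (a ∙ b) (a′ ∙ b′) = if eqᵇ a a′ then eqᵇ b b′ else false

-- The comparison descends only where both trees branch, so the first tree alone bounds it. A
-- membership test is therefore charged to the element sought and the length of the list, whatever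
-- the sizes of the entries.
eq-ok : ∀ a b → a ∷ b ∷ [] ⊢ bodies eqᶠ ↦ encodeBool (eqᵇ a b) # 2 * size a
eq-ok nil     nil     = lax (`case-nil `var (`case-nil `var (`cons `nil `nil))) z≤n
eq-ok nil     (_ ∙ _) = lax (`case-nil `var (`case-cons `var `nil)) z≤n
eq-ok (_ ∙ _) nil     = lax (`case-cons `var (`case-nil `var `nil)) z≤n
eq-ok (a ∙ b) (a′ ∙ b′) =
  lax (`case-cons `var (`case-cons `var
        (`if encodeBool (`call (`var `∷ `var `∷ `[]) (eq-ok a a′)) (lax `nil z≤n)
          (`call (`var `∷ `var `∷ `[]) (eq-ok b b′)))))
      (slack 0 (arith (size a) (size b)))
  where
  arith : ∀ x y → suc (2 * x + suc (2 * y)) + 0 ≡ 2 * suc (x + y)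
  arith = solve-∀

nth : ℕ → List Tree → Tree
nth i       []       = nil
nth zero    (a ∷ as) = a
nth (suc i) (a ∷ as) = nth i as

nth-ok : ∀ i as → encodeUnary i ∷ encodeList as ∷ [] ⊢ bodies nthᶠ ↦ nth i as # i
nth-ok zero    []       = `case-nil `var (`case-nil `var `nil)
nth-ok zero    (a ∷ as) = `case-nil `var (`case-cons `var `var)
nth-ok (suc i) []       = lax (`case-cons `var (`case-nil `var `nil)) z≤n
nth-ok (suc i) (a ∷ as) =
  `case-cons `var (`case-cons `var (`call (`var `∷ `var `∷ `[]) (nth-ok i as)))

append-ok : ∀ as bs → encodeList as ∷ encodeList bs ∷ []
                      ⊢ bodies appendᶠ ↦ encodeList (as ++ bs) # length as
append-ok []       bs = `case-nil `var `var
append-ok (a ∷ as) bs =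
  `case-cons `var (`cons `var (`call (`var `∷ `var `∷ `[]) (append-ok as bs)))

take-ok : ∀ ls as → encodeList ls ∷ encodeList as ∷ []
                    ⊢ bodies takeᶠ ↦ encodeList (take (length ls) as) # length ls
take-ok []       as       = `case-nil `var `nil
take-ok (l ∷ ls) []       = lax (`case-cons `var (`case-nil `var `nil)) z≤n
take-ok (l ∷ ls) (a ∷ as) =
  `case-cons `var (`case-cons `var
    (`cons `var (`call (`var `∷ `var `∷ `[]) (take-ok ls as))))

len-ok : ∀ ls → encodeList ls ∷ [] ⊢ bodies lenᶠ ↦ encodeUnary (length ls) # length ls
len-ok []       = `case-nil `var `nil
len-ok (l ∷ ls) = `case-cons `var (`cons `nil (`call (`var `∷ `[]) (len-ok ls)))

encodeBits : List Bool → Tree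
encodeBits ds = encodeList (map encodeBool ds)

value : List Bool → ℕ
value []           = 0
value (false ∷ ds) = 1 + (value ds + value ds)
value (true ∷ ds)  = 2 + (value ds + value ds)

encodeUnary-+ : ∀ m n → encodeList (replicate m nil ++ replicate n nil) ≡ encodeUnary (m + n)
encodeUnary-+ zero    n = refl
encodeUnary-+ (suc m) n = cong (nil ∙_) (encodeUnary-+ m n)

length-units : ∀ n → length (replicate {A = Tree} n nil) ≡ n
length-units zero    = refl
length-units (suc n) = cong suc (length-units n)

append-unary-ok : ∀ m n → encodeUnary m ∷ encodeUnary n ∷ []
                          ⊢ bodies appendᶠ ↦ encodeUnary (m + n) # m
append-unary-ok m n =
  subst₂ (λ a c → encodeUnary m ∷ encodeUnary n ∷ [] ⊢ bodies appendᶠ ↦ a # c)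
    (encodeUnary-+ m n) (length-units m)
    (append-ok (replicate m nil) (replicate n nil))

-- Appending at a digit costs the value of the digits after it, which at least halves from one digit
-- to the next; the costs form a geometric series.
unary-ok : ∀ ds → encodeBits ds ∷ [] ⊢ bodies unaryᶠ ↦ encodeUnary (value ds) # 2 * value ds
unary-ok []           = `case-nil `var `nil
unary-ok (false ∷ ds) =
  lax (`case-cons `var
        (`let (`call (`var `∷ `[]) (unary-ok ds))
          (`let (`call (`var `∷ `var `∷ `[]) (append-unary-ok (value ds) (value ds)))
            (`case-nil `var (`cons `nil `var)))))
      (slack (value ds) (arith (value ds)))
  where
  arith : ∀ x → suc (2 * x + suc (x + 0)) + x ≡ 2 * (1 + (x + x))
  arith = solve-∀
unary-ok (true ∷ ds) =
  lax (`case-cons `var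
        (`let (`call (`var `∷ `[]) (unary-ok ds))
          (`let (`call (`var `∷ `var `∷ `[]) (append-unary-ok (value ds) (value ds)))
            (`case-cons `var (`cons `nil (`cons `nil `var))))))
      (slack (2 + value ds) (arith (value ds)))
  where
  arith : ∀ x → suc (2 * x + suc (x + 0)) + (2 + x) ≡ 2 * (2 + (x + x))
  arith = solve-∀

inc : List Bool → List Bool
inc []           = false ∷ []
inc (false ∷ ds) = true ∷ ds
inc (true ∷ ds)  = false ∷ inc ds

bits : ℕ → List Bool
bits zero    = []
bits (suc n) = inc (bits n)

inc-ok : ∀ ds → encodeBits ds ∷ [] ⊢ bodies incᶠ ↦ encodeBits (inc ds) # length ds
inc-ok []           = `case-nil `var (`cons `nil `nil)
inc-ok (false ∷ ds) = lax (`case-cons `var (`case-nil `var (`cons (`cons `nil `nil) `var))) z≤n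
inc-ok (true ∷ ds)  =
  `case-cons `var (`case-cons `var (`cons `nil (`call (`var `∷ `[]) (inc-ok ds))))

length-inc : ∀ ds → length (inc ds) ≤ suc (length ds)
length-inc []           = ≤-refl
length-inc (false ∷ ds) = n≤1+n _
length-inc (true ∷ ds)  = s≤s (length-inc ds)

-- Crude, but enough wherever a polynomial is wanted; the logarithmic estimate is `2^length≤`.
length-bits : ∀ n → length (bits n) ≤ n
length-bits zero    = z≤n
length-bits (suc n) = ≤-trans (length-inc (bits n)) (s≤s (length-bits n))

bits-ok : ∀ ls → encodeList ls ∷ [] ⊢ bodies bitsᶠ
                 ↦ encodeBits (bits (length ls)) # length ls * (2 + length ls)
bits-ok []       = `case-nil `var `nil
bits-ok (l ∷ ls) =
  lax (`case-cons `var
        (`call (`call (`var `∷ `[]) (bits-ok ls) `∷ `[])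
          (lax (inc-ok (bits (length ls))) (length-bits (length ls)))))
      (slack (suc (length ls)) (arith (length ls)))
  where
  arith : ∀ x → suc (suc (x * (2 + x) + 0) + x) + suc x ≡ suc x * (2 + suc x)
  arith = solve-∀

memᵇ : ∀ {A : Set} → (A → Tree) → A → List A → Bool
memᵇ enc x []       = false
memᵇ enc x (y ∷ ys) = if eqᵇ (enc x) (enc y) then true else memᵇ enc x ys

mem-ok : ∀ {A : Set} (enc : A → Tree) x ys → enc x ∷ encodeList (map enc ys) ∷ []
         ⊢ bodies memᶠ ↦ encodeBool (memᵇ enc x ys) # length ys * (2 + 2 * size (enc x))
mem-ok enc x []       = `case-nil `var `nil
mem-ok enc x (y ∷ ys) =
  lax (`case-cons `var
        (`if encodeBool (`call (`var `∷ `var `∷ `[]) (eq-ok (enc x) (enc y)))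
          (`call (`var `∷ `var `∷ `[]) (mem-ok enc x ys))
          (lax (`cons `nil `nil) z≤n)))
      (≤-reflexive (cong suc (+-suc _ _)))

select : ∀ {A : Set} → (A → Bool) → List A → List A
select p []       = []
select p (x ∷ xs) = if p x then x ∷ select p xs else select p xs

size-head : ∀ a b → size a ≤ size (a ∙ b)
size-head a b = m≤n⇒m≤1+n (m≤m+n (size a) (size b))

size-tail : ∀ a b → size b ≤ size (a ∙ b)
size-tail a b = m≤n⇒m≤1+n (m≤n+m (size b) (size a))

length≤size : ∀ as → length as ≤ size (encodeList as)
length≤size []       = z≤n
length≤size (a ∷ as) = s≤s (≤-trans (length≤size as) (m≤n+m _ (size a)))

length-map≤size : ∀ {A : Set} (enc : A → Tree) xs → length xs ≤ size (encodeList (map enc xs))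
length-map≤size enc xs = subst (_≤ size (encodeList (map enc xs))) (length-map enc xs) (length≤size (map enc xs))

-- States of the search and its single moves

module Machine {v : ℕ} (G : Graph v) where
  open Graph G

  -- pt x describes the vertex x of X, cl σ the vertices of K that may exchange
  -- calls with the vertices σ of X only.
  data Desc : Set where
    pt : Fin v → Desc
    cl : List (Fin v) → Desc

  -- The state of one label: room more vertices may be given it, uninf and inf of
  -- those carrying it are uninformed and informed, and avail of the latter may
  -- still call in the current round.
  record Cell : Set where
    constructor cell
    field
      desc : Desc
      room uninf inf avail : ℕ
  open Cell public

  -- In mode assign vs the vertices vs have yet to be labelled; assign [] is also the
  -- mode between two calls, and hold d that of a call whose caller is described by d.
  data Mode : Set where
    assign : List (Fin v) → Mode
    hold   : Desc → Mode

  Ctl State : Set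
  Ctl   = ℕ × Mode
  State = Ctl × List Cell

  -- A vertex carries its own row of the adjacency matrix, so an adjacency test is one lookup and no
  -- function needs the whole matrix as an argument.
  encodeRow encV : Fin v → Tree
  encodeRow x = encodeList (map (λ y → encodeBool (adj x y)) (allFin v))
  encV x = encodeUnary (toℕ x) ∙ encodeRow x

  encVs : List (Fin v) → Tree
  encVs xs = encodeList (map encV xs)

  encDesc : Desc → Tree
  encDesc (pt x) = nil ∙ encV x
  encDesc (cl σ) = (nil ∙ nil) ∙ encVs σ

  encCell : Cell → Tree
  encCell (cell d o u i a) =
    encDesc d ∙ encodeUnary o ∙ encodeUnary u ∙ encodeUnary i ∙ encodeUnary a

  encMode : Mode → Tree
  encMode (assign vs) = nil ∙ encVs vs
  encMode (hold d)    = (nil ∙ nil) ∙ encDesc d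

  encCtl : Ctl → Tree
  encCtl (r , m) = encodeUnary r ∙ encMode m

  encCells : List Cell → Tree
  encCells cs = encodeList (map encCell cs)

  encState : State → Tree
  encState (c , cs) = encCtl c ∙ encCells cs

  -- Two vertices described by `cl` lie in the clique, and they are distinct because the caller is
  -- informed and the callee is not; such a call is always possible.
  edge : Desc → Desc → Bool
  edge (pt x) (pt y) = adj x y
  edge (pt x) (cl σ) = memᵇ encV x σ
  edge (cl σ) (pt x) = memᵇ encV x σ
  edge (cl σ) (cl τ) = true

  -- Every move touches a single cell. For this reason a call is split in two, the choice of a
  -- caller and the choice of a callee, with the description of the caller held in the mode in
  -- between.
  rule : Ctl → Cell → Maybe (Ctl × Cell)
  rule (r , assign []) (cell d o u i zero) = nothing
  rule (r , assign []) (cell d o u i (suc a)) = just ((r , hold d) , cell d o u i a)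
  rule (r , assign (x ∷ xs)) (cell (pt y) o u i a) = nothing
  rule (r , assign (x ∷ xs)) (cell (cl σ) zero u i a) = nothing
  rule (r , assign (x ∷ xs)) (cell (cl σ) (suc o) u i a) =
    just ((r , assign xs) , cell (cl (select (adj x) σ)) o (suc u) i a)
  rule (r , hold h) (cell d o zero i a) = nothing
  rule (r , hold h) (cell d o (suc u) i a) =
    if edge h d then just ((r , assign []) , cell d o u (suc i) a) else nothing

  consAll : Cell → List State → List State
  consAll c []              = []
  consAll c ((k , cs) ∷ ss) = (k , c ∷ cs) ∷ consAll c ss

  addVariant : Maybe (Ctl × Cell) → List Cell → List State → List State
  addVariant nothing        cs ss = ss
  addVariant (just (k , c)) cs ss = (k , c ∷ cs) ∷ ss

  variants : Ctl → List Cell → List State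
  variants k []       = []
  variants k (c ∷ cs) = addVariant (rule k c) cs (consAll c (variants k cs))

  reset : Cell → Cell
  reset (cell d o u i a) = cell d o u i i

  -- A round begins only when every vertex has its label and no caller is waiting for a callee; `r`
  -- counts the rounds that have not begun.
  tick : Ctl → List Cell → List State → List State
  tick (suc r , assign []) cs ss = ((r , assign []) , map reset cs) ∷ ss
  tick _                   cs ss = ss

  -- A state is its own successor. Thus the states reached in at most `n` moves are those reached in
  -- exactly `n`, and an accepting state is never lost when the next layer is computed from scratch.
  succs : State → List State
  succs (k , cs) = (k , cs) ∷ tick k cs (variants k cs)

  nth-tabulate : ∀ {n} (f : Fin n → Tree) i → nth (toℕ i) (Data.List.tabulate f) ≡ f i
  nth-tabulate f zero    = refl
  nth-tabulate f (suc i) = nth-tabulate (f ∘ suc) i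

  nth-row : ∀ (f : Fin v → Tree) y → nth (toℕ y) (map f (allFin v)) ≡ f y
  nth-row f y = trans (cong (nth (toℕ y)) (map-tabulate id f)) (nth-tabulate f y)

  adj-ok : ∀ x y → encV x ∷ encV y ∷ [] ⊢ bodies adjᶠ ↦ encodeBool (adj x y) # v
  adj-ok x y =
    lax (`case-cons `var (`case-cons `var (`call (`var `∷ `var `∷ `[])
          (subst (λ a → encodeUnary (toℕ y) ∷ encodeRow x ∷ [] ⊢ bodies nthᶠ ↦ a # toℕ y)
            (nth-row (λ z → encodeBool (adj x z)) y)
            (nth-ok (toℕ y) (map (λ z → encodeBool (adj x z)) (allFin v)))))))
        (toℕ<n y)

  filt-ok : ∀ x σ → encV x ∷ encVs σ ∷ []
            ⊢ bodies filtᶠ ↦ encVs (select (adj x) σ) # length σ * (2 + v)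
  filt-ok x []      = `case-nil `var `nil
  filt-ok x (y ∷ σ) =
    lax (`case-cons `var
          (`if encVs (`call (`var `∷ `var `∷ `[]) (adj-ok x y))
            (`call (`var `∷ `var `∷ `[]) (filt-ok x σ))
            (`cons `var (`call (`var `∷ `var `∷ `[]) (filt-ok x σ)))))
        (≤-reflexive (cong suc (+-suc _ _)))

  size-pt : ∀ x → size (encV x) ≤ size (encDesc (pt x))
  size-pt x = size-tail nil (encV x)

  length-cl : ∀ σ → length σ ≤ size (encDesc (cl σ))
  length-cl σ = ≤-trans (length-map≤size encV σ) (size-tail (nil ∙ nil) (encVs σ))

  size-desc : ∀ c → size (encDesc (desc c)) ≤ size (encCell c)
  size-desc (cell d o u i a) =
    size-head (encDesc d) (encodeUnary o ∙ encodeUnary u ∙ encodeUnary i ∙ encodeUnary a)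

  size-mode : ∀ r m → size (encMode m) ≤ size (encCtl (r , m))
  size-mode r m = size-tail (encodeUnary r) (encMode m)

  consAll-ok : ∀ c ss → encCell c ∷ encodeList (map encState ss) ∷ []
               ⊢ bodies consAllᶠ ↦ encodeList (map encState (consAll c ss)) # length ss
  consAll-ok c []              = `case-nil `var `nil
  consAll-ok c ((k , cs) ∷ ss) =
    `case-cons `var (`case-cons `var
      (`cons (`cons `var (`cons `var `var)) (`call (`var `∷ `var `∷ `[]) (consAll-ok c ss))))

  reset-ok : ∀ cs → encCells cs ∷ [] ⊢ bodies resetᶠ ↦ encCells (map reset cs) # length cs
  reset-ok []                      = `case-nil `var `nil
  reset-ok (cell d o u i a ∷ cs) =
    `case-cons `var (`case-cons `var (`case-cons `var (`case-cons `var (`case-cons `var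
      (`cons (`cons `var (`cons `var (`cons `var (`cons `var `var))))
             (`call (`var `∷ `[]) (reset-ok cs)))))))

  length-consAll : ∀ c ss → length (consAll c ss) ≡ length ss
  length-consAll c []              = refl
  length-consAll c ((k , cs) ∷ ss) = cong suc (length-consAll c ss)

  length-variants : ∀ k cs → length (variants k cs) ≤ length cs
  length-variants k []       = z≤n
  length-variants k (c ∷ cs) with rule k c
  ... | nothing = ≤-trans (≤-reflexive (length-consAll c (variants k cs))) (m≤n⇒m≤1+n (length-variants k cs))
  ... | just _  = s≤s (≤-trans (≤-reflexive (length-consAll c (variants k cs))) (length-variants k cs))

  length-succs : ∀ k cs → length (succs (k , cs)) ≤ 2 + length cs
  length-succs k@(zero , _)              cs = s≤s (m≤n⇒m≤1+n (length-variants k cs))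
  length-succs k@(suc _ , assign [])      cs = s≤s (s≤s (length-variants k cs))
  length-succs k@(suc _ , assign (_ ∷ _)) cs = s≤s (m≤n⇒m≤1+n (length-variants k cs))
  length-succs k@(suc _ , hold _)         cs = s≤s (m≤n⇒m≤1+n (length-variants k cs))

  -- With a single bound `Z` for `v` and for all sizes, every cost becomes a polynomial in `Z`.
  module StepCost (Z : ℕ) (v≤Z : v ≤ Z) where

    memCost edgeCost filtCost ruleCost variantsCost succsCost : ℕ
    memCost  = Z * (2 + 2 * Z)
    edgeCost = 1 + (Z + memCost)
    filtCost = Z * (2 + Z)
    ruleCost = 1 + (edgeCost + suc filtCost)
    variantsCost = Z * (3 + (Z + ruleCost))
    succsCost = 3 + (Z + variantsCost)

    mem≤ : ∀ {A : Set} (enc : A → Tree) x (ys : List A) → length ys ≤ Z → size (enc x) ≤ Z →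
           length ys * (2 + 2 * size (enc x)) ≤ memCost
    mem≤ enc x ys ys≤ x≤ = *-mono-≤ ys≤ (+-monoʳ-≤ 2 (*-monoʳ-≤ 2 x≤))

    edge-ok : ∀ d e → size (encDesc d) ≤ Z → size (encDesc e) ≤ Z →
              encDesc d ∷ encDesc e ∷ [] ⊢ bodies edgeᶠ ↦ encodeBool (edge d e) # edgeCost
    edge-ok (pt x) (pt y) d≤ e≤ =
      lax (`case-cons `var (`case-cons `var (`case-nil `var (`case-nil `var
            (`call (`var `∷ `var `∷ `[]) (adj-ok x y))))))
          (s≤s (≤-trans v≤Z (m≤m+n Z memCost)))
    edge-ok (pt x) (cl σ) d≤ e≤ =
      lax (`case-cons `var (`case-cons `var (`case-nil `var (`case-cons `var
            (`call (`var `∷ `var `∷ `[]) (mem-ok encV x σ))))))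
          (s≤s (≤-trans (mem≤ encV x σ (≤-trans (length-cl σ) e≤) (≤-trans (size-pt x) d≤))
                        (m≤n+m memCost Z)))
    edge-ok (cl σ) (pt x) d≤ e≤ =
      lax (`case-cons `var (`case-cons `var (`case-cons `var (`case-nil `var
            (`call (`var `∷ `var `∷ `[]) (mem-ok encV x σ))))))
          (s≤s (≤-trans (mem≤ encV x σ (≤-trans (length-cl σ) d≤) (≤-trans (size-pt x) e≤))
                        (m≤n+m memCost Z)))
    edge-ok (cl σ) (cl τ) d≤ e≤ =
      lax (`case-cons `var (`case-cons `var (`case-cons `var (`case-cons `var
            (`cons `nil `nil))))) z≤n

    encRule : Maybe (Ctl × Cell) → Tree
    encRule nothing        = nil
    encRule (just (k , c)) = encCtl k ∙ encCell c

    rule-ok : ∀ k c → size (encCtl k) ≤ Z → size (encCell c) ≤ Z →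
              encCtl k ∷ encCell c ∷ [] ⊢ bodies ruleᶠ ↦ encRule (rule k c) # ruleCost
    rule-ok (r , assign []) (cell d o u i zero) k≤ c≤ =
      lax (`case-cons `var (`case-cons `var (`case-nil `var (`case-nil `var
            (`call (`var `∷ `var `∷ `[])
              (`case-cons `var (`case-cons `var (`case-cons `var (`case-cons `var
                (`case-nil `var `nil)))))))))) (s≤s z≤n)
    rule-ok (r , assign []) (cell d o u i (suc a)) k≤ c≤ =
      lax (`case-cons `var (`case-cons `var (`case-nil `var (`case-nil `var
            (`call (`var `∷ `var `∷ `[])
              (`case-cons `var (`case-cons `var (`case-cons `var (`case-cons `var
                (`case-cons `var
                  (`cons (`cons `var (`cons (`cons `nil `nil) `var))
                    (`cons `var (`cons `var (`cons `var (`cons `var `var)))))))))))))))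
          (s≤s z≤n)
    rule-ok (r , assign (x ∷ xs)) (cell (pt y) o u i a) k≤ c≤ =
      lax (`case-cons `var (`case-cons `var (`case-nil `var (`case-cons `var
            (`call (`var `∷ `var `∷ `var `∷ `var `∷ `[])
              (`case-cons `var (`case-cons `var (`case-cons `var (`case-nil `var `nil)))))))))
          (s≤s z≤n)
    rule-ok (r , assign (x ∷ xs)) (cell (cl σ) zero u i a) k≤ c≤ =
      lax (`case-cons `var (`case-cons `var (`case-nil `var (`case-cons `var
            (`call (`var `∷ `var `∷ `var `∷ `var `∷ `[])
              (`case-cons `var (`case-cons `var (`case-cons `var (`case-cons `var
                (`case-nil `var `nil))))))))))
          (s≤s z≤n)
    rule-ok (r , assign (x ∷ xs)) (cell (cl σ) (suc o) u i a) k≤ c≤ =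
      lax (`case-cons `var (`case-cons `var (`case-nil `var (`case-cons `var
            (`call (`var `∷ `var `∷ `var `∷ `var `∷ `[])
              (`case-cons `var (`case-cons `var (`case-cons `var (`case-cons `var
                (`case-cons `var (`case-cons `var
                  (`cons (`cons `var (`cons `nil `var))
                    (`cons (`cons (`cons `nil `nil)
                                  (`call (`var `∷ `var `∷ `[]) (filt-ok x σ)))
                      (`cons `var (`cons (`cons `nil `var) `var)))))))))))))))
          (s≤s (≤-trans (≤-reflexive (+-identityʳ _)) (≤-trans (s≤s filt≤) (m≤n+m _ edgeCost))))
      where
      filt≤ : length σ * (2 + v) ≤ filtCost
      filt≤ = *-mono-≤ (≤-trans (length-cl σ) (≤-trans (size-desc (cell (cl σ) (suc o) u i a)) c≤)) (+-monoʳ-≤ 2 v≤Z)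
    rule-ok (r , hold h) (cell d o u i a) k≤ c≤ =
      lax (`case-cons `var (`case-cons `var (`case-cons `var
            (`call (`var `∷ `var `∷ `var `∷ `[])
              (`case-cons `var (`case-cons `var (`case-cons `var (`case-cons `var
                (held u)))))))))
          (s≤s (+-monoʳ-≤ edgeCost (s≤s z≤n)))
      where
      h≤ : size (encDesc h) ≤ Z
      h≤ = ≤-trans (size-tail (nil ∙ nil) (encDesc h)) (≤-trans (size-mode r (hold h)) k≤)
      d≤ : size (encDesc d) ≤ Z
      d≤ = ≤-trans (size-desc (cell d o u i a)) c≤
      held : ∀ u → encodeUnary i ∷ encodeUnary a ∷ encodeUnary u ∷ (encodeUnary i ∙ encodeUnary a)
                   ∷ encodeUnary o ∷ (encodeUnary u ∙ encodeUnary i ∙ encodeUnary a) ∷ encDesc d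
                   ∷ (encodeUnary o ∙ encodeUnary u ∙ encodeUnary i ∙ encodeUnary a)
                   ∷ encodeUnary r ∷ encDesc h ∷ encCell (cell d o u i a) ∷ []
                   ⊢ case (call edgeᶠ (x9 ∷ x6 ∷ [])) nil (case x4 nil
                       (cons (cons x12 (cons nil nil))
                         (cons x10 (cons x8 (cons x1 (cons (cons nil x4) x5))))))
                   ↦ encRule (rule (r , hold h) (cell d o u i a)) # edgeCost + 1
      -- The program tests the edge before the counter, `rule` the counter before the edge; when no
      -- uninformed vertex is left, both give `nothing` for either outcome of the edge test.
      held zero with edge h d | edge-ok h d h≤ d≤
      ... | false | e = lax (`case-nil (`call (`var `∷ `var `∷ `[]) e) `nil) (≤-reflexive (trans (+-identityʳ _) (+-comm 1 _)))
      ... | true  | e = lax (`case-cons (`call (`var `∷ `var `∷ `[]) e) (`case-nil `var `nil))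
                            (≤-reflexive (trans (+-identityʳ _) (+-comm 1 _)))
      held (suc u) =
        lax (`if encRule (`call (`var `∷ `var `∷ `[]) (edge-ok h d h≤ d≤)) `nil
              (`case-cons `var
                (`cons (`cons `var (`cons `nil `nil))
                  (`cons `var (`cons `var (`cons `var (`cons (`cons `nil `var) `var)))))))
            (≤-reflexive (trans (+-identityʳ _) (+-comm 1 _)))

    variants-ok : ∀ k cs → size (encCtl k) ≤ Z → size (encCells cs) ≤ Z →
                  encCtl k ∷ encCells cs ∷ [] ⊢ bodies variantsᶠ
                  ↦ encodeList (map encState (variants k cs)) # length cs * (3 + (Z + ruleCost))
    variants-ok k []       k≤ cs≤ = `case-nil `var `nil
    variants-ok k (c ∷ cs) k≤ cs≤ =
      lax (`case-cons `var
            (`let (`call (`var `∷ `call (`var `∷ `var `∷ `[]) (variants-ok k cs k≤ cs′≤) `∷ `[])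
                    (lax (consAll-ok c (variants k cs)) len≤))
                  (choose (rule k c) (rule-ok k c k≤ (≤-trans (size-head (encCell c) (encCells cs)) cs≤)))))
          (slack 0 (arith (length cs * (3 + (Z + ruleCost))) Z ruleCost))
      where
      cs′≤ : size (encCells cs) ≤ Z
      cs′≤ = ≤-trans (size-tail (encCell c) (encCells cs)) cs≤
      len≤ : length (variants k cs) ≤ Z
      len≤ = ≤-trans (length-variants k cs) (≤-trans (length-map≤size encCell cs) cs′≤)
      arith : ∀ n z r → suc (suc (n + 0) + z) + (suc r + 0) + 0 ≡ 3 + (z + r) + n
      arith = solve-∀
      ss = consAll c (variants k cs)
      choose : ∀ m → encCtl k ∷ encCell c ∷ [] ⊢ bodies ruleᶠ ↦ encRule m # ruleCost →
               encodeList (map encState ss) ∷ encCell c ∷ encCells cs ∷ encCtl k ∷ encCells (c ∷ cs) ∷ []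
               ⊢ case (call ruleᶠ (x3 ∷ x1 ∷ [])) x0 (cons (cons x0 (cons x1 x4)) x2)
               ↦ encodeList (map encState (addVariant m cs ss)) # suc ruleCost + 0
      choose nothing        d = `case-nil (`call (`var `∷ `var `∷ `[]) d) `var
      choose (just (_ , _)) d =
        `case-cons (`call (`var `∷ `var `∷ `[]) d) (`cons (`cons `var (`cons `var `var)) `var)

eqᵇ-refl : ∀ a → eqᵇ a a ≡ true
eqᵇ-refl nil = refl
eqᵇ-refl (a ∙ b) rewrite eqᵇ-refl a = eqᵇ-refl b

memᵇ-false : ∀ {A : Set} (enc : A → Tree) x ys → memᵇ enc x ys ≡ false → All (x ≢_) ys
memᵇ-false enc x []       _ = []
memᵇ-false enc x (y ∷ ys) p with eqᵇ (enc x) (enc y) in eq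
... | false = (λ { refl → case-⊥ (trans (sym (eqᵇ-refl (enc x))) eq) }) ∷ memᵇ-false enc x ys p
  where
  case-⊥ : true ≡ false → _
  case-⊥ ()

-- Breadth-first exploration and its cost

module Search {v : ℕ} (G : Graph v) where
  open Machine G

  addAll : List State → List State → List State
  addAll []       set = set
  addAll (s ∷ ss) set = if memᵇ encState s set then addAll ss set else addAll ss (s ∷ set)

  expand : List State → List State → List State
  expand []        acc = acc
  expand (s ∷ set) acc = expand set (addAll (succs s) acc)

  iter : ℕ → List State → List State
  iter zero    set = set
  iter (suc n) set = iter n (expand set [])

  allInformed : List Cell → Bool
  allInformed []                        = true
  allInformed (cell d o zero i a ∷ cs)    = allInformed cs
  allInformed (cell d o (suc u) i a ∷ cs) = false

  -- Vertices without a label occur in no cell, so a state that still has some must be rejected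
  -- whatever its cells say.
  accepting : State → Bool
  accepting ((r , assign []) , cs)      = allInformed cs
  accepting ((r , assign (_ ∷ _)) , cs) = false
  accepting ((r , hold _) , cs)         = false

  acceptAny : List State → Bool
  acceptAny []       = false
  acceptAny (s ∷ ss) = if accepting s then true else acceptAny ss

  encStates : List State → Tree
  encStates ss = encodeList (map encState ss)

  tick-ok : ∀ k cs ss → encCtl k ∷ encCells cs ∷ encStates ss ∷ [] ⊢ bodies tickᶠ
            ↦ encStates (tick k cs ss) # suc (length cs)
  tick-ok (zero , m) cs ss = lax (`case-cons `var (`case-nil `var `var)) z≤n
  tick-ok (suc r , assign []) cs ss =
    lax (`case-cons `var (`case-cons `var (`case-cons `var (`case-nil `var (`case-nil `var
          (`cons (`cons (`cons `var `var) (`call (`var `∷ `[]) (reset-ok cs))) `var))))))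
        (≤-reflexive (+-identityʳ _))
  tick-ok (suc r , assign (x ∷ xs)) cs ss =
    lax (`case-cons `var (`case-cons `var (`case-cons `var (`case-nil `var (`case-cons `var `var)))))
        z≤n
  tick-ok (suc r , hold d) cs ss =
    lax (`case-cons `var (`case-cons `var (`case-cons `var (`case-cons `var `var)))) z≤n

  allInformed-ok : ∀ cs → encCells cs ∷ [] ⊢ bodies doneᶠ
                   ↦ encodeBool (allInformed cs) # length cs
  allInformed-ok [] = `case-nil `var (`cons `nil `nil)
  allInformed-ok (cell d o zero i a ∷ cs) =
    `case-cons `var (`case-cons `var (`case-cons `var (`case-cons `var
      (`case-nil `var (`call (`var `∷ `[]) (allInformed-ok cs))))))
  allInformed-ok (cell d o (suc u) i a ∷ cs) =
    lax (`case-cons `var (`case-cons `var (`case-cons `var (`case-cons `var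
          (`case-cons `var `nil))))) z≤n

  -- An invariant stands in for the set of reachable states. `inv-length` is where the removal of
  -- duplicates pays: with repetitions the layers could grow exponentially in the number of moves.
  module SearchCost (Z : ℕ) (v≤Z : v ≤ Z) (Inv : State → Set)
      (inv-succs  : ∀ {s s′} → Inv s → s′ ∈ succs s → Inv s′)
      (inv-size   : ∀ {s} → Inv s → size (encState s) ≤ Z)
      (inv-length : ∀ ss → Unique ss → All Inv ss → length ss ≤ Z) where
    open StepCost Z v≤Z

    length-cells : ∀ k cs → Inv (k , cs) → length cs ≤ Z
    length-cells k cs inv =
      ≤-trans (length-map≤size encCell cs)
        (≤-trans (size-tail (encCtl k) (encCells cs)) (inv-size inv))

    succs-ok : ∀ s → Inv s → encState s ∷ [] ⊢ bodies succsᶠ ↦ encStates (succs s) # succsCost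
    succs-ok (k , cs) inv =
      lax (`case-cons `var
            (`cons `var
              (`call (`var `∷ `var `∷ `call (`var `∷ `var `∷ `[])
                       (lax (variants-ok k cs k≤ cs≤) (*-monoˡ-≤ (3 + (Z + ruleCost)) len)) `∷ `[])
                (lax (tick-ok k cs (variants k cs)) (s≤s len)))))
          (slack 0 (arith variantsCost Z))
      where
      k≤ : size (encCtl k) ≤ Z
      k≤ = ≤-trans (size-head (encCtl k) (encCells cs)) (inv-size inv)
      cs≤ : size (encCells cs) ≤ Z
      cs≤ = ≤-trans (size-tail (encCtl k) (encCells cs)) (inv-size inv)
      len : length cs ≤ Z
      len = length-cells k cs inv
      arith : ∀ x z → suc (suc (x + 0) + suc z) + 0 ≡ 3 + (z + x)
      arith = solve-∀

    addAllCost expandCost iterCost acceptCost : ℕ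
    addAllCost = (2 + Z) * (2 + memCost)
    expandCost = 3 + (succsCost + addAllCost)
    iterCost = 2 + Z * expandCost
    acceptCost = Z * (2 + Z)

    addAll-all : ∀ {P : State → Set} ss set → All P ss → All P set → All P (addAll ss set)
    addAll-all []       set _          Pset = Pset
    addAll-all (s ∷ ss) set (Ps ∷ Pss) Pset with memᵇ encState s set
    ... | true  = addAll-all ss set Pss Pset
    ... | false = addAll-all ss (s ∷ set) Pss (Ps ∷ Pset)

    addAll-unique : ∀ ss set → Unique set → Unique (addAll ss set)
    addAll-unique []       set uq = uq
    addAll-unique (s ∷ ss) set uq with memᵇ encState s set in eq
    ... | true  = addAll-unique ss set uq
    ... | false = addAll-unique ss (s ∷ set) (memᵇ-false encState s set eq ∷ uq)

    addAll-ok : ∀ ss set → All Inv ss → All Inv set → Unique set →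
                encStates ss ∷ encStates set ∷ [] ⊢ bodies addAllᶠ
                ↦ encStates (addAll ss set) # length ss * (2 + memCost)
    addAll-ok []       set _         _  _  = `case-nil `var `var
    addAll-ok (s ∷ ss) set (is ∷ iss) iset uq =
      lax (`case-cons `var (choose (memᵇ encState s set) refl
            (lax (mem-ok encState s set)
                 (mem≤ encState s set (inv-length set uq iset) (inv-size is)))))
          (≤-reflexive (cong suc (+-suc memCost _)))
      where
      choose : ∀ b → memᵇ encState s set ≡ b →
               encState s ∷ encStates set ∷ [] ⊢ bodies memᶠ ↦ encodeBool b # memCost →
               encState s ∷ encStates ss ∷ encStates (s ∷ ss) ∷ encStates set ∷ []
               ⊢ case (call memᶠ (x0 ∷ x3 ∷ []))
                   (call addAllᶠ (x1 ∷ cons x0 x3 ∷ [])) (call addAllᶠ (x3 ∷ x5 ∷ []))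
               ↦ encStates (if b then addAll ss set else addAll ss (s ∷ set))
               # suc memCost + suc (length ss * (2 + memCost))
      choose true  eq d = `case-cons (`call (`var `∷ `var `∷ `[]) d)
        (`call (`var `∷ `var `∷ `[]) (addAll-ok ss set iss iset uq))
      choose false eq d = `case-nil (`call (`var `∷ `var `∷ `[]) d)
        (`call (`var `∷ `cons `var `var `∷ `[])
          (addAll-ok ss (s ∷ set) iss (is ∷ iset) (memᵇ-false encState s set eq ∷ uq)))

    inv-all : ∀ {s} → Inv s → All Inv (succs s)
    inv-all inv = All.tabulate (inv-succs inv)

    expand-all : ∀ set acc → All Inv set → All Inv acc → All Inv (expand set acc)
    expand-all []        acc _          iacc = iacc
    expand-all (s ∷ set) acc (is ∷ iset) iacc =
      expand-all set _ iset (addAll-all (succs s) acc (inv-all is) iacc)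

    expand-unique : ∀ set acc → Unique acc → Unique (expand set acc)
    expand-unique []        acc uq = uq
    expand-unique (s ∷ set) acc uq = expand-unique set _ (addAll-unique (succs s) acc uq)

    iter-all : ∀ n set → All Inv set → All Inv (iter n set)
    iter-all zero    set iset = iset
    iter-all (suc n) set iset = iter-all n _ (expand-all set [] iset [])

    iter-unique : ∀ n set → Unique set → Unique (iter n set)
    iter-unique zero    set uq = uq
    iter-unique (suc n) set uq = iter-unique n _ (expand-unique set [] [])

    expand-ok : ∀ set acc → All Inv set → All Inv acc → Unique acc →
                encStates set ∷ encStates acc ∷ [] ⊢ bodies expandᶠ
                ↦ encStates (expand set acc) # length set * expandCost
    expand-ok []               acc _           _    _  = `case-nil `var `var
    expand-ok (s@(k , cs) ∷ set) acc (is ∷ iset) iacc uq =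
      lax (`case-cons `var
            (`call (`var `∷ `call (`call (`var `∷ `[]) (succs-ok s is) `∷ `var `∷ `[])
                      (lax (addAll-ok (succs s) acc (inv-all is) iacc uq)
                           (*-monoˡ-≤ (2 + memCost) len)) `∷ `[])
              (expand-ok set _ iset (addAll-all (succs s) acc (inv-all is) iacc)
                         (addAll-unique (succs s) acc uq))))
          (slack 0 (arith succsCost addAllCost (length set * expandCost)))
      where
      len : length (succs s) ≤ 2 + Z
      len = ≤-trans (length-succs k cs) (s≤s (s≤s (length-cells k cs is)))
      arith : ∀ x y z → suc (suc (suc (x + 0) + y + 0) + z) + 0 ≡ 3 + (x + y) + z
      arith = solve-∀

    iter-ok : ∀ ls set → All Inv set → Unique set →
              encodeList ls ∷ encStates set ∷ [] ⊢ bodies iterᶠ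
              ↦ encStates (iter (length ls) set) # length ls * iterCost
    iter-ok []       set _    _  = `case-nil `var `var
    iter-ok (l ∷ ls) set iset uq =
      lax (`case-cons `var
            (`call (`var `∷ `call (`var `∷ `nil `∷ `[])
                      (lax (expand-ok set [] iset [] [])
                           (*-monoˡ-≤ expandCost (inv-length set uq iset))) `∷ `[])
              (iter-ok ls _ (expand-all set [] iset []) (expand-unique set [] []))))
          (slack 0 (arith (Z * expandCost) (length ls * iterCost)))
      where
      arith : ∀ x y → suc (suc (x + 0) + y) + 0 ≡ 2 + x + y
      arith = solve-∀

    accept-ok : ∀ ss → All Inv ss → encStates ss ∷ [] ⊢ bodies acceptᶠ
                ↦ encodeBool (acceptAny ss) # length ss * (2 + Z)
    accept-ok [] _ = `case-nil `var `nil
    accept-ok (((r , assign []) , cs) ∷ ss) (is ∷ iss) =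
      lax (`case-cons `var (`case-cons `var (`case-cons `var (`case-cons `var (`case-nil `var
            (`if encodeBool (`call (`var `∷ `[])
                (lax (allInformed-ok cs) (length-cells _ cs is)))
              (`call (`var `∷ `[]) (accept-ok ss iss))
              (lax (`cons `nil `nil) z≤n)))))))
          (≤-reflexive (cong suc (+-suc Z _)))
    accept-ok (((r , assign (x ∷ xs)) , cs) ∷ ss) (is ∷ iss) =
      lax (`case-cons `var (`case-cons `var (`case-cons `var (`case-cons `var (`case-cons `var
            (`call (`var `∷ `[]) (accept-ok ss iss)))))))
          (s≤s (m≤n⇒m≤1+n (m≤n+m _ Z)))
    accept-ok (((r , hold (pt x)) , cs) ∷ ss) (is ∷ iss) =
      lax (`case-cons `var (`case-cons `var (`case-cons `var (`case-cons `var (`case-cons `var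
            (`call (`var `∷ `[]) (accept-ok ss iss)))))))
          (s≤s (m≤n⇒m≤1+n (m≤n+m _ Z)))
    accept-ok (((r , hold (cl σ)) , cs) ∷ ss) (is ∷ iss) =
      lax (`case-cons `var (`case-cons `var (`case-cons `var (`case-cons `var (`case-cons `var
            (`call (`var `∷ `[]) (accept-ok ss iss)))))))
          (s≤s (m≤n⇒m≤1+n (m≤n+m _ Z)))

    search-ok : ∀ {j} {ρ : Vec Tree j} {e₁ e₂ m₁ m₂} ls s → Inv s →
                ρ ⊢ e₁ ↦ encodeList ls # m₁ → ρ ⊢ e₂ ↦ encStates (s ∷ []) # m₂ →
                ρ ⊢ call acceptᶠ (call iterᶠ (e₁ ∷ e₂ ∷ []) ∷ [])
                ↦ encodeBool (acceptAny (iter (length ls) (s ∷ [])))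
                # 2 + (m₁ + m₂ + length ls * iterCost + acceptCost)
    search-ok {m₁ = m₁} {m₂} ls s is d₁ d₂ =
      lax (`call (`call (d₁ `∷ d₂ `∷ `[]) (iter-ok ls _ (is ∷ []) ([] ∷ [])) `∷ `[])
            (lax (accept-ok final allInv)
                 (*-monoˡ-≤ (2 + Z) (inv-length final (iter-unique (length ls) _ ([] ∷ [])) allInv))))
          (slack 0 (arith m₁ m₂ (length ls * iterCost) acceptCost))
      where
      final = iter (length ls) (s ∷ [])
      allInv = iter-all (length ls) (s ∷ []) (is ∷ [])
      arith : ∀ x y z w → suc (suc (x + (y + 0) + z) + 0 + w) + 0 ≡ 2 + (x + y + z + w)
      arith = solve-∀

-- Greedy modulator, initial state and horizon

module Setup {v : ℕ} (G : Graph v) where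
  open Graph G
  open Machine G
  open Search G

  findNon : Fin v → List (Fin v) → Maybe (Fin v × List (Fin v))
  keepOut : Fin v → Maybe (Fin v × List (Fin v)) → Maybe (Fin v × List (Fin v))
  findNon x []       = nothing
  findNon x (u ∷ us) = if adj x u then keepOut u (findNon x us) else just (u , us)
  keepOut u nothing         = nothing
  keepOut u (just (w , ws)) = just (w , u ∷ ws)

  -- `K` is a clique at all times and `Y` a list of disjoint non-adjacent pairs. A vertex without
  -- non-neighbour in `K` joins `K`; otherwise it leaves together with one non-neighbour, and the
  -- rest of `K` remains a clique.
  greedy : Fin v → List (Fin v) → List (Fin v) → List (Fin v) → List (Fin v) × List (Fin v)
  greedyStep : Fin v → Fin v → List (Fin v) → Maybe (Fin v × List (Fin v)) →
               List (Fin v) → List (Fin v) → List (Fin v) × List (Fin v)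
  greedy s []       K Y = K , Y
  greedy s (x ∷ xs) K Y =
    if eqᵇ (encV x) (encV s) then greedy s xs K Y else greedyStep s x xs (findNon x K) K Y
  greedyStep s x xs nothing         K Y = greedy s xs (x ∷ K) Y
  greedyStep s x xs (just (u , us)) K Y = greedy s xs us (u ∷ x ∷ Y)

  baseCells : List (Fin v) → List (Fin v) → ℕ → List Cell
  baseCells []       X T = []
  baseCells (x ∷ ys) X T =
    cell (pt x) 0 1 0 0 ∷ cell (cl (x ∷ [])) T 0 0 0 ∷ cell (cl X) 1 0 0 0 ∷ baseCells ys X T

  initial : Fin v → List (Fin v) → List (Fin v) → ℕ → State
  initial s K Y T = (T , assign K) ,
    -- The source is informed but has no call available; calls become available with the first
    -- `tick`.
    cell (cl []) (length K) 0 0 0 ∷ cell (pt s) 0 0 1 0 ∷ cell (cl (s ∷ [])) T 0 0 0 ∷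
    cell (cl (s ∷ Y)) 1 0 0 0 ∷ baseCells Y (s ∷ Y) T

  -- bits n has log n + O(1) digits.
  roundLimit : List (Fin v) → List (Fin v) → ℕ
  roundLimit K Y = suc (length Y) + suc (length (bits (length K)))

  -- By `value-take-≤` and `value-take-≥` this is the minimum of the round limit and the deadline,
  -- although the digits beyond the limit are never looked at.
  horizon : List (Fin v) → List (Fin v) → List Bool → ℕ
  horizon K Y ds = roundLimit K Y ⊓ value (take (roundLimit K Y) ds)

  -- One move for each vertex to be labelled, one for each round, and two for each of at most `v`
  -- calls.
  searchTime : List (Fin v) → ℕ → ℕ
  searchTime K T = length K + (T + (v + v))

  answerAt : Fin v → List (Fin v) → List (Fin v) → ℕ → Bool
  answerAt s K Y T = acceptAny (iter (searchTime K T) (initial s K Y T ∷ []))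

  broadcastable : Fin v → List Bool → Bool
  broadcastable s ds = answerAt s K Y (horizon K Y ds)
    where
    KY = greedy s (allFin v) [] []
    K = proj₁ KY
    Y = proj₂ KY

  -- The program numbers the rows while it descends the list, so the induction has to cover every
  -- final segment, here the vertices from `i` on.
  verts-ok : ∀ {n} (f : Fin n → Fin v) i → (∀ j → toℕ (f j) ≡ i + toℕ j) →
             encodeList (map encodeRow (tabulate f)) ∷ encodeUnary i ∷ [] ⊢ bodies vertsᶠ
             ↦ encVs (tabulate f) # n
  verts-ok {zero}  f i _  = `case-nil `var `nil
  verts-ok {suc n} f i f≡ =
    subst (λ j → encodeList (map encodeRow (tabulate f)) ∷ encodeUnary i ∷ [] ⊢ bodies vertsᶠ
                 ↦ (encodeUnary j ∙ encodeRow (f zero)) ∙ encVs (tabulate (f ∘ suc)) # suc n)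
      (sym (trans (f≡ zero) (+-identityʳ i)))
      (`case-cons `var (`cons (`cons `var `var)
        (`call (`var `∷ `cons `nil `var `∷ `[])
          (verts-ok (f ∘ suc) (suc i) (λ j → trans (f≡ (suc j)) (+-suc i (toℕ j)))))))

  encFound : Maybe (Fin v × List (Fin v)) → Tree
  encFound nothing         = nil
  encFound (just (u , us)) = encV u ∙ encVs us

  find-ok : ∀ x K → encV x ∷ encVs K ∷ [] ⊢ bodies findᶠ ↦ encFound (findNon x K) # length K * (2 + v)
  find-ok x []       = `case-nil `var `nil
  find-ok x (u ∷ us) =
    lax (`case-cons `var (`if encFound (`call (`var `∷ `var `∷ `[]) (adj-ok x u))
          (lax (`cons `var `var) z≤n) (rest (findNon x us) (find-ok x us))))
        (slack 0 (arith v (length us * (2 + v))))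
    where
    arith : ∀ x y → suc x + (suc y + 0) + 0 ≡ 2 + x + y
    arith = solve-∀
    rest : ∀ m → encV x ∷ encVs us ∷ [] ⊢ bodies findᶠ ↦ encFound m # length us * (2 + v) →
           nil ∷ nil ∷ encV u ∷ encVs us ∷ encV x ∷ encVs (u ∷ us) ∷ []
           ⊢ case (call findᶠ (x4 ∷ x3 ∷ [])) nil (cons x0 (cons x4 x1))
           ↦ encFound (keepOut u m) # suc (length us * (2 + v)) + 0
    rest nothing         d = `case-nil (`call (`var `∷ `var `∷ `[]) d) `nil
    rest (just (w , ws)) d = `case-cons (`call (`var `∷ `var `∷ `[]) d) (`cons `var (`cons `var `var))

  length-find : ∀ x K {u us} → findNon x K ≡ just (u , us) → length us ≤ length K
  length-find x (u ∷ us) eq with adj x u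
  length-find x (u ∷ us) refl | false = n≤1+n _
  ... | true with findNon x us in eq′
  length-find x (u ∷ us) refl | true | just (w , ws) = s≤s (length-find x us eq′)

  base-ok : ∀ ys X T → encVs ys ∷ encVs X ∷ encodeUnary T ∷ [] ⊢ bodies baseᶠ
            ↦ encCells (baseCells ys X T) # length ys
  base-ok []       X T = `case-nil `var `nil
  base-ok (y ∷ ys) X T =
    `case-cons `var
      (`cons (`cons (`cons `nil `var) (`cons `nil (`cons (`cons `nil `nil) (`cons `nil `nil))))
      (`cons (`cons (`cons (`cons `nil `nil) (`cons `var `nil)) (`cons `var (`cons `nil (`cons `nil `nil))))
      (`cons (`cons (`cons (`cons `nil `nil) `var) (`cons (`cons `nil `nil) (`cons `nil (`cons `nil `nil))))
        (`call (`var `∷ `var `∷ `var `∷ `[]) (base-ok ys X T)))))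

  module GreedyCost (Z : ℕ) (v≤Z : v ≤ Z) (encV≤Z : ∀ x → size (encV x) ≤ Z) where

    greedyCost : ℕ
    greedyCost = 3 + (2 * Z + Z * (2 + Z))

    encPair : List (Fin v) × List (Fin v) → Tree
    encPair (K , Y) = encVs K ∙ encVs Y

    -- A vertex taken from `xs` adds at most one to `K`, so `length xs + length K` never grows and
    -- bounds every scan of `K`.
    greedy-ok : ∀ s xs K Y → length xs + length K ≤ Z →
                encV s ∷ encVs xs ∷ encVs K ∷ encVs Y ∷ [] ⊢ bodies greedyᶠ
                ↦ encPair (greedy s xs K Y) # length xs * greedyCost
    greedy-ok s []       K Y _  = `case-nil `var (`cons `var `var)
    greedy-ok s (x ∷ xs) K Y ≤Z =
      lax (`case-cons `var (`if encPair
            (`call (`var `∷ `var `∷ `[]) (lax (eq-ok (encV x) (encV s)) (*-monoʳ-≤ 2 (encV≤Z x))))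
            (step (findNon x K) refl (lax (find-ok x K) (*-mono-≤ K≤ (+-monoʳ-≤ 2 v≤Z))))
            (lax (`call (`var `∷ `var `∷ `var `∷ `var `∷ `[])
                    (greedy-ok s xs K Y (≤-trans (n≤1+n _) ≤Z)))
                 (≤-trans (s≤s (m≤n+m _ _)) (≤-reflexive (sym (+-suc (suc findCost) _)))))))
          (slack 0 (arith (2 * Z) findCost (length xs * greedyCost)))
      where
      findCost = Z * (2 + Z)
      K≤ : length K ≤ Z
      K≤ = ≤-trans (m≤n+m _ _) ≤Z
      arith : ∀ x y z → suc x + (suc y + suc z) + 0 ≡ 3 + (x + y) + z
      arith = solve-∀
      step : ∀ m → findNon x K ≡ m →
             encV x ∷ encVs K ∷ [] ⊢ bodies findᶠ ↦ encFound m # findCost →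
             encV x ∷ encVs xs ∷ encV s ∷ encVs (x ∷ xs) ∷ encVs K ∷ encVs Y ∷ []
             ⊢ case (call findᶠ (x0 ∷ x4 ∷ []))
                 (call greedyᶠ (x2 ∷ x1 ∷ cons x0 x4 ∷ x5 ∷ []))
                 (call greedyᶠ (x4 ∷ x3 ∷ x1 ∷ cons x0 (cons x2 x7) ∷ []))
             ↦ encPair (greedyStep s x xs m K Y) # suc findCost + suc (length xs * greedyCost)
      step nothing         eq d = `case-nil (`call (`var `∷ `var `∷ `[]) d)
        (`call (`var `∷ `var `∷ `cons `var `var `∷ `var `∷ `[])
          (greedy-ok s xs (x ∷ K) Y (≤-trans (≤-reflexive (+-suc _ _)) ≤Z)))
      step (just (u , us)) eq d = `case-cons (`call (`var `∷ `var `∷ `[]) d)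
        (`call (`var `∷ `var `∷ `var `∷ `cons `var (`cons `var `var) `∷ `[])
          (greedy-ok s xs us (u ∷ x ∷ Y)
            (≤-trans (+-monoʳ-≤ (length xs) (length-find x K eq)) (≤-trans (n≤1+n _) ≤Z))))

  take-units : ∀ l n → take l (replicate n Tree.nil) ≡ replicate (l ⊓ n) Tree.nil
  take-units zero    n       = refl
  take-units (suc l) zero    = refl
  take-units (suc l) (suc n) = cong (nil ∷_) (take-units l n)

-- Running time of the whole program as a polynomial

infixl 6 _⊕_
infixl 7 _⊗_
data Polynomial : Set where
  X′      : Polynomial
  con     : ℕ → Polynomial
  _⊕_ _⊗_ : Polynomial → Polynomial → Polynomial

⟦_⟧ : Polynomial → ℕ → ℕ
⟦ X′ ⟧    z = z
⟦ con c ⟧ z = c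
⟦ p ⊕ q ⟧ z = ⟦ p ⟧ z + ⟦ q ⟧ z
⟦ p ⊗ q ⟧ z = ⟦ p ⟧ z * ⟦ q ⟧ z

-- Written term by term like `totalCost`, so that its value at `Z` is `totalCost` by computation.
-- The syntax is needed because growth is estimated by induction on polynomials.
totalPoly : Polynomial
totalPoly = con 4 ⊕ (X′ ⊕ (X′ ⊕ (X′ ⊗ greedy ⊕ solve)))
  where
  twoX mem edge rule variants succs addAll expand iter accept greedy lim horizon fuel init solve : Polynomial
  twoX     = con 2 ⊗ X′
  mem      = X′ ⊗ (con 2 ⊕ twoX)
  edge     = con 1 ⊕ (X′ ⊕ mem)
  rule     = con 1 ⊕ (edge ⊕ (con 1 ⊕ X′ ⊗ (con 2 ⊕ X′)))
  variants = X′ ⊗ (con 3 ⊕ (X′ ⊕ rule))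
  succs    = con 3 ⊕ (X′ ⊕ variants)
  addAll   = (con 2 ⊕ X′) ⊗ (con 2 ⊕ mem)
  expand   = con 3 ⊕ (succs ⊕ addAll)
  iter     = con 2 ⊕ X′ ⊗ expand
  accept   = X′ ⊗ (con 2 ⊕ X′)
  greedy   = con 3 ⊕ (twoX ⊕ X′ ⊗ (con 2 ⊕ X′))
  lim      = con 2 ⊕ (X′ ⊗ (con 2 ⊕ X′) ⊕ X′)
  horizon  = con 3 ⊕ (X′ ⊕ (twoX ⊕ X′))
  fuel     = con 3 ⊕ (X′ ⊕ (X′ ⊕ X′))
  init     = con 2 ⊕ (X′ ⊕ X′)
  solve    = lim ⊕ (horizon ⊕ (con 2 ⊕ (fuel ⊕ init ⊕ (X′ ⊕ (X′ ⊕ (X′ ⊕ X′))) ⊗ iter ⊕ accept)))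

module Total {v : ℕ} (G : Graph v) (s : Fin v) (ds : List Bool) where
  open Machine G
  open Search G
  open Setup G

  K Y : List (Fin v)
  K = proj₁ (greedy s (allFin v) [] [])
  Y = proj₂ (greedy s (allFin v) [] [])

  lim T units : ℕ
  lim   = roundLimit K Y
  T     = horizon K Y ds
  units = value (take lim ds)

  result : ∀ {k} {ρ : Vec Tree k} {e a b n} → a ≡ b → ρ ⊢ e ↦ a # n → ρ ⊢ e ↦ b # n
  result refl d = d

  limTrees : List Tree
  limTrees = map encV (s ∷ Y) ++ nil ∷ map encodeBool (bits (length K))

  length-lim : length limTrees ≡ lim
  length-lim = trans (length-++ (map encV (s ∷ Y)))
    (cong₂ (λ m n → suc (m + suc n)) (length-map encV Y) (length-map encodeBool (bits (length K))))

  fuel : List Tree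
  fuel = map encV K ++ (replicate T nil ++ (map encV (allFin v) ++ map encV (allFin v)))

  length-encVs : length (map encV (allFin v)) ≡ v
  length-encVs = trans (length-map encV (allFin v)) (length-tabulate id)

  length-fuel : length fuel ≡ searchTime K T
  length-fuel = begin
    length fuel
      ≡⟨ length-++ (map encV K) ⟩
    length (map encV K) + length (replicate T nil ++ (map encV (allFin v) ++ map encV (allFin v)))
      ≡⟨ cong₂ _+_ (length-map encV K) (length-++ (replicate T nil)) ⟩
    length K + (length (replicate T Tree.nil) + length (map encV (allFin v) ++ map encV (allFin v)))
      ≡⟨ cong (length K +_) (cong₂ _+_ (length-units T) (length-++ (map encV (allFin v)))) ⟩
    length K + (T + (length (map encV (allFin v)) + length (map encV (allFin v))))
      ≡⟨ cong (λ m → length K + (T + (m + m))) length-encVs ⟩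
    searchTime K T ∎
    where open ≡-Reasoning

  module TotalCost (Z : ℕ) (v≤Z : v ≤ Z) (encV≤Z : ∀ x → size (encV x) ≤ Z)
      (K≤Z : length K ≤ Z) (lim≤Z : lim ≤ Z) (units≤Z : units ≤ Z) (Inv : State → Set)
      (inv-succs  : ∀ {s s′} → Inv s → s′ ∈ succs s → Inv s′)
      (inv-size   : ∀ {s} → Inv s → size (encState s) ≤ Z)
      (inv-length : ∀ ss → Unique ss → All Inv ss → length ss ≤ Z)
      (inv-init   : Inv (initial s K Y T)) where
    open SearchCost Z v≤Z Inv inv-succs inv-size inv-length
    open GreedyCost Z v≤Z encV≤Z

    Y≤Z : suc (length Y) ≤ Z
    Y≤Z = ≤-trans (m≤m+n (suc (length Y)) _) lim≤Z

    T≤Z : T ≤ Z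
    T≤Z = ≤-trans (m⊓n≤m lim units) lim≤Z

    limCost horizonCost fuelCost initCost solveCost totalCost : ℕ
    limCost = 2 + (Z * (2 + Z) + Z)
    horizonCost = 3 + (Z + (2 * Z + Z))
    fuelCost = 3 + (Z + (Z + Z))
    initCost = 2 + (Z + Z)
    solveCost =
      limCost + (horizonCost +
        (2 + (fuelCost + initCost + (Z + (Z + (Z + Z))) * iterCost + acceptCost)))
    totalCost = 4 + (Z + (Z + (Z * greedyCost + solveCost)))

    lim-ok : ∀ {a b} → encVs (s ∷ Y) ∷ encV s ∷ encVs K ∷ a ∷ b ∷ encVs (allFin v) ∷ []
             ⊢ call appendᶠ (x0 ∷ cons nil (call bitsᶠ (x2 ∷ [])) ∷ [])
             ↦ encodeList limTrees # limCost
    lim-ok =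
      lax (`call (`var `∷ `cons `nil (`call (`var `∷ `[])
              (lax (subst (λ m → encVs K ∷ [] ⊢ bodies bitsᶠ ↦ encodeBits (bits m) # m * (2 + m))
                      (length-map encV K) (bits-ok (map encV K)))
                   (*-mono-≤ K≤Z (+-monoʳ-≤ 2 K≤Z)))) `∷ `[])
            (lax (append-ok (map encV (s ∷ Y)) (nil ∷ map encodeBool (bits (length K))))
                 (≤-trans (≤-reflexive (cong suc (length-map encV Y))) Y≤Z)))
          (slack 0 (arith (Z * (2 + Z)) Z))
      where
      arith : ∀ x z → suc (suc x + 0 + z) + 0 ≡ 2 + (x + z)
      arith = solve-∀

    horizon-ok : ∀ {a b c d e} → encodeList limTrees ∷ a ∷ b ∷ c ∷ d ∷ encodeBits ds ∷ e ∷ []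
                 ⊢ call takeᶠ (x0 ∷ call unaryᶠ (call takeᶠ (x0 ∷ x5 ∷ []) ∷ []) ∷ [])
                 ↦ encodeUnary T # horizonCost
    horizon-ok =
      lax (`call (`var `∷
             `call (`call (`var `∷ `var `∷ `[]) prefix-ok `∷ `[]) (lax (unary-ok (take lim ds)) (*-monoʳ-≤ 2 units≤Z)) `∷ `[])
            units-ok)
          (slack 0 (arith Z (2 * Z)))
      where
      arith : ∀ x y → suc (suc (suc x + 0 + y) + 0 + x) + 0 ≡ 3 + (x + (y + x))
      arith = solve-∀
      len≤ : length limTrees ≤ Z
      len≤ = ≤-trans (≤-reflexive length-lim) lim≤Z
      prefix-ok : encodeList limTrees ∷ encodeBits ds ∷ [] ⊢ bodies takeᶠ ↦ encodeBits (take lim ds) # Z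
      prefix-ok =
        result (cong encodeList (trans (cong (λ l → take l (map encodeBool ds)) length-lim)
                                       (take-map lim ds)))
          (lax (take-ok limTrees (map encodeBool ds)) len≤)
      units-ok : encodeList limTrees ∷ encodeUnary units ∷ [] ⊢ bodies takeᶠ ↦ encodeUnary T # Z
      units-ok =
        result (cong encodeList (trans (cong (λ l → take l (replicate units nil)) length-lim)
                                       (take-units lim units)))
          (lax (take-ok limTrees (replicate units nil)) len≤)

    fuel-ok : ∀ {a b c d e} →
              encodeUnary T ∷ a ∷ b ∷ c ∷ encVs K ∷ d ∷ e ∷ encVs (allFin v) ∷ []
              ⊢ call appendᶠ (x4 ∷ call appendᶠ (x0 ∷ call appendᶠ (x7 ∷ x7 ∷ []) ∷ []) ∷ [])
              ↦ encodeList fuel # fuelCost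
    fuel-ok =
      lax (`call (`var `∷ `call (`var `∷ `call (`var `∷ `var `∷ `[])
              (lax (append-ok (map encV (allFin v)) (map encV (allFin v)))
                   (≤-trans (≤-reflexive length-encVs) v≤Z)) `∷ `[])
              (lax (append-ok (replicate T nil) (map encV (allFin v) ++ map encV (allFin v)))
                   (≤-trans (≤-reflexive (length-units T)) T≤Z)) `∷ `[])
            (lax (append-ok (map encV K) _)
                 (≤-trans (≤-reflexive (length-map encV K)) K≤Z)))
          (slack 0 (arith Z))
      where
      arith : ∀ x → suc (suc (suc x + 0 + x) + 0 + x) + 0 ≡ 3 + (x + (x + x))
      arith = solve-∀

    init-ok : ∀ {a b c} →
              encodeUnary T ∷ a ∷ encVs (s ∷ Y) ∷ encV s ∷ encVs K ∷ encVs Y ∷ b ∷ c ∷ []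
              ⊢ cons
                  (cons (cons x0 (cons nil x4))
                    (cons (cons (cons (cons nil nil) nil) (cons (call lenᶠ (x4 ∷ [])) (cons nil (cons nil nil))))
                      (cons (cons (cons nil x3) (cons nil (cons nil (cons (cons nil nil) nil))))
                        (cons (cons (cons (cons nil nil) (cons x3 nil)) (cons x0 (cons nil (cons nil nil))))
                          (cons (cons (cons (cons nil nil) x2) (cons (cons nil nil) (cons nil (cons nil nil))))
                            (call baseᶠ (x5 ∷ x2 ∷ x0 ∷ [])))))))
                  nil
              ↦ encStates (initial s K Y T ∷ []) # initCost
    init-ok =
      lax (`cons (`cons (`cons `var (`cons `nil `var))
            (`cons (`cons (`cons (`cons `nil `nil) `nil) (`cons count (`cons `nil (`cons `nil `nil))))
            (`cons (`cons (`cons `nil `var) (`cons `nil (`cons `nil (`cons (`cons `nil `nil) `nil))))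
            (`cons (`cons (`cons (`cons `nil `nil) (`cons `var `nil)) (`cons `var (`cons `nil (`cons `nil `nil))))
            (`cons (`cons (`cons (`cons `nil `nil) `var) (`cons (`cons `nil `nil) (`cons `nil (`cons `nil `nil))))
              (`call (`var `∷ `var `∷ `var `∷ `[])
                (lax (base-ok Y (s ∷ Y) T) (≤-trans (n≤1+n _) Y≤Z))))))))
            `nil)
          (slack 0 (arith Z))
      where
      arith : ∀ x → suc x + 0 + suc x + 0 + 0 ≡ 2 + (x + x)
      arith = solve-∀
      count : ∀ {a b c} →
              encodeUnary T ∷ a ∷ encVs (s ∷ Y) ∷ encV s ∷ encVs K ∷ encVs Y ∷ b ∷ c ∷ []
              ⊢ call lenᶠ (x4 ∷ []) ↦ encodeUnary (length K) # suc Z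
      count = `call (`var `∷ `[])
        (result (cong encodeUnary (length-map encV K))
          (lax (len-ok (map encV K)) (≤-trans (≤-reflexive (length-map encV K)) K≤Z)))

    solve-ok : encV s ∷ encVs K ∷ encVs Y ∷ encodeBits ds ∷ encVs (allFin v) ∷ []
               ⊢ bodies solveᶠ ↦ encodeBool (answerAt s K Y T) # solveCost
    solve-ok =
      `let (`cons `var `var) (`let lim-ok (`let horizon-ok
        -- The fuel is assembled from lists at hand, and `length-fuel` identifies its length with
        -- the number of moves that `answerAt` allows.
        (result (cong (λ n → encodeBool (acceptAny (iter n (initial s K Y T ∷ [])))) length-fuel)
          (lax (search-ok fuel (initial s K Y T) inv-init fuel-ok init-ok)
            (+-monoʳ-≤ 2 (+-monoˡ-≤ acceptCost (+-monoʳ-≤ (fuelCost + initCost)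
              (*-monoˡ-≤ iterCost fuel≤))))))))
      where
      fuel≤ : length fuel ≤ Z + (Z + (Z + Z))
      fuel≤ = ≤-trans (≤-reflexive length-fuel) (+-mono-≤ K≤Z (+-mono-≤ T≤Z (+-mono-≤ v≤Z v≤Z)))

    broadcastable-ok : (encodeGraph G ∙ encodeUnary (toℕ s) ∙ encodeBits ds) ∷ []
                       ⊢ Program.main broadcaster ↦ encodeBool (broadcastable s ds) # totalCost
    broadcastable-ok =
      lax (`case-cons `var (`case-cons `var
            (`let (`call (`var `∷ `nil `∷ `[]) (lax (verts-ok id 0 (λ _ → refl)) v≤Z))
              (`let (`call (`var `∷ `var `∷ `[])
                      (lax (result (nth-row encV s) (nth-ok (toℕ s) (map encV (allFin v))))
                           (≤-trans (<⇒≤ (toℕ<n s)) v≤Z)))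
                (`case-cons (`call (`var `∷ `var `∷ `nil `∷ `nil `∷ `[])
                              (lax (greedy-ok s (allFin v) [] [] (≤-trans (≤-reflexive len) v≤Z))
                                   (*-monoˡ-≤ greedyCost (≤-trans (≤-reflexive (length-tabulate id)) v≤Z))))
                  (`call (`var `∷ `var `∷ `var `∷ `var `∷ `var `∷ `[]) solve-ok))))))
          (slack 0 (arith Z (Z * greedyCost) solveCost))
      where
      len : length (allFin v) + 0 ≡ v
      len = trans (+-identityʳ _) (length-tabulate id)
      arith : ∀ x y z → suc x + (suc x + (suc y + suc z)) + 0 ≡ 4 + (x + (x + (y + z)))
      arith = solve-∀

-- Rounds as sequences of calls

T⇒≡ : ∀ {b} → IsTrue b → b ≡ true
T⇒≡ {true} _ = refl

≡⇒T : ∀ {b} → b ≡ true → IsTrue b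
≡⇒T refl = _

lookup-ext : ∀ {A : Set} {n} (xs ys : Vec A n) → (∀ i → lookup xs i ≡ lookup ys i) → xs ≡ ys
lookup-ext xs ys eq =
  trans (sym (tabulate∘lookup xs)) (trans (tabulate-cong eq) (tabulate∘lookup ys))

∉⇒false : ∀ {n} {p : Subset n} {x} → x Subset.∉ p → lookup p x ≡ false
∉⇒false {p = p} {x} x∉p with lookup p x in eq
... | false = refl
... | true  = contradiction (lookup⇒[]= x p eq) x∉p

false⇒∉ : ∀ {n} {p : Subset n} {x} → lookup p x ≡ false → x Subset.∉ p
false⇒∉ eq x∈p with trans (sym ([]=⇒lookup x∈p)) eq
... | ()

true≢false : true ≢ false
true≢false ()

module Runs {v : ℕ} (G : Graph v) where
  open Graph G

  -- A round is serialised into single calls: A is the set of vertices that may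
  -- still call in the current round, J the set of informed vertices.
  data Run : ℕ → Subset v → Subset v → Set where
    stop : ∀ {r A J} → (∀ x → lookup J x ≡ true) → Run r A J
    newRound : ∀ {r A J} → Run r J J → Run (suc r) A J
    call : ∀ {r A J} u w → lookup A u ≡ true → lookup J w ≡ false → adj u w ≡ true →
           Run r (A [ u ]≔ false) (J [ w ]≔ true) → Run r A J

  idleRound : ∀ {I} → Round G I I
  idleRound = record
    { call = λ _ → nothing ; informed = λ () ; uninformed = λ () ; neighbor = λ ()
    ; result = λ y → mk⇔ inj₁ [ id , (λ ()) ]′ }

  idle : ∀ r {I} → Rounds G r I I
  idle zero    = done
  idle (suc r) = next idleRound (idle r)

  module _ {I J : Subset v} (R : Round G I J) where
    open Round R renaming (call to callee)

    grows : ∀ {x} → x Subset.∈ I → x Subset.∈ J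
    grows x∈I = Equivalence.from (result _) (inj₁ x∈I)

    -- A round is rebuilt from a run call by call: an idle vertex informed at the start of the round
    -- may still take a call to a vertex that the round has not reached.
    addCall : ∀ u w → u Subset.∈ I → callee u ≡ nothing → w Subset.∉ J → adj u w ≡ true →
              Round G I (J [ w ]≔ true)
    addCall u w u∈I idle-u w∉J u~w = record
      { call = callee′ ; informed = λ {x} → informed′ {x}
      ; uninformed = λ {x} → uninformed′ {x} ; neighbor = λ {x} → neighbor′ {x}
      ; result = λ y → mk⇔ (to y) (from y) }
      where
      callee′ : Fin v → Maybe (Fin v)
      callee′ x with x Fin.≟ u
      ... | yes _ = just w
      ... | no _  = callee x
      informed′ : ∀ {x y} → callee′ x ≡ just y → x Subset.∈ I
      informed′ {x} eq with x Fin.≟ u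
      ... | yes refl = u∈I
      ... | no _     = informed eq
      uninformed′ : ∀ {x y} → callee′ x ≡ just y → y Subset.∉ I
      uninformed′ {x} eq with x Fin.≟ u
      uninformed′ refl | yes refl = w∉J ∘ grows
      ... | no _ = uninformed eq
      neighbor′ : ∀ {x y} → callee′ x ≡ just y → x ~ y
      neighbor′ {x} eq with x Fin.≟ u
      neighbor′ refl | yes refl = ≡⇒T u~w
      ... | no _ = neighbor eq
      callee-u : callee′ u ≡ just w
      callee-u with u Fin.≟ u
      ... | yes _  = refl
      ... | no u≢u = contradiction refl u≢u
      callee-other : ∀ {x y} → callee x ≡ just y → callee′ x ≡ just y
      callee-other {x} eq with x Fin.≟ u
      ... | yes refl = contradiction (trans (sym idle-u) eq) (λ ())
      ... | no _     = eq
      ∈-update : ∀ {y} → y Subset.∈ J → y Subset.∈ (J [ w ]≔ true)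
      ∈-update {y} y∈J with y Fin.≟ w
      ... | yes refl = lookup⇒[]= y _ (lookup∘update y J true)
      ... | no y≢w   = lookup⇒[]= y _ (trans (lookup∘update′ y≢w J true) ([]=⇒lookup y∈J))
      to : ∀ y → y Subset.∈ (J [ w ]≔ true) → y Subset.∈ I ⊎ ∃[ x ] callee′ x ≡ just y
      to y y∈ with y Fin.≟ w
      ... | yes refl = inj₂ (u , callee-u)
      ... | no y≢w with Equivalence.to (result y)
                          (lookup⇒[]= y J (trans (sym (lookup∘update′ y≢w J true)) ([]=⇒lookup y∈)))
      ...   | inj₁ y∈I      = inj₁ y∈I
      ...   | inj₂ (x , eq) = inj₂ (x , callee-other eq)
      from : ∀ y → y Subset.∈ I ⊎ (∃[ x ] callee′ x ≡ just y) → y Subset.∈ (J [ w ]≔ true)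
      from y (inj₁ y∈I) = ∈-update (grows y∈I)
      from y (inj₂ (x , eq)) with x Fin.≟ u
      from y (inj₂ (x , refl)) | yes refl = lookup⇒[]= y _ (lookup∘update y J true)
      ... | no _ = ∈-update (Equivalence.from (result y) (inj₂ (x , eq)))

    -- Two vertices may call the same vertex in one round, so a call of the round is
    -- dropped when its callee has been informed by a caller treated earlier.
    serialise : ∀ {r} xs A J₀ → Unique xs →
      (∀ {x} → x ∈ xs → x Subset.∈ I → lookup A x ≡ true) →
      (∀ {y} → lookup J₀ y ≡ true → lookup J y ≡ true) →
      (∀ {y} → lookup J y ≡ true → lookup J₀ y ≡ true ⊎ (∃[ x ] (x ∈ xs × callee x ≡ just y))) →
      (∀ A′ → Run r A′ J) → Run r A J₀
    serialise {r} [] A J₀ _ _ J₀⊆J J⊆ rest = subst (Run r A) (sym (lookup-ext J₀ J same)) (rest A)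
      where
      same : ∀ y → lookup J₀ y ≡ lookup J y
      same y with lookup J₀ y in eq₀ | lookup J y in eq
      ... | true  | true  = refl
      ... | false | false = refl
      ... | true  | false = contradiction (trans (sym (J₀⊆J eq₀)) eq) true≢false
      ... | false | true  with J⊆ eq
      ...   | inj₁ eq₀′         = contradiction (trans (sym eq₀′) eq₀) true≢false
      ...   | inj₂ (_ , () , _)
    serialise {r} (x ∷ xs) A J₀ (x∉xs ∷ uq) A⊇ J₀⊆J J⊆ rest with callee x in eq
    ... | nothing = serialise xs A J₀ uq (A⊇ ∘ there) J₀⊆J J⊆′ rest
      where
      J⊆′ : ∀ {y} → lookup J y ≡ true → lookup J₀ y ≡ true ⊎ (∃[ x ] (x ∈ xs × callee x ≡ just y))
      J⊆′ y∈J with J⊆ y∈J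
      ... | inj₁ y∈J₀                  = inj₁ y∈J₀
      ... | inj₂ (_ , here refl , eq′) = contradiction (trans (sym eq) eq′) (λ ())
      ... | inj₂ (x′ , there x′∈ , eq′) = inj₂ (x′ , x′∈ , eq′)
    ... | just y with lookup J₀ y in informed-y
    ...   | true = serialise xs A J₀ uq (A⊇ ∘ there) J₀⊆J J⊆′ rest
      where
      J⊆′ : ∀ {y} → lookup J y ≡ true → lookup J₀ y ≡ true ⊎ (∃[ x ] (x ∈ xs × callee x ≡ just y))
      J⊆′ y′∈J with J⊆ y′∈J
      ... | inj₁ y∈J₀                  = inj₁ y∈J₀
      ... | inj₂ (x′ , there x′∈ , eq′) = inj₂ (x′ , x′∈ , eq′)
      ... | inj₂ (_ , here refl , eq′) with trans (sym eq) eq′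
      ...   | refl = inj₁ informed-y
    ...   | false = call x y (A⊇ (here refl) (informed eq)) informed-y (T⇒≡ (neighbor eq))
                      (serialise xs (A [ x ]≔ false) (J₀ [ y ]≔ true) uq A⊇′ J₀⊆J′ J⊆′ rest)
      where
      A⊇′ : ∀ {x′} → x′ ∈ xs → x′ Subset.∈ I → lookup (A [ x ]≔ false) x′ ≡ true
      A⊇′ {x′} x′∈ x′∈I =
        trans (lookup∘update′ (λ { refl → All.lookup x∉xs x′∈ refl }) A false) (A⊇ (there x′∈) x′∈I)
      J₀⊆J′ : ∀ {z} → lookup (J₀ [ y ]≔ true) z ≡ true → lookup J z ≡ true
      J₀⊆J′ {z} z∈ with z Fin.≟ y
      ... | yes refl = []=⇒lookup (Equivalence.from (result y) (inj₂ (x , eq)))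
      ... | no z≢y   = J₀⊆J (trans (sym (lookup∘update′ z≢y J₀ true)) z∈)
      J⊆′ : ∀ {z} → lookup J z ≡ true →
            lookup (J₀ [ y ]≔ true) z ≡ true ⊎ (∃[ x ] (x ∈ xs × callee x ≡ just z))
      J⊆′ {z} z∈J with z Fin.≟ y
      ... | yes refl = inj₁ (lookup∘update y J₀ true)
      ... | no z≢y with J⊆ z∈J
      ...   | inj₁ z∈J₀                  = inj₁ (trans (lookup∘update′ z≢y J₀ true) z∈J₀)
      ...   | inj₂ (x′ , there x′∈ , eq′) = inj₂ (x′ , x′∈ , eq′)
      ...   | inj₂ (_ , here refl , eq′) with trans (sym eq) eq′
      ...     | refl = contradiction refl z≢y

  -- `A` is arbitrary because the run begins with `stop` or `newRound`, and neither reads it.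
  rounds⇒run : ∀ {r I} → Rounds G r I ⊤ → ∀ A → Run r A I
  rounds⇒run done A = stop (λ x → lookup-replicate x true)
  rounds⇒run (next {I = I} {J} R rs) A = newRound
    (serialise R (allFin v) I I (allFin⁺ v) (λ _ → []=⇒lookup)
      ([]=⇒lookup ∘ grows R ∘ lookup⇒[]= _ I) covered (rounds⇒run rs))
    where
    covered : ∀ {y} → lookup J y ≡ true →
              lookup I y ≡ true ⊎ (∃[ x ] (x ∈ allFin v × Round.call R x ≡ just y))
    covered {y} y∈J with Equivalence.to (Round.result R y) (lookup⇒[]= y J y∈J)
    ... | inj₁ y∈I      = inj₁ ([]=⇒lookup y∈I)
    ... | inj₂ (x , eq) = inj₂ (x , ∈-allFin x , eq)

  all-informed : ∀ {J : Subset v} → (∀ x → lookup J x ≡ true) → J ≡ ⊤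
  all-informed {J} all = lookup-ext J ⊤ (λ x → trans (all x) (sym (lookup-replicate x true)))

  -- `R` is the part of the current round performed so far, from its starting set `I` to `J`. The
  -- hypothesis on `A` is what `addCall` asks of the next caller.
  run⇒rounds′ : ∀ {r A I J} → Run r A J → (R : Round G I J) →
    (∀ u → lookup A u ≡ true → u Subset.∈ I × Round.call R u ≡ nothing) → Rounds G (suc r) I ⊤
  run⇒rounds′ {r} {I = I} (stop all) R A⊆ =
    next (subst (Round G I) (all-informed all) R) (idle r)
  run⇒rounds′ {J = J} (newRound run) R A⊆ =
    next R (run⇒rounds′ run idleRound (λ u u∈J → lookup⇒[]= u J u∈J , refl))
  run⇒rounds′ {A = A} {I} {J} (call u w u∈A w∉J u~w run) R A⊆ =
    run⇒rounds′ run (addCall R u w u∈I idle-u (false⇒∉ w∉J) u~w) A⊆′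
    where
    u∈I = proj₁ (A⊆ u u∈A)
    idle-u = proj₂ (A⊆ u u∈A)
    A⊆′ : ∀ x → lookup (A [ u ]≔ false) x ≡ true →
          x Subset.∈ I × Round.call (addCall R u w u∈I idle-u (false⇒∉ w∉J) u~w) x ≡ nothing
    A⊆′ x x∈ with x Fin.≟ u
    ... | yes refl = contradiction (trans (sym x∈) (lookup∘update u A false)) true≢false
    ... | no x≢u   =
      let x∈A = trans (sym (lookup∘update′ x≢u A false)) x∈ in
      proj₁ (A⊆ x x∈A) , proj₂ (A⊆ x x∈A)

  -- With no caller available, no call can precede the first `newRound`; so no round beyond the `r`
  -- counted ones is used.
  run⇒rounds : ∀ {r I} → Run r ⊥ I → Rounds G r I ⊤
  run⇒rounds {r} {I} (stop all) = subst (Rounds G r I) (all-informed all) (idle r)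
  run⇒rounds {I = I} (newRound run) =
    run⇒rounds′ run idleRound (λ u u∈I → lookup⇒[]= u I u∈I , refl)
  run⇒rounds (call u w u∈⊥ _ _ _) =
    contradiction (trans (sym u∈⊥) (lookup-replicate u false)) true≢false

-- Labels

count : ∀ {A : Set} → (A → Bool) → List A → ℕ
count p []       = 0
count p (x ∷ xs) = if p x then suc (count p xs) else count p xs

count-cong : ∀ {A : Set} {p q : A → Bool} xs → (∀ {x} → x ∈ xs → p x ≡ q x) → count p xs ≡ count q xs
count-cong [] _ = refl
count-cong {p = p} {q} (x ∷ xs) eq rewrite eq (here refl) with q x
... | true  = cong suc (count-cong xs (eq ∘ there))
... | false = count-cong xs (eq ∘ there)

count-none : ∀ {A : Set} {p : A → Bool} xs → (∀ {x} → x ∈ xs → p x ≡ false) → count p xs ≡ 0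
count-none [] _ = refl
count-none (x ∷ xs) eq rewrite eq (here refl) = count-none xs (eq ∘ there)

count-mono : ∀ {A : Set} {p q : A → Bool} xs → (∀ {x} → x ∈ xs → p x ≡ true → q x ≡ true) →
             count p xs ≤ count q xs
count-mono [] _ = z≤n
count-mono {p = p} {q} (x ∷ xs) imp with p x in px | q x in qx
... | true  | true  = s≤s (count-mono xs (imp ∘ there))
... | false | true  = m≤n⇒m≤1+n (count-mono xs (imp ∘ there))
... | false | false = count-mono xs (imp ∘ there)
... | true  | false = contradiction (trans (sym (imp (here refl) px)) qx) true≢false

count-length : ∀ {A : Set} (p : A → Bool) xs → count p xs ≤ length xs
count-length p [] = z≤n
count-length p (x ∷ xs) with p x
... | true  = s≤s (count-length p xs)
... | false = m≤n⇒m≤1+n (count-length p xs)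

count-zero : ∀ {A : Set} {p : A → Bool} xs → count p xs ≡ 0 → ∀ {x} → x ∈ xs → p x ≡ false
count-zero {p = p} (y ∷ xs) eq x∈ with p y in py
count-zero (y ∷ xs) eq (here refl) | false = py
count-zero (y ∷ xs) eq (there x∈)  | false = count-zero xs eq x∈

count-suc : ∀ {A : Set} {p : A → Bool} xs {n} → count p xs ≡ suc n → ∃[ x ] (x ∈ xs × p x ≡ true)
count-suc {p = p} (x ∷ xs) eq with p x in px
... | true  = x , here refl , px
... | false = let y , y∈ , py = count-suc xs eq in y , there y∈ , py

-- The basis of all updates of counters: the predicate changes at one position, and there from true
-- to false. The `key` serves labellings, where it is the first components that are distinct.
count-drop : ∀ {A B : Set} (key : A → B) {p q : A → Bool} xs → Unique (map key xs) →
             ∀ {x} → x ∈ xs → p x ≡ true → q x ≡ false →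
             (∀ {y} → y ∈ xs → key y ≢ key x → p y ≡ q y) → count p xs ≡ suc (count q xs)
count-drop key {p} {q} (x ∷ xs) (x∉ ∷ uq) (here refl) px qx same rewrite px | qx =
  cong suc (count-cong xs (λ y∈ → same (there y∈) (λ eq → All.lookup x∉ (∈-map⁺ key y∈) (sym eq))))
count-drop key {p} {q} (z ∷ xs) (z∉ ∷ uq) (there x∈) px qx same
  rewrite same (here refl) (λ eq → All.lookup z∉ (∈-map⁺ key x∈) eq) with q z
... | true  = cong suc (count-drop key xs uq x∈ px qx (same ∘ there))
... | false = count-drop key xs uq x∈ px qx (same ∘ there)

-- A list without duplicates meets the exception `w` at most once.
count-≤suc : ∀ {n} {p q : Fin n → Bool} xs w → Unique xs →
             (∀ {x} → x ∈ xs → x ≢ w → p x ≡ true → q x ≡ true) → count p xs ≤ suc (count q xs)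
count-≤suc [] w _ _ = z≤n
count-≤suc {p = p} {q} (x ∷ xs) w (x∉ ∷ uq) imp with x Fin.≟ w
... | yes refl = ≤-trans (head≤ (p x) (q x)) (s≤s (tail≤ (q x)))
  where
  rest≤ : count p xs ≤ count q xs
  rest≤ = count-mono xs (λ y∈ → imp (there y∈) (λ { refl → All.lookup x∉ y∈ refl }))
  head≤ : ∀ b b′ → (if b then suc (count p xs) else count p xs) ≤ suc (count q xs)
  head≤ true  _ = s≤s rest≤
  head≤ false _ = m≤n⇒m≤1+n rest≤
  tail≤ : ∀ b → count q xs ≤ (if b then suc (count q xs) else count q xs)
  tail≤ true  = n≤1+n _
  tail≤ false = ≤-refl
... | no x≢w with p x in px | q x in qx
...   | true  | true  = s≤s (count-≤suc xs w uq (imp ∘ there))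
...   | false | true  = m≤n⇒m≤1+n (count-≤suc xs w uq (imp ∘ there))
...   | false | false = count-≤suc xs w uq (imp ∘ there)
...   | true  | false = contradiction (trans (sym (imp (here refl) x≢w px)) qx) true≢false

module Labels {v : ℕ} (G : Graph v) (s : Fin v) (K Y : List (Fin v)) (T : ℕ) where
  open Graph G
  open Machine G
  open Search G
  open Setup G

  X : List (Fin v)
  X = s ∷ Y

  -- calling x is the label of a vertex of K that calls x and perhaps other vertices
  -- of X, calledBy x that of a vertex of K that is called by x and calls no vertex of X.
  data Label : Set where
    plain                      : Label
    modulator calledBy calling : Fin v → Label

  infix 4 _≟ᴸ_
  _≟ᴸ_ : (ℓ ℓ′ : Label) → Dec (ℓ ≡ ℓ′)
  plain       ≟ᴸ plain       = yes refl
  plain       ≟ᴸ modulator _ = no λ ()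
  plain       ≟ᴸ calledBy _  = no λ ()
  plain       ≟ᴸ calling _   = no λ ()
  modulator _ ≟ᴸ plain       = no λ ()
  modulator x ≟ᴸ modulator y = map′ (cong modulator) (λ { refl → refl }) (x Fin.≟ y)
  modulator _ ≟ᴸ calledBy _  = no λ ()
  modulator _ ≟ᴸ calling _   = no λ ()
  calledBy _  ≟ᴸ plain       = no λ ()
  calledBy _  ≟ᴸ modulator _ = no λ ()
  calledBy x  ≟ᴸ calledBy y  = map′ (cong calledBy) (λ { refl → refl }) (x Fin.≟ y)
  calledBy _  ≟ᴸ calling _   = no λ ()
  calling _   ≟ᴸ plain       = no λ ()
  calling _   ≟ᴸ modulator _ = no λ ()
  calling _   ≟ᴸ calledBy _  = no λ ()
  calling x   ≟ᴸ calling y   = map′ (cong calling) (λ { refl → refl }) (x Fin.≟ y)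

  infix 5 _is_
  _is_ : Label → Label → Bool
  ℓ is ℓ′ = does (ℓ ≟ᴸ ℓ′)

  is-refl : ∀ ℓ → ℓ is ℓ ≡ true
  is-refl ℓ = dec-true (ℓ ≟ᴸ ℓ) refl

  is-false : ∀ {ℓ ℓ′} → ℓ ≢ ℓ′ → ℓ is ℓ′ ≡ false
  is-false {ℓ} {ℓ′} = dec-false (ℓ ≟ᴸ ℓ′)

  is-true : ∀ {ℓ ℓ′} → ℓ is ℓ′ ≡ true → ℓ ≡ ℓ′
  is-true {ℓ} {ℓ′} eq with ℓ ≟ᴸ ℓ′
  ... | yes ℓ≡ℓ′ = ℓ≡ℓ′

  Labelling : Set
  Labelling = List (Fin v × Label)

  labelsOf : List (Fin v) → List Label
  labelsOf []       = []
  labelsOf (x ∷ xs) = modulator x ∷ calledBy x ∷ calling x ∷ labelsOf xs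

  labels : List Label
  labels = plain ∷ labelsOf X

  -- A vertex `x` makes at most one call in each of `T` rounds and is itself called at most once.
  -- The vertices of `X` are labelled beforehand, so their own labels have no room for others.
  capacity : Label → ℕ
  capacity plain         = length K
  capacity (modulator x) = 0
  capacity (calledBy x)  = T
  capacity (calling x)   = 1

  -- The vertices of X that a clique vertex with the given label may exchange
  -- calls with are those adjacent to all the vertices carrying this label.
  links₀ : Label → List (Fin v)
  links₀ plain         = []
  links₀ (modulator x) = []
  links₀ (calledBy x)  = x ∷ []
  links₀ (calling x)   = X

  links : Label → Labelling → List (Fin v)
  links ℓ []              = links₀ ℓ
  links ℓ ((w , ℓ′) ∷ vs) = if ℓ′ is ℓ then select (adj w) (links ℓ vs) else links ℓ vs

  descAt : Labelling → Label → Desc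
  descAt vs (modulator x) = pt x
  descAt vs ℓ             = cl (links ℓ vs)

  countAt : Labelling → Label → (Fin v → Bool) → ℕ
  countAt vs ℓ f = count (λ p → (proj₂ p is ℓ) ∧ f (proj₁ p)) vs

  informed uninformed : Subset v → Fin v → Bool
  informed   J x = lookup J x
  uninformed J x = not (lookup J x)

  roomAt : Labelling → Label → ℕ
  roomAt vs ℓ = capacity ℓ ∸ count (λ p → proj₂ p is ℓ) vs

  -- What the search sees of a configuration, given by the labelling, the available callers `A` and
  -- the informed vertices `J`. The simulation in both directions relates configurations to these
  -- images.
  cellAt : Labelling → Subset v → Subset v → Label → Cell
  cellAt vs A J ℓ = cell (descAt vs ℓ) (roomAt vs ℓ)
    (countAt vs ℓ (uninformed J)) (countAt vs ℓ (informed J)) (countAt vs ℓ (informed A))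

  cells : Labelling → Subset v → Subset v → List Cell
  cells vs A J = map (cellAt vs A J) labels

  countAt-same : ∀ (vs : Labelling) → Unique (map proj₁ vs) → ∀ {w ℓ} → (w , ℓ) ∈ vs → ∀ {f g} →
                 f w ≡ true → g w ≡ false → (∀ x → x ≢ w → f x ≡ g x) →
                 countAt vs ℓ f ≡ suc (countAt vs ℓ g)
  countAt-same vs uq {w} {ℓ} w∈ {f} {g} fw gw same =
    count-drop proj₁ vs uq w∈ (cong₂ _∧_ (is-refl ℓ) fw) (cong₂ _∧_ (is-refl ℓ) gw)
      (λ {y} _ ≢w → cong ((proj₂ y is ℓ) ∧_) (same (proj₁ y) ≢w))

  label-unique : ∀ (vs : Labelling) → Unique (map proj₁ vs) → ∀ {w ℓ ℓ′} → (w , ℓ) ∈ vs → (w , ℓ′) ∈ vs → ℓ ≡ ℓ′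
  label-unique (_ ∷ vs) (_ ∷ _)   (here refl) (here refl) = refl
  label-unique (_ ∷ vs) (p∉ ∷ _)  (here refl) (there q∈)  =
    contradiction refl (All.lookup p∉ (∈-map⁺ proj₁ q∈))
  label-unique (_ ∷ vs) (p∉ ∷ _)  (there q∈)  (here refl) =
    contradiction refl (All.lookup p∉ (∈-map⁺ proj₁ q∈))
  label-unique (_ ∷ vs) (_ ∷ uq)  (there p∈)  (there q∈)  = label-unique vs uq p∈ q∈

  countAt-other : ∀ (vs : Labelling) → Unique (map proj₁ vs) → ∀ {w ℓ ℓ′} → (w , ℓ) ∈ vs → ℓ′ ≢ ℓ → ∀ {f g} →
                  (∀ x → x ≢ w → f x ≡ g x) → countAt vs ℓ′ f ≡ countAt vs ℓ′ g
  countAt-other vs uq {w} {ℓ} {ℓ′} w∈ ℓ′≢ℓ {f} {g} same = count-cong vs eq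
    where
    eq : ∀ {p} → p ∈ vs → (proj₂ p is ℓ′) ∧ f (proj₁ p) ≡ (proj₂ p is ℓ′) ∧ g (proj₁ p)
    eq {x , ℓ″} p∈ with x Fin.≟ w
    ... | no x≢w = cong ((ℓ″ is ℓ′) ∧_) (same x x≢w)
    ... | yes refl rewrite label-unique vs uq p∈ w∈ | is-false (λ eq → ℓ′≢ℓ (sym eq)) = refl

  countAt-pos : ∀ vs ℓ f {n} → countAt vs ℓ f ≡ suc n → ∃[ w ] ((w , ℓ) ∈ vs × f w ≡ true)
  countAt-pos vs ℓ f eq with count-suc vs eq
  ... | (w , ℓ′) , w∈ , both with ℓ′ ≟ᴸ ℓ
  ...   | yes refl = w , w∈ , both

  ∈-consAll⁻ : ∀ c ss {k cs} → (k , cs) ∈ consAll c ss → ∃[ cs′ ] (cs ≡ c ∷ cs′ × (k , cs′) ∈ ss)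
  ∈-consAll⁻ c ((k , cs) ∷ ss) (here refl) = cs , refl , here refl
  ∈-consAll⁻ c ((k , cs) ∷ ss) (there p)   =
    let cs′ , eq , q = ∈-consAll⁻ c ss p in cs′ , eq , there q

  ∈-consAll⁺ : ∀ c {ss k cs} → (k , cs) ∈ ss → (k , c ∷ cs) ∈ consAll c ss
  ∈-consAll⁺ c {_ ∷ _} (here refl) = here refl
  ∈-consAll⁺ c {_ ∷ _} (there p)   = there (∈-consAll⁺ c p)

  map-agree : ∀ {f g : Label → Cell} ls ℓ → All (ℓ ≢_) ls → (∀ ℓ′ → ℓ′ ≢ ℓ → g ℓ′ ≡ f ℓ′) →
              map f ls ≡ map g ls
  map-agree []       ℓ _          same = refl
  map-agree (m ∷ ls) ℓ (ℓ≢m ∷ ℓ∉) same =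
    cong₂ _∷_ (sym (same m (λ eq → ℓ≢m (sym eq)))) (map-agree ls ℓ ℓ∉ same)

  ∈-addVariant⁻ : ∀ m cs ss {t} → t ∈ addVariant m cs ss →
                  (∃[ k ] ∃[ c ] (m ≡ just (k , c) × t ≡ (k , c ∷ cs))) ⊎ t ∈ ss
  ∈-addVariant⁻ nothing        cs ss p           = inj₂ p
  ∈-addVariant⁻ (just (k , c)) cs ss (here eq)   = inj₁ (k , c , refl , eq)
  ∈-addVariant⁻ (just (k , c)) cs ss (there p)   = inj₂ p

  ∈-addVariant⁺ : ∀ m cs {ss t} → t ∈ ss → t ∈ addVariant m cs ss
  ∈-addVariant⁺ nothing  cs p = p
  ∈-addVariant⁺ (just _) cs p = there p

  -- Exactly one cell changes. The quantification over `g` lets the cells of an updated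
  -- configuration be inserted: one has to compute its cell at `ℓ` and to see that the others have
  -- not changed.
  ∈-variants⁻ : ∀ k (f : Label → Cell) ls → Unique ls → ∀ {k′ cs} → (k′ , cs) ∈ variants k (map f ls) →
                ∃[ ℓ ] ∃[ c ] (ℓ ∈ ls × rule k (f ℓ) ≡ just (k′ , c) ×
                  (∀ (g : Label → Cell) → g ℓ ≡ c → (∀ ℓ′ → ℓ′ ≢ ℓ → g ℓ′ ≡ f ℓ′) → cs ≡ map g ls))
  ∈-variants⁻ k f (ℓ ∷ ls) (ℓ∉ ∷ uq) p
    with ∈-addVariant⁻ (rule k (f ℓ)) (map f ls) (consAll (f ℓ) (variants k (map f ls))) p
  ... | inj₁ (k′ , c , eq , refl) =
    ℓ , c , here refl , eq , λ g gℓ same → cong₂ _∷_ (sym gℓ) (map-agree ls ℓ ℓ∉ same)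
  ... | inj₂ p′ with ∈-consAll⁻ (f ℓ) (variants k (map f ls)) p′
  ...   | cs′ , refl , q with ∈-variants⁻ k f ls uq q
  ...     | ℓ′ , c , ℓ′∈ , eq , agree =
    ℓ′ , c , there ℓ′∈ , eq ,
    λ g gℓ′ same → cong₂ _∷_ (sym (same ℓ (All.lookup ℓ∉ ℓ′∈))) (agree g gℓ′ same)

  ∈-variants⁺ : ∀ k (f g : Label → Cell) ls → Unique ls → ∀ {ℓ} → ℓ ∈ ls → ∀ {k′ c} →
                rule k (f ℓ) ≡ just (k′ , c) → g ℓ ≡ c → (∀ ℓ′ → ℓ′ ≢ ℓ → g ℓ′ ≡ f ℓ′) →
                (k′ , map g ls) ∈ variants k (map f ls)
  ∈-variants⁺ k f g (ℓ ∷ ls) (ℓ∉ ∷ uq) (here refl) eq gℓ same rewrite eq =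
    here (cong₂ (λ c cs → _ , c ∷ cs) gℓ (sym (map-agree ls ℓ ℓ∉ same)))
  ∈-variants⁺ k f g (m ∷ ls) (m∉ ∷ uq) (there ℓ∈) eq gℓ same =
    ∈-addVariant⁺ (rule k (f m)) (map f ls)
      (subst (λ c → (_ , c ∷ map g ls) ∈ consAll (f m) (variants k (map f ls)))
             (sym (same m (All.lookup m∉ ℓ∈)))
             (∈-consAll⁺ (f m) (∈-variants⁺ k f g ls uq ℓ∈ eq gℓ same)))

  ∈-labelsOf⁻ : ∀ xs {ℓ} → ℓ ∈ labelsOf xs →
                ∃[ x ] (x ∈ xs × (ℓ ≡ modulator x ⊎ ℓ ≡ calledBy x ⊎ ℓ ≡ calling x))
  ∈-labelsOf⁻ (x ∷ xs) (here refl)                 = x , here refl , inj₁ refl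
  ∈-labelsOf⁻ (x ∷ xs) (there (here refl))         = x , here refl , inj₂ (inj₁ refl)
  ∈-labelsOf⁻ (x ∷ xs) (there (there (here refl))) = x , here refl , inj₂ (inj₂ refl)
  ∈-labelsOf⁻ (x ∷ xs) (there (there (there p)))   =
    let y , y∈ , eq = ∈-labelsOf⁻ xs p in y , there y∈ , eq

  ∈-labelsOf⁺ : ∀ {xs x} → x ∈ xs →
                modulator x ∈ labelsOf xs × calledBy x ∈ labelsOf xs × calling x ∈ labelsOf xs
  ∈-labelsOf⁺ (here refl) = here refl , there (here refl) , there (there (here refl))
  ∈-labelsOf⁺ (there x∈) =
    let p , q , r = ∈-labelsOf⁺ x∈ in
    there (there (there p)) , there (there (there q)) , there (there (there r))

  labelsOf-unique : ∀ xs → Unique xs → Unique (labelsOf xs)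
  labelsOf-unique []       _         = []
  labelsOf-unique (x ∷ xs) (x∉ ∷ uq) =
    ((λ ()) ∷ (λ ()) ∷ All.tabulate (λ ℓ∈ eq → outside ℓ∈ (inj₁ (sym eq)))) ∷
    ((λ ()) ∷ All.tabulate (λ ℓ∈ eq → outside ℓ∈ (inj₂ (inj₁ (sym eq))))) ∷
    All.tabulate (λ ℓ∈ eq → outside ℓ∈ (inj₂ (inj₂ (sym eq)))) ∷
    labelsOf-unique xs uq
    where
    outside : ∀ {ℓ} → ℓ ∈ labelsOf xs → ¬ (ℓ ≡ modulator x ⊎ ℓ ≡ calledBy x ⊎ ℓ ≡ calling x)
    outside ℓ∈ eq with ∈-labelsOf⁻ xs ℓ∈
    outside ℓ∈ (inj₁ refl)        | _ , x∈ , inj₁ refl        = All.lookup x∉ x∈ refl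
    outside ℓ∈ (inj₂ (inj₁ ()))   | _ , _ , inj₁ refl
    outside ℓ∈ (inj₂ (inj₂ ()))   | _ , _ , inj₁ refl
    outside ℓ∈ (inj₂ (inj₁ refl)) | _ , x∈ , inj₂ (inj₁ refl) = All.lookup x∉ x∈ refl
    outside ℓ∈ (inj₂ (inj₂ refl)) | _ , x∈ , inj₂ (inj₂ refl) = All.lookup x∉ x∈ refl

  labels-unique : Unique X → Unique labels
  labels-unique uq = All.tabulate not-plain ∷ labelsOf-unique X uq
    where
    not-plain : ∀ {ℓ} → ℓ ∈ labelsOf X → plain ≢ ℓ
    not-plain ℓ∈ refl with ∈-labelsOf⁻ X ℓ∈
    ... | _ , _ , inj₁ ()
    ... | _ , _ , inj₂ (inj₁ ())
    ... | _ , _ , inj₂ (inj₂ ())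

  modulators : Labelling
  modulators = map (λ x → x , modulator x) X

  start : State
  start = (T , assign K) , cells modulators ⊥ ⁅ s ⁆

-- Tree comparison and injectivity of the encodings

eqᵇ-sound : ∀ a b → eqᵇ a b ≡ true → a ≡ b
eqᵇ-sound nil     nil       _ = refl
eqᵇ-sound (a ∙ b) (a′ ∙ b′) eq with eqᵇ a a′ in eqa
... | true = cong₂ _∙_ (eqᵇ-sound a a′ eqa) (eqᵇ-sound b b′ eq)

memᵇ-sound : ∀ {A : Set} (enc : A → Tree) → (∀ {x y} → enc x ≡ enc y → x ≡ y) →
             ∀ x ys → memᵇ enc x ys ≡ true → x ∈ ys
memᵇ-sound enc inj x (y ∷ ys) eq with eqᵇ (enc x) (enc y) in eq′
... | true  = here (inj (eqᵇ-sound (enc x) (enc y) eq′))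
... | false = there (memᵇ-sound enc inj x ys eq)

memᵇ-complete : ∀ {A : Set} (enc : A → Tree) {x ys} → x ∈ ys → memᵇ enc x ys ≡ true
memᵇ-complete enc {x} (here {y} refl) rewrite eqᵇ-refl (enc x) = refl
memᵇ-complete enc {x} (there {y} x∈) with eqᵇ (enc x) (enc y)
... | true  = refl
... | false = memᵇ-complete enc x∈

∙-injective : ∀ {a b a′ b′} → a ∙ b ≡ a′ ∙ b′ → a ≡ a′ × b ≡ b′
∙-injective refl = refl , refl

encodeUnary-injective : ∀ m n → encodeUnary m ≡ encodeUnary n → m ≡ n
encodeUnary-injective zero    zero    _  = refl
encodeUnary-injective (suc m) (suc n) eq =
  cong suc (encodeUnary-injective m n (proj₂ (∙-injective eq)))

encodeList-injective : ∀ {A : Set} (enc : A → Tree) → (∀ {x y} → enc x ≡ enc y → x ≡ y) →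
                       ∀ xs ys → encodeList (map enc xs) ≡ encodeList (map enc ys) → xs ≡ ys
encodeList-injective enc inj []       []       _  = refl
encodeList-injective enc inj (x ∷ xs) (y ∷ ys) eq =
  cong₂ _∷_ (inj (proj₁ (∙-injective eq)))
            (encodeList-injective enc inj xs ys (proj₂ (∙-injective eq)))

∈-select⁻ : ∀ {A : Set} (p : A → Bool) xs {x} → x ∈ select p xs → x ∈ xs × p x ≡ true
∈-select⁻ p (y ∷ xs) x∈ with p y in eq
∈-select⁻ p (y ∷ xs) (here refl) | true  = here refl , eq
∈-select⁻ p (y ∷ xs) (there x∈)  | true  = let q , r = ∈-select⁻ p xs x∈ in there q , r
∈-select⁻ p (y ∷ xs) x∈          | false = let q , r = ∈-select⁻ p xs x∈ in there q , r

∈-select⁺ : ∀ {A : Set} (p : A → Bool) {xs x} → x ∈ xs → p x ≡ true → x ∈ select p xs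
∈-select⁺ p (here refl) px rewrite px = here refl
∈-select⁺ p {y ∷ xs} (there x∈) px with p y
... | true  = there (∈-select⁺ p x∈ px)
... | false = ∈-select⁺ p x∈ px

module Injectivity {v : ℕ} (G : Graph v) where
  open Machine G

  encV-injective : ∀ {x y} → encV x ≡ encV y → x ≡ y
  encV-injective eq = toℕ-injective (encodeUnary-injective _ _ (proj₁ (∙-injective eq)))

  encDesc-injective : ∀ {d e} → encDesc d ≡ encDesc e → d ≡ e
  encDesc-injective {pt x} {pt y} eq = cong pt (encV-injective (proj₂ (∙-injective eq)))
  encDesc-injective {cl σ} {cl τ} eq =
    cong cl (encodeList-injective encV encV-injective σ τ (proj₂ (∙-injective eq)))

  cell-≡ : ∀ {d d′ o o′ u u′ i i′ a a′} → d ≡ d′ → o ≡ o′ → u ≡ u′ → i ≡ i′ → a ≡ a′ →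
           cell d o u i a ≡ cell d′ o′ u′ i′ a′
  cell-≡ refl refl refl refl refl = refl

  encCell-injective : ∀ {c d} → encCell c ≡ encCell d → c ≡ d
  encCell-injective eq with ∙-injective eq
  ... | d≡ , eq₁ with ∙-injective eq₁
  ... | o≡ , eq₂ with ∙-injective eq₂
  ... | u≡ , eq₃ with ∙-injective eq₃
  ... | i≡ , a≡ = cell-≡ (encDesc-injective d≡)
    (encodeUnary-injective _ _ o≡) (encodeUnary-injective _ _ u≡)
    (encodeUnary-injective _ _ i≡) (encodeUnary-injective _ _ a≡)

  encMode-injective : ∀ {m m′} → encMode m ≡ encMode m′ → m ≡ m′
  encMode-injective {assign xs} {assign ys} eq =
    cong assign (encodeList-injective encV encV-injective xs ys (proj₂ (∙-injective eq)))
  encMode-injective {hold d} {hold e} eq = cong hold (encDesc-injective (proj₂ (∙-injective eq)))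

  -- A state is discarded when its code is already present; injectivity ensures that the state
  -- itself is then present, so nothing is lost.
  encState-injective : ∀ {t t′} → encState t ≡ encState t′ → t ≡ t′
  encState-injective {(r , m) , cs} {(r′ , m′) , cs′} eq with ∙-injective eq
  ... | ctl≡ , cs≡ with ∙-injective ctl≡
  ... | r≡ , m≡ = cong₂ _,_
    (cong₂ _,_ (encodeUnary-injective r r′ r≡) (encMode-injective m≡))
    (encodeList-injective encCell encCell-injective cs cs′ cs≡)

-- The initial state as the image of a configuration

module Start {v : ℕ} (G : Graph v) (s : Fin v) (K Y : List (Fin v)) (T : ℕ)
             (X-unique : Unique (s ∷ Y)) where
  open Graph G
  open Machine G
  open Setup G
  open Labels G s K Y T
  open Injectivity G using (cell-≡)

  private
    mark : List (Fin v) → Labelling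
    mark = map (λ x → x , modulator x)

  links-mark : ∀ ℓ xs → (∀ x → modulator x is ℓ ≡ false) → links ℓ (mark xs) ≡ links₀ ℓ
  links-mark ℓ []       other = refl
  links-mark ℓ (x ∷ xs) other rewrite other x = links-mark ℓ xs other

  count-mark : ∀ ℓ xs → (∀ x → modulator x is ℓ ≡ false) →
               count (λ p → proj₂ p is ℓ) (mark xs) ≡ 0
  count-mark ℓ []       other = refl
  count-mark ℓ (x ∷ xs) other rewrite other x = count-mark ℓ xs other

  countAt-mark : ∀ ℓ f xs → (∀ x → modulator x is ℓ ≡ false) → countAt (mark xs) ℓ f ≡ 0
  countAt-mark ℓ f []       other = refl
  countAt-mark ℓ f (x ∷ xs) other rewrite other x = countAt-mark ℓ f xs other

  countAt-absent : ∀ f xs {y} → All (y ≢_) xs → countAt (mark xs) (modulator y) f ≡ 0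
  countAt-absent f []       _              = refl
  countAt-absent f (x ∷ xs) {y} (y≢x ∷ y∉)
    rewrite is-false {modulator x} {modulator y} (λ { refl → y≢x refl }) = countAt-absent f xs y∉

  countAt-modulator : ∀ f xs → Unique xs → ∀ {y} → y ∈ xs →
                      countAt (mark xs) (modulator y) f ≡ (if f y then 1 else 0)
  countAt-modulator f (y ∷ xs) (y∉ ∷ uq) (here refl) rewrite is-refl (modulator y) with f y
  ... | true  = cong suc (countAt-absent f xs y∉)
  ... | false = countAt-absent f xs y∉
  countAt-modulator f (x ∷ xs) (x∉ ∷ uq) {y} (there y∈)
    rewrite is-false {modulator x} {modulator y} (λ { refl → All.lookup x∉ y∈ refl }) =
    countAt-modulator f xs uq y∈

  blank : ∀ ℓ → (∀ x → modulator x is ℓ ≡ false) → descAt modulators ℓ ≡ cl (links ℓ modulators) →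
          cellAt modulators ⊥ ⁅ s ⁆ ℓ ≡ cell (cl (links₀ ℓ)) (capacity ℓ) 0 0 0
  blank ℓ other desc≡ = cell-≡ (trans desc≡ (cong cl (links-mark ℓ X other)))
    (cong (capacity ℓ ∸_) (count-mark ℓ X other))
    (countAt-mark ℓ _ X other) (countAt-mark ℓ _ X other) (countAt-mark ℓ _ X other)

  lookup-source : lookup ⁅ s ⁆ s ≡ true
  lookup-source = []=⇒lookup (x∈⁅x⁆ s)

  lookup-other : ∀ {x} → x ≢ s → lookup ⁅ s ⁆ x ≡ false
  lookup-other x≢s = ∉⇒false (x≢y⇒x∉⁅y⁆ x≢s)

  silent : ∀ x → lookup (⊥ {v}) x ≡ false
  silent x = lookup-replicate x false

  source-cell : cellAt modulators ⊥ ⁅ s ⁆ (modulator s) ≡ cell (pt s) 0 0 1 0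
  source-cell = cell-≡ refl (0∸n≡0 (count (λ p → proj₂ p is modulator s) modulators))
    (trans (countAt-modulator _ X X-unique (here refl))
           (cong (λ b → if not b then 1 else 0) lookup-source))
    (trans (countAt-modulator _ X X-unique (here refl)) (cong (if_then 1 else 0) lookup-source))
    (trans (countAt-modulator _ X X-unique (here refl)) (cong (if_then 1 else 0) (silent s)))

  modulator-cell : ∀ {y} → y ∈ X → y ≢ s →
                   cellAt modulators ⊥ ⁅ s ⁆ (modulator y) ≡ cell (pt y) 0 1 0 0
  modulator-cell {y} y∈ y≢s = cell-≡ refl (0∸n≡0 (count (λ p → proj₂ p is modulator y) modulators))
    (trans (countAt-modulator _ X X-unique y∈)
           (cong (λ b → if not b then 1 else 0) (lookup-other y≢s)))
    (trans (countAt-modulator _ X X-unique y∈) (cong (if_then 1 else 0) (lookup-other y≢s)))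
    (trans (countAt-modulator _ X X-unique y∈) (cong (if_then 1 else 0) (silent y)))

  base-cells : ∀ ys → (∀ {y} → y ∈ ys → y ∈ X × y ≢ s) →
               map (cellAt modulators ⊥ ⁅ s ⁆) (labelsOf ys) ≡ baseCells ys X T
  base-cells []       _   = refl
  base-cells (y ∷ ys) ys⊆ =
    cong₂ _∷_ (modulator-cell (proj₁ (ys⊆ (here refl))) (proj₂ (ys⊆ (here refl))))
    (cong₂ _∷_ (blank (calledBy y) (λ _ → refl) refl)
    (cong₂ _∷_ (blank (calling y) (λ _ → refl) refl)
      (base-cells ys (ys⊆ ∘ there))))

  -- The program builds `initial` literally, whereas the simulation needs a state given by a
  -- labelling of `X`.
  start≡initial : start ≡ initial s K Y T
  start≡initial = cong ((T , assign K) ,_)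
    (cong₂ _∷_ (blank plain (λ _ → refl) refl)
    (cong₂ _∷_ source-cell
    (cong₂ _∷_ (blank (calledBy s) (λ _ → refl) refl)
    (cong₂ _∷_ (blank (calling s) (λ _ → refl) refl)
      (base-cells Y λ y∈ → there y∈ , λ { refl → distinct X-unique y∈ })))))
    where
    distinct : ∀ {x : Fin v} {xs} → Unique (x ∷ xs) → x ∉ xs
    distinct (x∉ ∷ _) x∈ = All.lookup x∉ x∈ refl

-- Correctness of the exploration

module Reachability {v : ℕ} (G : Graph v) where
  open Machine G
  open Search G
  open Injectivity G

  data Path : ℕ → State → Set where
    accept : ∀ {n t} → accepting t ≡ true → Path n t
    step   : ∀ {n t t′} → t′ ∈ succs t → Path n t′ → Path (suc n) t

  ∈-addAll⁻ : ∀ ss set {t} → t ∈ addAll ss set → t ∈ ss ⊎ t ∈ set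
  ∈-addAll⁻ []       set t∈ = inj₂ t∈
  ∈-addAll⁻ (s ∷ ss) set t∈ with memᵇ encState s set
  ... | true = [ inj₁ ∘ there , inj₂ ]′ (∈-addAll⁻ ss set t∈)
  ... | false with ∈-addAll⁻ ss (s ∷ set) t∈
  ...   | inj₁ t∈ss         = inj₁ (there t∈ss)
  ...   | inj₂ (here refl)  = inj₁ (here refl)
  ...   | inj₂ (there t∈set) = inj₂ t∈set

  ∈-addAll⁺ʳ : ∀ ss set {t} → t ∈ set → t ∈ addAll ss set
  ∈-addAll⁺ʳ []       set t∈ = t∈
  ∈-addAll⁺ʳ (s ∷ ss) set t∈ with memᵇ encState s set
  ... | true  = ∈-addAll⁺ʳ ss set t∈
  ... | false = ∈-addAll⁺ʳ ss (s ∷ set) (there t∈)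

  ∈-addAll⁺ˡ : ∀ ss set {t} → t ∈ ss → t ∈ addAll ss set
  ∈-addAll⁺ˡ (s ∷ ss) set t∈ with memᵇ encState s set in eq | t∈
  ... | true  | here refl =
    ∈-addAll⁺ʳ ss set (memᵇ-sound encState encState-injective s set eq)
  ... | true  | there t∈ss = ∈-addAll⁺ˡ ss set t∈ss
  ... | false | here refl  = ∈-addAll⁺ʳ ss (s ∷ set) (here refl)
  ... | false | there t∈ss = ∈-addAll⁺ˡ ss (s ∷ set) t∈ss

  ∈-expand⁻ : ∀ set acc {t} → t ∈ expand set acc → (∃[ s ] (s ∈ set × t ∈ succs s)) ⊎ t ∈ acc
  ∈-expand⁻ []        acc t∈ = inj₂ t∈
  ∈-expand⁻ (s ∷ set) acc t∈ with ∈-expand⁻ set (addAll (succs s) acc) t∈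
  ... | inj₁ (s′ , s′∈ , t∈s′) = inj₁ (s′ , there s′∈ , t∈s′)
  ... | inj₂ t∈′ with ∈-addAll⁻ (succs s) acc t∈′
  ...   | inj₁ t∈s   = inj₁ (s , here refl , t∈s)
  ...   | inj₂ t∈acc = inj₂ t∈acc

  ∈-expand⁺ʳ : ∀ set acc {t} → t ∈ acc → t ∈ expand set acc
  ∈-expand⁺ʳ []        acc t∈ = t∈
  ∈-expand⁺ʳ (s ∷ set) acc t∈ = ∈-expand⁺ʳ set _ (∈-addAll⁺ʳ (succs s) acc t∈)

  ∈-expand⁺ˡ : ∀ set acc {s t} → s ∈ set → t ∈ succs s → t ∈ expand set acc
  ∈-expand⁺ˡ (s ∷ set) acc (here refl) t∈ = ∈-expand⁺ʳ set _ (∈-addAll⁺ˡ (succs s) acc t∈)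
  ∈-expand⁺ˡ (s ∷ set) acc (there s∈)  t∈ = ∈-expand⁺ˡ set _ s∈ t∈

  acceptAny⁻ : ∀ ss → acceptAny ss ≡ true → ∃[ t ] (t ∈ ss × accepting t ≡ true)
  acceptAny⁻ (s ∷ ss) eq with accepting s in acc
  ... | true  = s , here refl , acc
  ... | false = let t , t∈ , ok = acceptAny⁻ ss eq in t , there t∈ , ok

  acceptAny⁺ : ∀ ss {t} → t ∈ ss → accepting t ≡ true → acceptAny ss ≡ true
  acceptAny⁺ (s ∷ ss) (here refl) ok rewrite ok = refl
  acceptAny⁺ (s ∷ ss) (there t∈)  ok with accepting s
  ... | true  = refl
  ... | false = acceptAny⁺ ss t∈ ok

  search-sound : ∀ n set → acceptAny (iter n set) ≡ true → ∃[ t ] (t ∈ set × Path n t)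
  search-sound zero    set eq = let t , t∈ , ok = acceptAny⁻ set eq in t , t∈ , accept ok
  search-sound (suc n) set eq with search-sound n (expand set []) eq
  ... | t , t∈ , p with ∈-expand⁻ set [] t∈
  ...   | inj₁ (s , s∈ , t∈s) = s , s∈ , step t∈s p

  search-complete : ∀ n set {t} → t ∈ set → Path n t → acceptAny (iter n set) ≡ true
  search-complete zero    set t∈ (accept ok)  = acceptAny⁺ set t∈ ok
  search-complete (suc n) set t∈ (accept ok)  =
    search-complete n (expand set []) (∈-expand⁺ˡ set [] t∈ (here refl)) (accept ok)
  search-complete (suc n) set t∈ (step t′∈ p) =
    search-complete n (expand set []) (∈-expand⁺ˡ set [] t∈ t′∈) p

-- Broadcasts and accepting computations

just-injective : ∀ {A : Set} {x y : A} → just x ≡ just y → x ≡ y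
just-injective refl = refl

module Simulation {v : ℕ} (G : Graph v) (s : Fin v) (K Y : List (Fin v)) (T : ℕ)
    (X-unique : Unique (s ∷ Y)) (K-unique : Unique K)
    (K∩X : ∀ {w} → w ∈ K → w ∉ s ∷ Y)
    (K∪X : ∀ w → w ∈ K ⊎ w ∈ s ∷ Y)
    (K-clique : ∀ {u w} → u ∈ K → w ∈ K → u ≢ w → Graph.adj G u w ≡ true) where
  open Graph G
  open Machine G
  open Search G
  open Runs G
  open Labels G s K Y T
  open Injectivity G
  open Reachability G

  -- The field `edge⇒~` makes vertices with the same label interchangeable: a call permitted between
  -- two descriptions is an edge between any two distinct vertices carrying them.
  record Good (vs : Labelling) : Set where
    field
      unique  : Unique (map proj₁ vs)
      total   : ∀ w → ∃[ ℓ ] (w , ℓ) ∈ vs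
      label∈  : ∀ {w ℓ} → (w , ℓ) ∈ vs → ℓ ∈ labels
      edge⇒~  : ∀ {u w ℓ ℓ′} → (u , ℓ) ∈ vs → (w , ℓ′) ∈ vs → u ≢ w →
                edge (descAt vs ℓ) (descAt vs ℓ′) ≡ true → adj u w ≡ true

  idle-inv : ∀ {r} c {k c′} → rule (r , assign []) c ≡ just (k , c′) →
             ∃[ a ] (avail c ≡ suc a × k ≡ (r , hold (desc c)) ×
                     c′ ≡ cell (desc c) (room c) (uninf c) (inf c) a)
  idle-inv (cell d o u i (suc a)) refl = a , refl , refl , refl

  hold-inv : ∀ {r h} c {k c′} → rule (r , hold h) c ≡ just (k , c′) →
             ∃[ u ] (uninf c ≡ suc u × edge h (desc c) ≡ true × k ≡ (r , assign []) ×
                     c′ ≡ cell (desc c) (room c) u (suc (inf c)) (avail c))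
  hold-inv {h = h} (cell d o (suc u) i a) eq with edge h d | eq
  ... | true | refl = u , refl , refl , refl , refl

  assign-inv : ∀ {r x xs} c {k c′} → rule (r , assign (x ∷ xs)) c ≡ just (k , c′) →
               ∃[ σ ] ∃[ o ] (desc c ≡ cl σ × room c ≡ suc o × k ≡ (r , assign xs) ×
                 c′ ≡ cell (cl (select (adj x) σ)) o (suc (uninf c)) (inf c) (avail c))
  assign-inv (cell (cl σ) (suc o) u i a) refl = σ , o , refl , refl , refl , refl

  tick-assign : ∀ r {x xs} cs ss → tick (r , assign (x ∷ xs)) cs ss ≡ ss
  tick-assign zero    cs ss = refl
  tick-assign (suc r) cs ss = refl

  tick-hold : ∀ r {d} cs ss → tick (r , hold d) cs ss ≡ ss
  tick-hold zero    cs ss = refl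
  tick-hold (suc r) cs ss = refl

  reset-cells : ∀ vs A J → map reset (cells vs A J) ≡ cells vs J J
  reset-cells vs A J = sym (map-∘ labels)

  module _ (vs : Labelling) (uq : Unique (map proj₁ vs)) where

    release : ∀ {u ℓ} A → (u , ℓ) ∈ vs → lookup A u ≡ true →
              countAt vs ℓ (informed A) ≡ suc (countAt vs ℓ (informed (A [ u ]≔ false)))
    release {u} A u∈ Au = countAt-same vs uq u∈ Au (lookup∘update u A false)
      (λ x x≢u → sym (lookup∘update′ x≢u A false))

    release-other : ∀ {u ℓ} A J → (u , ℓ) ∈ vs → ∀ ℓ′ → ℓ′ ≢ ℓ →
                    cellAt vs (A [ u ]≔ false) J ℓ′ ≡ cellAt vs A J ℓ′
    release-other {u} A J u∈ ℓ′ ℓ′≢ℓ = cell-≡ refl refl refl refl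
      (countAt-other vs uq u∈ ℓ′≢ℓ (λ x x≢u → lookup∘update′ x≢u A false))

    inform-uninf : ∀ {w ℓ} J → (w , ℓ) ∈ vs → lookup J w ≡ false →
                   countAt vs ℓ (uninformed J) ≡ suc (countAt vs ℓ (uninformed (J [ w ]≔ true)))
    inform-uninf {w} J w∈ Jw = countAt-same vs uq w∈ (cong not Jw)
      (cong not (lookup∘update w J true))
      (λ x x≢w → cong not (sym (lookup∘update′ x≢w J true)))

    inform-inf : ∀ {w ℓ} J → (w , ℓ) ∈ vs → lookup J w ≡ false →
                 countAt vs ℓ (informed (J [ w ]≔ true)) ≡ suc (countAt vs ℓ (informed J))
    inform-inf {w} J w∈ Jw = countAt-same vs uq w∈ (lookup∘update w J true) Jw
      (λ x x≢w → lookup∘update′ x≢w J true)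

    inform-other : ∀ {w ℓ} A J → (w , ℓ) ∈ vs → ∀ ℓ′ → ℓ′ ≢ ℓ →
                   cellAt vs A (J [ w ]≔ true) ℓ′ ≡ cellAt vs A J ℓ′
    inform-other {w} A J w∈ ℓ′ ℓ′≢ℓ = cell-≡ refl refl
      (countAt-other vs uq w∈ ℓ′≢ℓ (λ x x≢w → cong not (lookup∘update′ x≢w J true)))
      (countAt-other vs uq w∈ ℓ′≢ℓ (λ x x≢w → lookup∘update′ x≢w J true))
      refl

  allInformed⁻ : ∀ vs A J ls → allInformed (map (cellAt vs A J) ls) ≡ true →
                 ∀ {ℓ} → ℓ ∈ ls → countAt vs ℓ (uninformed J) ≡ 0
  allInformed⁻ vs A J (m ∷ ls) eq ℓ∈ with countAt vs m (uninformed J) in zero-m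
  allInformed⁻ vs A J (m ∷ ls) eq (here refl) | zero = zero-m
  allInformed⁻ vs A J (m ∷ ls) eq (there ℓ∈)  | zero = allInformed⁻ vs A J ls eq ℓ∈

  allInformed⁺ : ∀ vs A J ls → (∀ ℓ → countAt vs ℓ (uninformed J) ≡ 0) →
                 allInformed (map (cellAt vs A J) ls) ≡ true
  allInformed⁺ vs A J []       none = refl
  allInformed⁺ vs A J (m ∷ ls) none rewrite none m = allInformed⁺ vs A J ls none

  -- A positive counter yields some vertex, and by `edge⇒~` any vertex with the label will do. The
  -- state remembers only the description of a waiting caller, so `sound-hold` carries the vertex
  -- `u` itself. `A ⊆ J` keeps the caller different from the callee.
  sound-idle : ∀ n {r A J vs} → Good vs → (∀ x → lookup A x ≡ true → lookup J x ≡ true) →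
               Path n ((r , assign []) , cells vs A J) → Run r A J
  sound-call : ∀ n {r A J vs t} → Good vs → (∀ x → lookup A x ≡ true → lookup J x ≡ true) →
               t ∈ variants (r , assign []) (cells vs A J) → Path n t → Run r A J
  sound-hold : ∀ n {r A J vs u ℓ} → Good vs → (∀ x → lookup A x ≡ true → lookup J x ≡ true) →
               (u , ℓ) ∈ vs → lookup A u ≡ true →
               Path n ((r , hold (descAt vs ℓ)) , cells vs (A [ u ]≔ false) J) → Run r A J

  sound-idle n {A = A} {J} {vs} g A⊆J (accept ok) = stop everyone
    where
    everyone : ∀ w → lookup J w ≡ true
    everyone w with Good.total g w
    ... | ℓ , w∈ with count-zero vs (allInformed⁻ vs A J labels ok (Good.label∈ g w∈)) w∈
    ...   | eq rewrite is-refl ℓ = Bool.not-injective eq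
  sound-idle (suc n)          g A⊆J (step (here refl) p)        = sound-idle n g A⊆J p
  sound-idle (suc n) {zero}   g A⊆J (step (there t∈) p)         = sound-call n g A⊆J t∈ p
  sound-idle (suc n) {suc r} {A} {J} {vs} g A⊆J (step (there (here refl)) p) =
    newRound (sound-idle n g (λ _ → id)
           (subst (λ cs → Path n ((r , assign []) , cs)) (reset-cells vs A J) p))
  sound-idle (suc n) {suc r}  g A⊆J (step (there (there t∈)) p) = sound-call n g A⊆J t∈ p

  sound-call n {r} {A} {J} {vs} g A⊆J t∈ p
    with ∈-variants⁻ (r , assign []) (cellAt vs A J) labels (labels-unique X-unique) t∈
  ... | ℓ , c , ℓ∈ , eq , agree with idle-inv (cellAt vs A J ℓ) eq
  ... | a , avail≡ , refl , refl with countAt-pos vs ℓ (informed A) avail≡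
  ... | u , u∈ , Au =
    sound-hold n g A⊆J u∈ Au
      (subst (λ cs → Path n ((r , hold (descAt vs ℓ)) , cs))
        (agree (cellAt vs (A [ u ]≔ false) J)
          (cell-≡ refl refl refl refl
            (suc-injective (trans (sym (release vs (Good.unique g) A u∈ Au)) avail≡)))
          (release-other vs (Good.unique g) A J u∈)) p)

  sound-hold (suc n) g A⊆J u∈ Au (step (here refl) p) = sound-hold n g A⊆J u∈ Au p
  sound-hold (suc n) {r} {A} {J} {vs} {u} {ℓ} g A⊆J u∈ Au (step (there t∈) p)
    with ∈-variants⁻ (r , hold (descAt vs ℓ)) (cellAt vs (A [ u ]≔ false) J) labels
           (labels-unique X-unique) (subst (_ ∈_) (tick-hold r _ _) t∈)
  ... | ℓ′ , c , ℓ′∈ , eq , agree with hold-inv (cellAt vs (A [ u ]≔ false) J ℓ′) eq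
  ... | _ , uninf≡ , edge≡ , refl , refl with countAt-pos vs ℓ′ (uninformed J) uninf≡
  ... | w , w∈ , notJw =
    call u w Au Jw (Good.edge⇒~ g u∈ w∈ u≢w edge≡)
      (sound-idle n g A⊆J′
        (subst (λ cs → Path n ((r , assign []) , cs))
          (agree (cellAt vs (A [ u ]≔ false) (J [ w ]≔ true))
            (cell-≡ refl refl
              (suc-injective (trans (sym (inform-uninf vs (Good.unique g) J w∈ Jw)) uninf≡))
              (inform-inf vs (Good.unique g) J w∈ Jw)
              refl)
            (inform-other vs (Good.unique g) (A [ u ]≔ false) J w∈)) p))
    where
    Jw : lookup J w ≡ false
    Jw = Bool.not-injective notJw
    u≢w : u ≢ w
    u≢w refl = true≢false (trans (sym (A⊆J u Au)) Jw)
    A⊆J′ : ∀ x → lookup (A [ u ]≔ false) x ≡ true → lookup (J [ w ]≔ true) x ≡ true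
    A⊆J′ x x∈ with x Fin.≟ w
    ... | yes refl = lookup∘update w J true
    ... | no x≢w with x Fin.≟ u
    ...   | yes refl = contradiction (trans (sym x∈) (lookup∘update u A false)) true≢false
    ...   | no x≢u = trans (lookup∘update′ x≢w J true)
                       (A⊆J x (trans (sym (lookup∘update′ x≢u A false)) x∈))

  NotModulator : Label → Set
  NotModulator ℓ = ∀ x → ℓ ≢ modulator x

  descAt-cl : ∀ vs ℓ → NotModulator ℓ → descAt vs ℓ ≡ cl (links ℓ vs)
  descAt-cl vs plain         _  = refl
  descAt-cl vs (modulator x) nm = contradiction refl (nm x)
  descAt-cl vs (calledBy x)  _  = refl
  descAt-cl vs (calling x)   _  = refl

  cl-notModulator : ∀ vs ℓ {σ} → descAt vs ℓ ≡ cl σ → NotModulator ℓ × σ ≡ links ℓ vs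
  cl-notModulator vs plain        refl = (λ _ ()) , refl
  cl-notModulator vs (calledBy x) refl = (λ _ ()) , refl
  cl-notModulator vs (calling x)  refl = (λ _ ()) , refl

  ∈-links⁻ : ∀ ℓ vs {x w} → x ∈ links ℓ vs → (w , ℓ) ∈ vs → adj w x ≡ true
  ∈-links⁻ ℓ ((u , ℓ′) ∷ vs) x∈ w∈ with ℓ′ ≟ᴸ ℓ | w∈
  ... | yes refl | here refl = proj₂ (∈-select⁻ (adj u) (links ℓ vs) x∈)
  ... | yes refl | there w∈′ = ∈-links⁻ ℓ vs (proj₁ (∈-select⁻ (adj u) (links ℓ vs) x∈)) w∈′
  ... | no ℓ≢    | here refl = contradiction refl ℓ≢
  ... | no _     | there w∈′ = ∈-links⁻ ℓ vs x∈ w∈′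

  ∈-links⁺ : ∀ ℓ vs {x} → x ∈ links₀ ℓ → (∀ {w} → (w , ℓ) ∈ vs → adj w x ≡ true) → x ∈ links ℓ vs
  ∈-links⁺ ℓ []              x∈ _   = x∈
  ∈-links⁺ ℓ ((u , ℓ′) ∷ vs) x∈ all with ℓ′ ≟ᴸ ℓ
  ... | yes refl = ∈-select⁺ (adj u) (∈-links⁺ ℓ vs x∈ (all ∘ there)) (all (here refl))
  ... | no _     = ∈-links⁺ ℓ vs x∈ (all ∘ there)

  record Partial (vs : Labelling) (rest : List (Fin v)) : Set where
    field
      unique   : Unique (map proj₁ vs)
      unique′  : Unique rest
      disjoint : ∀ {w} → w ∈ rest → All (w ≢_) (map proj₁ vs)
      rest⊆K   : ∀ {w} → w ∈ rest → w ∈ K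
      total    : ∀ w → w ∈ rest ⊎ (∃[ ℓ ] (w , ℓ) ∈ vs)
      label∈   : ∀ {w ℓ} → (w , ℓ) ∈ vs → ℓ ∈ labels
      proper   : ∀ {w ℓ} → (w , ℓ) ∈ vs → ℓ ≡ modulator w ⊎ (w ∈ K × NotModulator ℓ)

  -- If one end lies in `X` and the other in `K`, the former is among the links of the label of the
  -- latter and so adjacent to every vertex carrying that label. Two ends in `K` are adjacent in the
  -- clique.
  good : ∀ {vs} → Partial vs [] → Good vs
  good {vs} part = record
    { unique = unique ; total = λ w → [ (λ ()) , id ]′ (total w) ; label∈ = label∈
    ; edge⇒~ = λ u∈ w∈ → sound u∈ w∈ (proper u∈) (proper w∈) }
    where
    open Partial part
    sound : ∀ {u w ℓ ℓ′} → (u , ℓ) ∈ vs → (w , ℓ′) ∈ vs →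
            ℓ ≡ modulator u ⊎ (u ∈ K × NotModulator ℓ) → ℓ′ ≡ modulator w ⊎ (w ∈ K × NotModulator ℓ′) →
            u ≢ w → edge (descAt vs ℓ) (descAt vs ℓ′) ≡ true → adj u w ≡ true
    sound u∈ w∈ (inj₁ refl) (inj₁ refl) _ e = e
    sound {u} {w} {ℓ′ = ℓ′} u∈ w∈ (inj₁ refl) (inj₂ (_ , nm)) _ e rewrite descAt-cl vs ℓ′ nm =
      trans (adj-sym u w) (∈-links⁻ ℓ′ vs (memᵇ-sound encV encV-injective u (links ℓ′ vs) e) w∈)
    sound {u} {w} {ℓ} u∈ w∈ (inj₂ (_ , nm)) (inj₁ refl) _ e rewrite descAt-cl vs ℓ nm =
      ∈-links⁻ ℓ vs (memᵇ-sound encV encV-injective w (links ℓ vs) e) u∈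
    sound u∈ w∈ (inj₂ (u∈K , _)) (inj₂ (w∈K , _)) u≢w _ = K-clique u∈K w∈K u≢w

  extend : ∀ {vs x rest ℓ} → Partial vs (x ∷ rest) → ℓ ∈ labels → NotModulator ℓ →
           Partial ((x , ℓ) ∷ vs) rest
  extend {vs} {x} {rest} {ℓ} part ℓ∈ nm = record
    { unique = disjoint (here refl) ∷ unique
    ; unique′ = tail unique′
    ; disjoint = λ w∈ → (λ { refl → All.lookup (head unique′) w∈ refl }) ∷ disjoint (there w∈)
    ; rest⊆K = rest⊆K ∘ there
    ; total = total′
    ; label∈ = λ { (here refl) → ℓ∈ ; (there w∈) → label∈ w∈ }
    ; proper = λ { (here refl) → inj₂ (rest⊆K (here refl) , nm) ; (there w∈) → proper w∈ } }
    where
    open Partial part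
    head : ∀ {y : Fin v} {ys} → Unique (y ∷ ys) → All (y ≢_) ys
    head (y∉ ∷ _) = y∉
    tail : ∀ {y : Fin v} {ys} → Unique (y ∷ ys) → Unique ys
    tail (_ ∷ uq) = uq
    total′ : ∀ w → w ∈ rest ⊎ (∃[ ℓ′ ] (w , ℓ′) ∈ (x , ℓ) ∷ vs)
    total′ w with total w
    ... | inj₁ (here refl) = inj₂ (ℓ , here refl)
    ... | inj₁ (there w∈)  = inj₁ w∈
    ... | inj₂ (ℓ′ , w∈)   = inj₂ (ℓ′ , there w∈)

  K≢s : ∀ {x} → x ∈ K → lookup ⁅ s ⁆ x ≡ false
  K≢s x∈ = ∉⇒false (x≢y⇒x∉⁅y⁆ λ eq → K∩X x∈ (here eq))

  silent : ∀ x → lookup (⊥ {v}) x ≡ false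
  silent x = lookup-replicate x false

  -- `x` counts as uninformed since the source is not in `K`. With `pred` and truncated subtraction
  -- the equation holds even for a full label; that there is room is shown where the move is made.
  assigned : ∀ vs {x} ℓ → x ∈ K → NotModulator ℓ →
             cellAt ((x , ℓ) ∷ vs) ⊥ ⁅ s ⁆ ℓ ≡
             cell (cl (select (adj x) (links ℓ vs))) (pred (roomAt vs ℓ))
                  (suc (countAt vs ℓ (uninformed ⁅ s ⁆))) (countAt vs ℓ (informed ⁅ s ⁆))
                  (countAt vs ℓ (informed ⊥))
  assigned vs {x} ℓ x∈ nm rewrite descAt-cl ((x , ℓ) ∷ vs) ℓ nm | is-refl ℓ | K≢s x∈ | silent x =
    cell-≡ refl (sym (pred[m∸n]≡m∸[1+n] (capacity ℓ) (count (λ p → proj₂ p is ℓ) vs))) refl refl refl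

  assigned-other : ∀ vs {x} ℓ ℓ′ → ℓ′ ≢ ℓ →
                   cellAt ((x , ℓ) ∷ vs) ⊥ ⁅ s ⁆ ℓ′ ≡ cellAt vs ⊥ ⁅ s ⁆ ℓ′
  assigned-other vs {x} ℓ ℓ′ ℓ′≢ℓ = cell-≡ (desc≡ ℓ′ ℓ′≢ℓ) room≡ count≡ count≡ count≡
    where
    other : ℓ is ℓ′ ≡ false
    other = is-false (λ eq → ℓ′≢ℓ (sym eq))
    desc≡ : ∀ ℓ′ → ℓ′ ≢ ℓ → descAt ((x , ℓ) ∷ vs) ℓ′ ≡ descAt vs ℓ′
    desc≡ plain        ℓ′≢ℓ rewrite is-false {ℓ} {plain} (λ eq → ℓ′≢ℓ (sym eq)) = refl
    desc≡ (modulator y) _   = refl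
    desc≡ (calledBy y) ℓ′≢ℓ rewrite is-false {ℓ} {calledBy y} (λ eq → ℓ′≢ℓ (sym eq)) = refl
    desc≡ (calling y)  ℓ′≢ℓ rewrite is-false {ℓ} {calling y} (λ eq → ℓ′≢ℓ (sym eq)) = refl
    room≡ : roomAt ((x , ℓ) ∷ vs) ℓ′ ≡ roomAt vs ℓ′
    room≡ rewrite other = refl
    count≡ : ∀ {f} → countAt ((x , ℓ) ∷ vs) ℓ′ f ≡ countAt vs ℓ′ f
    count≡ rewrite other = refl

  sound-assign : ∀ n {vs} rest → Partial vs rest →
                 Path n ((T , assign rest) , cells vs ⊥ ⁅ s ⁆) → Run T ⊥ ⁅ s ⁆
  sound-assign n [] part p =
    sound-idle n (good part) (λ x x∈ → contradiction (trans (sym x∈) (silent x)) true≢false) p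
  sound-assign (suc n) (x ∷ rest) part (step (here refl) p) = sound-assign n (x ∷ rest) part p
  sound-assign (suc n) {vs} (x ∷ rest) part (step (there t∈) p)
    with ∈-variants⁻ (T , assign (x ∷ rest)) (cellAt vs ⊥ ⁅ s ⁆) labels
           (labels-unique X-unique) (subst (_ ∈_) (tick-assign T _ _) t∈)
  ... | ℓ , c , ℓ∈ , eq , agree with assign-inv (cellAt vs ⊥ ⁅ s ⁆ ℓ) eq
  ... | σ , o , desc≡ , room≡ , refl , refl with cl-notModulator vs ℓ desc≡
  ... | nm , refl =
    sound-assign n rest (extend part ℓ∈ nm)
      (subst (λ cs → Path n ((T , assign rest) , cs))
        (agree (cellAt ((x , ℓ) ∷ vs) ⊥ ⁅ s ⁆)
          (trans (assigned vs ℓ (Partial.rest⊆K part (here refl)) nm)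
                 (cell-≡ refl (cong pred room≡) refl refl refl))
          (λ ℓ′ → assigned-other vs ℓ ℓ′)) p)

  map-modulators : ∀ xs → map proj₁ (map (λ x → x , modulator x) xs) ≡ xs
  map-modulators []       = refl
  map-modulators (x ∷ xs) = cong (x ∷_) (map-modulators xs)

  partial₀ : Partial modulators K
  partial₀ = record
    { unique = subst Unique (sym (map-modulators X)) X-unique
    ; unique′ = K-unique
    ; disjoint = λ w∈ → subst (All (_ ≢_)) (sym (map-modulators X))
                          (¬Any⇒All¬ X (K∩X w∈))
    ; rest⊆K = id
    ; total = λ w → [ inj₁ , (λ w∈ → inj₂ (modulator w , ∈-map⁺ _ w∈)) ]′ (K∪X w)
    ; label∈ = λ p∈ → label∈ (∈-map⁻ _ p∈)
    ; proper = λ p∈ → proper (∈-map⁻ _ p∈) }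
    where
    label∈ : ∀ {w ℓ} → ∃[ x ] (x ∈ X × (w , ℓ) ≡ (x , modulator x)) → ℓ ∈ labels
    label∈ (x , x∈ , refl) = there (proj₁ (∈-labelsOf⁺ x∈))
    proper : ∀ {w ℓ} → ∃[ x ] (x ∈ X × (w , ℓ) ≡ (x , modulator x)) →
             ℓ ≡ modulator w ⊎ (w ∈ K × NotModulator ℓ)
    proper (x , x∈ , refl) = inj₁ refl

  sound : ∀ n → Path n start → Run T ⊥ ⁅ s ⁆
  sound n = sound-assign n K partial₀

  Path-mono : ∀ {m n t} → m ≤ n → Path m t → Path n t
  Path-mono _         (accept ok) = accept ok
  Path-mono (s≤s m≤n) (step t∈ p) = step t∈ (Path-mono m≤n p)

  idle-rule : ∀ {r} c {a} → avail c ≡ suc a → rule (r , assign []) c ≡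
              just ((r , hold (desc c)) , cell (desc c) (room c) (uninf c) (inf c) a)
  idle-rule (cell d o u i (suc a)) refl = refl

  hold-rule : ∀ {r h} c {u} → uninf c ≡ suc u → edge h (desc c) ≡ true → rule (r , hold h) c ≡
              just ((r , assign []) , cell (desc c) (room c) u (suc (inf c)) (avail c))
  hold-rule {h = h} (cell d o (suc u) i a) refl e rewrite e = refl

  assign-rule : ∀ {r x xs} c {σ o} → desc c ≡ cl σ → room c ≡ suc o → rule (r , assign (x ∷ xs)) c ≡
                just ((r , assign xs) , cell (cl (select (adj x) σ)) o (suc (uninf c)) (inf c) (avail c))
  assign-rule (cell (cl σ) (suc o) u i a) refl refl = refl

  ∈-tick : ∀ k cs {ss t} → t ∈ ss → t ∈ tick k cs ss
  ∈-tick (zero , _)               cs p = p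
  ∈-tick (suc r , assign [])      cs p = there p
  ∈-tick (suc r , assign (_ ∷ _)) cs p = p
  ∈-tick (suc r , hold _)         cs p = p

  remaining : Labelling → Subset v → ℕ
  remaining vs J = count (λ p → uninformed J (proj₁ p)) vs

  -- A run calls only uninformed vertices, so each vertex is called at most once and the first call
  -- found is the only one.
  caller : ∀ {r A J} → Run r A J → Fin v → Maybe (Fin v)
  caller (stop _)             x = nothing
  caller (newRound run)       x = caller run x
  caller (call u w _ _ _ run) x with x Fin.≟ w
  ... | yes _ = just u
  ... | no _  = caller run x

  caller-uninformed : ∀ {r A J} (run : Run r A J) {x u} → caller run x ≡ just u → lookup J x ≡ false
  caller-uninformed (newRound run) eq = caller-uninformed run eq
  caller-uninformed {J = J} (call u w _ Jw _ run) {x} eq with x Fin.≟ w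
  ... | yes refl = Jw
  ... | no x≢w   = trans (sym (lookup∘update′ x≢w J true)) (caller-uninformed run eq)

  caller-adj : ∀ {r A J} (run : Run r A J) {x u} → caller run x ≡ just u → adj u x ≡ true
  caller-adj (newRound run) eq = caller-adj run eq
  caller-adj (call u w _ _ u~w run) {x} eq with x Fin.≟ w
  caller-adj (call u w _ _ u~w run) refl | yes refl = u~w
  ... | no _ = caller-adj run eq

  -- The condition under which the search can replay a run with the given labels.
  Fits : ∀ {r A J} → Labelling → Run r A J → Set
  Fits vs run = ∀ {w u ℓ ℓ′} → caller run w ≡ just u → (u , ℓ) ∈ vs → (w , ℓ′) ∈ vs →
                edge (descAt vs ℓ) (descAt vs ℓ′) ≡ true

  -- A new round takes one move. A call takes two and lowers the number of uninformed vertices by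
  -- one, whence the two copies of `remaining`.
  complete-idle : ∀ {r A J vs} → Good vs → (run : Run r A J) → Fits vs run →
                  Path (r + (remaining vs J + remaining vs J)) ((r , assign []) , cells vs A J)
  complete-idle {A = A} {J} {vs} g (stop all) fits =
    accept (allInformed⁺ vs A J labels λ ℓ → count-none vs λ { {x , ℓ′} _ → none x (ℓ′ is ℓ) })
    where
    none : ∀ x b → b ∧ not (lookup J x) ≡ false
    none x false = refl
    none x true  = cong not (all x)
  complete-idle {A = A} {J} {vs} g (newRound {r} run) fits =
    step (there (here refl))
      (subst (λ cs → Path (r + (remaining vs J + remaining vs J)) ((r , assign []) , cs))
             (sym (reset-cells vs A J)) (complete-idle g run fits))
  complete-idle {r} {A} {J} {vs} g (call u w Au Jw u~w run) fits
    with Good.total g u | Good.total g w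
  ... | ℓ , u∈ | ℓ′ , w∈ =
    subst (λ n → Path n ((r , assign []) , cells vs A J)) (sym steps≡)
      (step (there (∈-tick (r , assign []) _
              (∈-variants⁺ (r , assign []) (cellAt vs A J) (cellAt vs A′ J) labels uq-labels (Good.label∈ g u∈)
                (idle-rule (cellAt vs A J ℓ) (release vs uq A u∈ Au)) refl (release-other vs uq A J u∈))))
      (step (there (∈-tick (r , hold (descAt vs ℓ)) _
              (∈-variants⁺ (r , hold (descAt vs ℓ)) (cellAt vs A′ J) (cellAt vs A′ J′) labels uq-labels (Good.label∈ g w∈)
                (hold-rule (cellAt vs A′ J ℓ′) (inform-uninf vs uq J w∈ Jw) (fits called u∈ w∈))
                (cell-≡ refl refl refl (inform-inf vs uq J w∈ Jw) refl)
                (inform-other vs uq A′ J w∈))))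
        (complete-idle g run fits′)))
    where
    A′ = A [ u ]≔ false
    J′ = J [ w ]≔ true
    uq = Good.unique g
    uq-labels = labels-unique X-unique
    called : caller (call u w Au Jw u~w run) w ≡ just u
    called with w Fin.≟ w
    ... | yes _  = refl
    ... | no w≢w = contradiction refl w≢w
    fits′ : Fits vs run
    fits′ {x} eq = fits same
      where
      same : caller (call u w Au Jw u~w run) x ≡ just _
      same with x Fin.≟ w
      ... | no _     = eq
      ... | yes refl =
        contradiction (trans (sym (lookup∘update x J true)) (caller-uninformed run eq)) true≢false
    drop : remaining vs J ≡ suc (remaining vs J′)
    drop = count-drop proj₁ vs uq w∈ (cong not Jw) (cong not (lookup∘update w J true))
      (λ _ ≢w → cong not (sym (lookup∘update′ ≢w J true)))
    steps≡ : r + (remaining vs J + remaining vs J) ≡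
             suc (suc (r + (remaining vs J′ + remaining vs J′)))
    steps≡ = trans (cong (λ m → r + (m + m)) drop) (arith r (remaining vs J′))
      where
      arith : ∀ x m → x + (suc m + suc m) ≡ suc (suc (x + (m + m)))
      arith = solve-∀

  labelAll : (Fin v → Label) → List (Fin v) → Labelling → Labelling
  labelAll lab []       vs = vs
  labelAll lab (x ∷ xs) vs = labelAll lab xs ((x , lab x) ∷ vs)

  module _ (lab : Fin v → Label) (lab∈ : ∀ x → lab x ∈ labels) (lab-nm : ∀ x → NotModulator (lab x)) where

    partial-all : ∀ rest {vs} → Partial vs rest → Partial (labelAll lab rest vs) []
    partial-all []       part = part
    partial-all (x ∷ xs) part = partial-all xs (extend part (lab∈ x) (lab-nm x))

    ∈-labelAll⁻ : ∀ xs {vs w ℓ} → (w , ℓ) ∈ labelAll lab xs vs → (w ∈ xs × ℓ ≡ lab w) ⊎ (w , ℓ) ∈ vs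
    ∈-labelAll⁻ []       w∈ = inj₂ w∈
    ∈-labelAll⁻ (x ∷ xs) w∈ with ∈-labelAll⁻ xs w∈
    ... | inj₁ (w∈xs , eq)  = inj₁ (there w∈xs , eq)
    ... | inj₂ (here refl)  = inj₁ (here refl , refl)
    ... | inj₂ (there w∈vs) = inj₂ w∈vs

    length-labelAll : ∀ xs vs → length (labelAll lab xs vs) ≡ length xs + length vs
    length-labelAll []       vs = refl
    length-labelAll (x ∷ xs) vs = trans (length-labelAll xs _) (+-suc (length xs) (length vs))

    complete-assign : ∀ rest vs {n} → (∀ {x} → x ∈ rest → x ∈ K) →
      (∀ ℓ → NotModulator ℓ →
        count (λ x → lab x is ℓ) rest + count (λ p → proj₂ p is ℓ) vs ≤ capacity ℓ) →
      Path n ((T , assign []) , cells (labelAll lab rest vs) ⊥ ⁅ s ⁆) →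
      Path (length rest + n) ((T , assign rest) , cells vs ⊥ ⁅ s ⁆)
    complete-assign []         vs _   _      p = p
    complete-assign (x ∷ rest) vs ⊆K  within p =
      step (there (∈-tick (T , assign (x ∷ rest)) _
             (∈-variants⁺ (T , assign (x ∷ rest)) (cellAt vs ⊥ ⁅ s ⁆) (cellAt ((x , ℓ) ∷ vs) ⊥ ⁅ s ⁆) labels
               (labels-unique X-unique) (lab∈ x)
               (assign-rule (cellAt vs ⊥ ⁅ s ⁆ ℓ) (descAt-cl vs ℓ (lab-nm x)) room≡)
               (assigned vs ℓ (⊆K (here refl)) (lab-nm x))
               (λ ℓ′ → assigned-other vs ℓ ℓ′))))
        (complete-assign rest ((x , ℓ) ∷ vs) (⊆K ∘ there) within′ p)
      where
      ℓ = lab x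
      used : ℕ
      used = count (λ p → proj₂ p is ℓ) vs
      used<capacity : used < capacity ℓ
      used<capacity with lab x is ℓ | is-refl ℓ | within ℓ (lab-nm x)
      ... | true | _ | within-ℓ = ≤-trans (s≤s (m≤n+m used _)) within-ℓ
      room≡ : roomAt vs ℓ ≡ suc (pred (roomAt vs ℓ))
      room≡ with roomAt vs ℓ | m<n⇒0<n∸m used<capacity
      ... | suc _ | _ = refl
      within′ : ∀ ℓ′ → NotModulator ℓ′ →
        count (λ y → lab y is ℓ′) rest + count (λ p → proj₂ p is ℓ′) ((x , ℓ) ∷ vs) ≤ capacity ℓ′
      within′ ℓ′ nm with lab x is ℓ′ | within ℓ′ nm
      ... | true  | w = ≤-trans (≤-reflexive (+-suc _ _)) w
      ... | false | w = w

  calls : ∀ {r A J} → Run r A J → Fin v → Fin v → Bool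
  calls run x w = does (Maybe.≡-dec Fin._≟_ (caller run w) (just x))

  does-true : ∀ {P : Set} (d : Dec P) → does d ≡ true → P
  does-true (yes p) _ = p

  -- One call for each round to come; the second summand is the call that `x` may still make in the
  -- current round.
  calls-bound : ∀ {r A J} (run : Run r A J) x ws → Unique ws →
                count (calls run x) ws ≤ r + (if lookup A x then 1 else 0)
  calls-bound (stop _) x ws uq = ≤-trans (≤-reflexive (count-none ws (λ _ → refl))) z≤n
  calls-bound {A = A} {J} (newRound {r} run) x ws uq =
    ≤-trans (calls-bound run x ws uq)
      (≤-trans (+-monoʳ-≤ r (at-most-one (lookup J x)))
        (≤-trans (≤-reflexive (+-comm r 1)) (m≤m+n (suc r) _)))
    where
    at-most-one : ∀ b → (if b then 1 else 0) ≤ 1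
    at-most-one true  = ≤-refl
    at-most-one false = z≤n
  calls-bound {r} {A} (call u w Au Jw u~w run) x ws uq with x Fin.≟ u
  ... | yes refl = ≤-trans (count-≤suc ws w uq same)
      (≤-trans (s≤s (calls-bound run x ws uq)) (≤-reflexive total≡))
    where
    same : ∀ {y} → y ∈ ws → y ≢ w → calls (call x w Au Jw u~w run) x y ≡ true → calls run x y ≡ true
    same {y} _ y≢w eq with y Fin.≟ w
    ... | yes y≡w = contradiction y≡w y≢w
    ... | no _    = eq
    total≡ : suc (r + (if lookup (A [ x ]≔ false) x then 1 else 0)) ≡ r + (if lookup A x then 1 else 0)
    total≡ rewrite lookup∘update x A false | Au = trans (cong suc (+-identityʳ r)) (+-comm 1 r)
  ... | no x≢u = ≤-trans (count-mono ws same)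
      (≤-trans (calls-bound run x ws uq)
        (≤-reflexive (cong (λ b → r + (if b then 1 else 0)) (lookup∘update′ x≢u A false))))
    where
    same : ∀ {y} → y ∈ ws → calls (call u w Au Jw u~w run) x y ≡ true → calls run x y ≡ true
    same {y} _ eq with y Fin.≟ w
    ... | no _  = eq
    ... | yes _ = contradiction
      (sym (just-injective (does-true (Maybe.≡-dec Fin._≟_ (just u) (just x)) eq))) x≢u

  module _ (run : Run T ⊥ ⁅ s ⁆) where

    child : Fin v → List (Fin v) → Maybe (Fin v)
    child w []       = nothing
    child w (x ∷ xs) with Maybe.≡-dec Fin._≟_ (caller run x) (just w)
    ... | yes _ = just x
    ... | no _  = child w xs

    child-just : ∀ w xs {x} → child w xs ≡ just x → x ∈ xs × caller run x ≡ just w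
    child-just w (y ∷ xs) eq with Maybe.≡-dec Fin._≟_ (caller run y) (just w)
    child-just w (y ∷ xs) refl | yes called = here refl , called
    ... | no _ = let x∈ , called = child-just w xs eq in there x∈ , called

    child-nothing : ∀ w xs {x} → child w xs ≡ nothing → x ∈ xs → caller run x ≢ just w
    child-nothing w (y ∷ xs) eq x∈ with Maybe.≡-dec Fin._≟_ (caller run y) (just w)
    child-nothing w (y ∷ xs) eq (here refl) | no not-called = not-called
    child-nothing w (y ∷ xs) eq (there x∈)  | no _          = child-nothing w xs eq x∈

    byCaller : Maybe (Fin v) → Label
    byCaller nothing  = plain
    byCaller (just x) with _∈?_ Fin._≟_ x X
    ... | yes _ = calledBy x
    ... | no _  = plain

    -- Calling into `X` takes precedence over being called from there. A vertex that does both gets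
    -- a label of its own, whose links may be all its neighbours in `X`, and these cover the call it
    -- receives as well.
    label : Fin v → Label
    label w with child w X
    ... | just x  = calling x
    ... | nothing = byCaller (caller run w)

    label-notModulator : ∀ w → NotModulator (label w)
    label-notModulator w x eq with child w X
    label-notModulator w x () | just _
    ... | nothing with caller run w
    label-notModulator w x () | nothing | nothing
    ... | just y with _∈?_ Fin._≟_ y X
    label-notModulator w x () | nothing | just y | yes _
    label-notModulator w x () | nothing | just y | no _

    label∈labels : ∀ w → label w ∈ labels
    label∈labels w with child w X in eq
    ... | just x = there (proj₂ (proj₂ (∈-labelsOf⁺ (proj₁ (child-just w X eq)))))
    ... | nothing with caller run w
    ...   | nothing = here refl
    ...   | just y with _∈?_ Fin._≟_ y X
    ...     | yes y∈ = there (proj₁ (proj₂ (∈-labelsOf⁺ y∈)))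
    ...     | no _   = here refl

    label-calling : ∀ w {x} → label w ≡ calling x → caller run x ≡ just w
    label-calling w eq with child w X in eq′
    label-calling w refl | just x = proj₂ (child-just w X eq′)
    ... | nothing with caller run w
    label-calling w () | nothing | nothing
    ... | just y with _∈?_ Fin._≟_ y X
    label-calling w () | nothing | just y | yes _
    label-calling w () | nothing | just y | no _

    label-calledBy : ∀ w {x} → label w ≡ calledBy x → caller run w ≡ just x
    label-calledBy w eq with child w X
    label-calledBy w () | just _
    ... | nothing with caller run w
    label-calledBy w () | nothing | nothing
    ... | just y with _∈?_ Fin._≟_ y X
    label-calledBy w refl | nothing | just y | yes _ = refl
    label-calledBy w ()   | nothing | just y | no _

    calls-modulator : ∀ {w x} → x ∈ X → caller run x ≡ just w → ∃[ z ] label w ≡ calling z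
    calls-modulator {w} x∈ eq with child w X in eq′
    ... | just z  = z , refl
    ... | nothing = contradiction eq (child-nothing w X eq′ x∈)

    called-by-modulator : ∀ {w x} → x ∈ X → caller run w ≡ just x →
                          (∃[ z ] label w ≡ calling z) ⊎ label w ≡ calledBy x
    called-by-modulator {w} {x} x∈ eq with child w X
    ... | just z = inj₁ (z , refl)
    ... | nothing rewrite eq with _∈?_ Fin._≟_ x X
    ...   | yes _ = inj₂ refl
    ...   | no x∉ = contradiction x∈ x∉

    -- The label `calling x` determines its vertex, the one caller of `x`; the label `calledBy x`
    -- goes only to vertices called by `x`, which `calls-bound` counts.
    within-capacity : ∀ ℓ → NotModulator ℓ → count (λ x → label x is ℓ) K ≤ capacity ℓ
    within-capacity plain         _  = count-length _ K
    within-capacity (modulator x) nm = contradiction refl (nm x)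
    within-capacity (calledBy x)  _  =
      ≤-trans (count-mono K (λ {w} _ eq → dec-true (Maybe.≡-dec Fin._≟_ (caller run w) (just x))
                                            (label-calledBy w (is-true eq))))
        (≤-trans (calls-bound run x K K-unique)
          (≤-reflexive (trans (cong (λ b → T + (if b then 1 else 0)) (silent x)) (+-identityʳ T))))
    within-capacity (calling x) _ with caller run x in eq
    ... | nothing = ≤-trans (≤-reflexive (count-none K (λ {w} _ → is-false (λ eq′ →
                      contradiction (trans (sym eq) (label-calling w eq′)) λ ())))) z≤n
    ... | just w₀ = ≤-trans (count-≤suc {q = λ _ → false} K w₀ K-unique (λ {w} _ w≢w₀ eq′ →
                      contradiction (sym (just-injective (trans (sym eq) (label-calling w (is-true eq′))))) w≢w₀))
                      (s≤s (≤-reflexive (count-none K (λ _ → refl))))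

    labelled : Labelling
    labelled = labelAll label K modulators

    ∈-labelled : ∀ {w ℓ} → (w , ℓ) ∈ labelled → (w ∈ X × ℓ ≡ modulator w) ⊎ (w ∈ K × ℓ ≡ label w)
    ∈-labelled w∈ with ∈-labelAll⁻ label label∈labels label-notModulator K w∈
    ... | inj₁ w∈K = inj₂ w∈K
    ... | inj₂ w∈′ with ∈-map⁻ _ w∈′
    ...   | x , x∈ , refl = inj₁ (x∈ , refl)

    label-of : ∀ {w ℓ} → (w , ℓ) ∈ labelled → NotModulator ℓ → ℓ ≡ label w
    label-of w∈ nm with ∈-labelled w∈
    ... | inj₁ (_ , refl) = contradiction refl (nm _)
    ... | inj₂ (_ , eq)   = eq

    linked : ∀ {u x ℓ} → label u ≡ ℓ → x ∈ links₀ ℓ → (∀ {w} → label w ≡ ℓ → adj w x ≡ true) →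
             NotModulator ℓ → x ∈ links ℓ labelled
    linked {ℓ = ℓ} _ x∈ all nm = ∈-links⁺ ℓ labelled x∈ (λ w∈ → all (sym (label-of w∈ nm)))

    -- No other vertex carries this label, so being linked to it means being adjacent to `u` alone.
    calling-linked : ∀ {u x z} → label u ≡ calling z → x ∈ X → adj u x ≡ true →
                     x ∈ links (label u) labelled
    calling-linked {u} {x} {z} eq x∈ u~x rewrite eq =
      linked eq x∈ (λ {w} eq′ → subst (λ y → adj y x ≡ true)
        (just-injective (trans (sym (label-calling u eq)) (label-calling w eq′))) u~x) (λ _ ())

    fits : Fits labelled run
    fits {w} {u} eq u∈ w∈ with ∈-labelled u∈ | ∈-labelled w∈
    ... | inj₁ (_ , refl)   | inj₁ (_ , refl)   = caller-adj run eq
    ... | inj₁ (u∈X , refl) | inj₂ (_ , refl)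
      rewrite descAt-cl labelled (label w) (label-notModulator w) =
      memᵇ-complete encV (u-linked (called-by-modulator u∈X eq))
      where
      u-linked : (∃[ z ] label w ≡ calling z) ⊎ label w ≡ calledBy u → u ∈ links (label w) labelled
      u-linked (inj₁ (z , eq′)) = calling-linked eq′ u∈X (trans (adj-sym w u) (caller-adj run eq))
      u-linked (inj₂ eq′) rewrite eq′ =
        linked eq′ (here refl)
          (λ {y} eq″ → trans (adj-sym y u) (caller-adj run (label-calledBy y eq″))) (λ _ ())
    ... | inj₂ (_ , refl)   | inj₁ (w∈X , refl)
      rewrite descAt-cl labelled (label u) (label-notModulator u) =
      memᵇ-complete encV (calling-linked (proj₂ (calls-modulator w∈X eq)) w∈X (caller-adj run eq))
    ... | inj₂ (_ , refl)   | inj₂ (_ , refl)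
      rewrite descAt-cl labelled (label u) (label-notModulator u)
            | descAt-cl labelled (label w) (label-notModulator w) = refl

    complete : length K + length X ≤ v → Path (length K + (T + (v + v))) start
    complete ≤v = complete-assign label label∈labels label-notModulator K modulators id
      (λ ℓ nm → ≤-trans (≤-reflexive (trans (cong (count (λ x → label x is ℓ) K +_) (none ℓ nm))
                                            (+-identityʳ _)))
                        (within-capacity ℓ nm))
      (Path-mono (+-monoʳ-≤ T (+-mono-≤ few few))
        (complete-idle (good (partial-all label label∈labels label-notModulator K partial₀)) run fits))
      where
      none : ∀ ℓ → NotModulator ℓ → count (λ p → proj₂ p is ℓ) modulators ≡ 0
      none ℓ nm = count-none modulators λ p∈ → other (∈-map⁻ _ p∈)
        where
        other : ∀ {p} → ∃[ x ] (x ∈ X × p ≡ (x , modulator x)) → proj₂ p is ℓ ≡ false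
        other (x , _ , refl) = is-false (λ eq → nm x (sym eq))
      few : remaining labelled ⁅ s ⁆ ≤ v
      few = ≤-trans (count-length _ labelled)
        (≤-trans (≤-reflexive (trans (length-labelAll label label∈labels label-notModulator K modulators)
                   (cong (length K +_) (length-map _ X)))) ≤v)

-- The upper bound |X| + log |K| + O(1)

count-complement : ∀ {A : Set} (p : A → Bool) xs → count p xs + count (not ∘ p) xs ≡ length xs
count-complement p [] = refl
count-complement p (x ∷ xs) with p x
... | true  = cong suc (count-complement p xs)
... | false = trans (+-suc _ _) (cong suc (count-complement p xs))

value-inc : ∀ ds → value (inc ds) ≡ suc (value ds)
value-inc []           = refl
value-inc (false ∷ ds) = refl
value-inc (true ∷ ds) rewrite value-inc ds = cong (2 +_) (+-suc (value ds) (value ds))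

value-bits : ∀ n → value (bits n) ≡ n
value-bits zero    = refl
value-bits (suc n) = trans (value-inc (bits n)) (cong suc (value-bits n))

-- The extreme case has all digits equal to 2 and value `2^(l+1) - 2` for `l` digits.
value<2^ : ∀ ds → 2 + value ds ≤ 2 ^ suc (length ds)
value<2^ []       = ≤-refl
value<2^ (d ∷ ds) = ≤-trans (digit d) (*-monoʳ-≤ 2 (value<2^ ds))
  where
  digit : ∀ d → 2 + value (d ∷ ds) ≤ 2 * (2 + value ds)
  digit false = slack 1 (arith (value ds))
    where
    arith : ∀ x → 2 + (1 + (x + x)) + 1 ≡ 2 * (2 + x)
    arith = solve-∀
  digit true = slack 0 (arith (value ds))
    where
    arith : ∀ x → 2 + (2 + (x + x)) + 0 ≡ 2 * (2 + x)
    arith = solve-∀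

module UpperBound {v : ℕ} (G : Graph v) (connected : Connected G)
    (s : Fin v) (K Y : List (Fin v))
    (X-unique : Unique (s ∷ Y)) (K-unique : Unique K)
    (K∪X : ∀ w → w ∈ K ⊎ w ∈ s ∷ Y)
    (K-clique : ∀ {u w} → u ∈ K → w ∈ K → u ≢ w → Graph.adj G u w ≡ true) where
  open Graph G
  open Runs G
  open Setup G using (roundLimit)

  private
    X = s ∷ Y
    inf un : Subset v → Fin v → Bool
    inf J x = lookup J x
    un  J x = not (lookup J x)

  crossing : ∀ (J : Subset v) {x w} → Star _~_ x w → lookup J x ≡ true → lookup J w ≡ false →
             ∃[ u ] ∃[ y ] (lookup J u ≡ true × lookup J y ≡ false × adj u y ≡ true)
  crossing J ε Jx Jw = contradiction (trans (sym Jx) Jw) true≢false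
  crossing J {x} (_◅_ {j = y} x~y path) Jx Jw with lookup J y in Jy
  ... | true  = crossing J path Jy Jw
  ... | false = x , y , Jx , Jy , T⇒≡ x~y

  count-pick : ∀ {p q : Fin v → Bool} xs → Unique xs → ∀ {x} → x ∈ xs → p x ≡ true → q x ≡ false →
               (∀ y → y ≢ x → p y ≡ q y) → count p xs ≡ suc (count q xs)
  count-pick xs uq x∈ px qx same =
    count-drop id xs (subst Unique (sym (map-id xs)) uq) x∈ px qx (λ _ → same _)

  fewer : ∀ J w xs → count (un (J [ w ]≔ true)) xs ≤ count (un J) xs
  fewer J w xs = count-mono xs imp
    where
    imp : ∀ {x} → x ∈ xs → un (J [ w ]≔ true) x ≡ true → un J x ≡ true
    imp {x} _ eq with x Fin.≟ w
    ... | yes refl =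
      contradiction (trans (sym eq) (cong not (lookup∘update x J true))) true≢false
    ... | no x≢w   = trans (cong not (sym (lookup∘update′ x≢w J true))) eq

  uninformed-drop : ∀ J w xs → Unique xs → w ∈ xs → lookup J w ≡ false →
                    count (un J) xs ≡ suc (count (un (J [ w ]≔ true)) xs)
  uninformed-drop J w xs uq w∈ Jw = count-pick xs uq w∈ (cong not Jw)
    (cong not (lookup∘update w J true)) (λ y y≢w → cong not (sym (lookup∘update′ y≢w J true)))

  informed-grow : ∀ J w xs → Unique xs → w ∈ xs → lookup J w ≡ false →
                  count (inf (J [ w ]≔ true)) xs ≡ suc (count (inf J) xs)
  informed-grow J w xs uq w∈ Jw = count-pick xs uq w∈
    (lookup∘update w J true) Jw (λ y y≢w → lookup∘update′ y≢w J true)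

  still : ∀ (J : Subset v) x w → lookup J x ≡ true → lookup (J [ w ]≔ true) x ≡ true
  still J x w Jx with x Fin.≟ w
  ... | yes refl = lookup∘update x J true
  ... | no x≢w   = trans (lookup∘update′ x≢w J true) Jx

  all-done : ∀ J → count (un J) K ≡ 0 → count (un J) X ≡ 0 → ∀ w → lookup J w ≡ true
  all-done J noK noX w with K∪X w
  ... | inj₁ w∈ = Bool.not-injective (count-zero K noK w∈)
  ... | inj₂ w∈ = Bool.not-injective (count-zero X noX w∈)

  -- Once `K` is informed, an edge leaving the informed set ends in `X`; so every round informs at
  -- least one more vertex of `X`.
  finish : ∀ a {A J} → lookup J s ≡ true → count (un J) X ≤ a → count (un J) K ≡ 0 → Run a A J
  finish a {A} {J} Js ≤a noK with count (un J) X in eq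
  ... | zero  = stop (all-done J noK eq)
  finish (suc a) {A} {J} Js (s≤s ≤a) noK | suc m with count-suc X eq
  ... | w , w∈ , unw with crossing J (connected s w) Js (Bool.not-injective unw)
  ... | u , y , Ju , Jy , u~y with K∪X y
  ...   | inj₁ y∈ = contradiction (trans (sym (cong not Jy)) (count-zero K noK y∈)) true≢false
  ...   | inj₂ y∈ = newRound (call u y Ju Jy u~y
    (finish a (still J s y Js)
      (≤-trans (≤-reflexive (suc-injective (trans (sym (uninformed-drop J y X X-unique y∈ Jy)) eq))) ≤a)
      (n≤0⇒n≡0 (≤-trans (fewer J y K) (≤-reflexive noK)))))

  none-uninformed : ∀ J → length K ≤ count (inf J) K → count (un J) K ≡ 0
  none-uninformed J K≤ = n≤0⇒n≡0 (+-cancelˡ-≤ (count (inf J) K) _ _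
    (≤-trans (≤-reflexive (count-complement (inf J) K)) (≤-trans K≤ (≤-reflexive (sym (+-identityʳ _))))))

  -- `j` doublings are still to be made and `a` rounds are reserved for `X`. Within one round,
  -- `double` keeps the sum of the informed vertices of `K` and its `m` available callers constant:
  -- each call turns a caller into an informed vertex.
  spread : ∀ j a {A J} → lookup J s ≡ true → count (un J) X ≤ a →
           length K ≤ count (inf J) K * 2 ^ j → Run (a + j) A J
  double : ∀ j a m {A J} → count (inf A) K ≡ m → (∀ x → lookup A x ≡ true → lookup J x ≡ true) →
           lookup J s ≡ true → count (un J) X ≤ a →
           length K ≤ (count (inf J) K + m) * 2 ^ j → Run (a + j) A J

  spread zero a {A} {J} Js ≤a K≤ = subst (λ r → Run r A J) (sym (+-identityʳ a))
    (finish a Js ≤a (none-uninformed J (≤-trans K≤ (≤-reflexive (*-identityʳ _)))))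
  spread (suc j) a {A} {J} Js ≤a K≤ = subst (λ r → Run r A J) (sym (+-suc a j))
    (newRound (double j a _ refl (λ _ → id) Js ≤a
      (≤-trans K≤ (≤-reflexive (arith (count (inf J) K) (2 ^ j))))))
    where
    arith : ∀ c x → c * (2 * x) ≡ (c + c) * x
    arith = solve-∀

  double j a zero {A} {J} _ A⊆J Js ≤a K≤ =
    spread j a Js ≤a (≤-trans K≤ (≤-reflexive (cong (_* 2 ^ j) (+-identityʳ (count (inf J) K)))))
  double j a (suc m) {A} {J} avail A⊆J Js ≤a K≤ with count (un J) K in noK
  ... | zero = spread j a Js ≤a (≤-trans (≤-reflexive full) (m≤m*n _ (2 ^ j) {{m^n≢0 2 j}}))
    where
    full : length K ≡ count (inf J) K
    full = trans (sym (count-complement (inf J) K)) (trans (cong (count (inf J) K +_) noK) (+-identityʳ _))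
  ... | suc _ with count-suc K avail | count-suc K noK
  ...   | u , u∈ , Au | w , w∈ , unw =
    call u w Au Jw (K-clique u∈ w∈ u≢w)
      (double j a m avail′ A⊆J′ (still J s w Js) (≤-trans (fewer J w X) ≤a)
        (≤-trans K≤ (≤-reflexive (cong (_* 2 ^ j)
          (trans (+-suc _ m) (cong (_+ m) (sym (informed-grow J w K K-unique w∈ Jw))))))))
    where
    Jw : lookup J w ≡ false
    Jw = Bool.not-injective unw
    u≢w : u ≢ w
    u≢w refl = true≢false (trans (sym (A⊆J u Au)) Jw)
    avail′ : count (inf (A [ u ]≔ false)) K ≡ m
    avail′ = suc-injective (trans (sym (count-pick K K-unique u∈ Au (lookup∘update u A false)
      (λ y y≢u → sym (lookup∘update′ y≢u A false)))) avail)
    A⊆J′ : ∀ x → lookup (A [ u ]≔ false) x ≡ true → lookup (J [ w ]≔ true) x ≡ true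
    A⊆J′ x Ax with x Fin.≟ u
    ... | yes refl = contradiction (trans (sym Ax) (lookup∘update u A false)) true≢false
    ... | no x≢u   = still J x w (A⊆J x (trans (sym (lookup∘update′ x≢u A false)) Ax))

  -- While nobody in `K` is informed, an edge leaving the informed set either ends in `X`, which is
  -- paid from `a`, or enters `K`, after which `spread` takes over. The additional round is the one
  -- that enters `K`.
  reach-clique : ∀ j a {A J} → lookup J s ≡ true → count (un J) X ≤ a → length K ≤ 2 ^ j →
                 Run (suc (a + j)) A J
  reach-clique j a {A} {J} Js ≤a K≤ with count (inf J) K in eqK
  ... | suc c = newRound (spread j a Js ≤a
      (≤-trans K≤ (≤-trans (m≤m+n _ (c * 2 ^ j)) (≤-reflexive (cong (_* 2 ^ j) (sym eqK))))))
  ... | zero with count (un J) X in eqX | count (un J) K in eqU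
  ...   | zero  | zero  = stop (all-done J eqU eqX)
  ...   | zero  | suc _ = one-call (count-suc K eqU)
    where
    one-call : ∃[ w ] (w ∈ K × un J w ≡ true) → Run (suc (a + j)) A J
    one-call (w , _ , unw) with crossing J (connected s w) Js (Bool.not-injective unw)
    ... | u , y , Ju , Jy , u~y with K∪X y
    ...   | inj₂ y∈ = contradiction (trans (sym (cong not Jy)) (count-zero X eqX y∈)) true≢false
    ...   | inj₁ y∈ = newRound (call u y Ju Jy u~y (spread j a (still J s y Js)
        (≤-trans (fewer J y X) (≤-trans (≤-reflexive eqX) z≤n))
        (≤-trans K≤ (≤-reflexive (sym (trans
          (cong (_* 2 ^ j) (trans (informed-grow J y K K-unique y∈ Jy) (cong suc eqK))) (+-identityʳ _)))))))
  reach-clique j (suc a) {A} {J} Js (s≤s ≤a) K≤ | zero | suc m | _ = one-call (count-suc X eqX)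
    where
    one-call : ∃[ w ] (w ∈ X × un J w ≡ true) → Run (suc (suc a + j)) A J
    one-call (w , _ , unw) with crossing J (connected s w) Js (Bool.not-injective unw)
    ... | u , y , Ju , Jy , u~y with K∪X y
    ...   | inj₂ y∈ = newRound (call u y Ju Jy u~y (reach-clique j a (still J s y Js)
        (≤-trans (≤-reflexive (suc-injective (trans (sym (uninformed-drop J y X X-unique y∈ Jy)) eqX))) ≤a) K≤))
    ...   | inj₁ y∈ = newRound (call u y Ju Jy u~y (spread j (suc a) (still J s y Js)
        (≤-trans (fewer J y X) (≤-trans (≤-reflexive eqX) (s≤s ≤a)))
        (≤-trans K≤ (≤-reflexive (sym (trans
          (cong (_* 2 ^ j) (trans (informed-grow J y K K-unique y∈ Jy) (cong suc eqK))) (+-identityʳ _)))))))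

  limit-run : Run (roundLimit K Y) ⊥ ⁅ s ⁆
  -- The source is already informed, which leaves `length Y` vertices of `X`; the exponent is one
  -- more than the number of digits by `value<2^`.
  limit-run = reach-clique (suc (length (bits (length K)))) (length Y) source-informed few
    (≤-trans (≤-trans (≤-reflexive (sym (value-bits (length K)))) (m≤n+m _ 2))
             (value<2^ (bits (length K))))
    where
    source-informed : lookup ⁅ s ⁆ s ≡ true
    source-informed = []=⇒lookup (x∈⁅x⁆ s)
    few : count (un ⁅ s ⁆) X ≤ length Y
    few with un ⁅ s ⁆ s | cong not source-informed
    ... | false | _ = count-length (un ⁅ s ⁆) Y

-- The modulator

unique-⊆-length : ∀ {A : Set} {xs ys : List A} → Unique xs → (∀ {x} → x ∈ xs → x ∈ ys) →
                  length xs ≤ length ys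
unique-⊆-length {xs = []}     _         _  = z≤n
unique-⊆-length {xs = x ∷ xs} (x∉ ∷ uq) ⊆ys with ∈-∃++ (⊆ys (here refl))
... | as , bs , refl = ≤-trans (s≤s (unique-⊆-length uq ⊆rest))
    (≤-reflexive (sym (Perm.↭-length (Perm.shift x as bs))))
  where
  ⊆rest : ∀ {y} → y ∈ xs → y ∈ as ++ bs
  ⊆rest y∈ with ∈-++⁻ as (⊆ys (there y∈))
  ... | inj₁ y∈as          = ∈-++⁺ˡ y∈as
  ... | inj₂ (here refl)   = contradiction refl (All.lookup x∉ y∈)
  ... | inj₂ (there y∈bs)  = ∈-++⁺ʳ as y∈bs

unique-resp : ∀ {A : Set} {xs ys : List A} → xs ↭ ys → Unique xs → Unique ys
unique-resp refl          uq        = uq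
unique-resp (prep x p)    (x∉ ∷ uq) = Perm.All-resp-↭ p x∉ ∷ unique-resp p uq
unique-resp (swap x y p)  ((x≢y ∷ x∉) ∷ y∉ ∷ uq) =
  ((λ eq → x≢y (sym eq)) ∷ Perm.All-resp-↭ p y∉) ∷ Perm.All-resp-↭ p x∉ ∷ unique-resp p uq
unique-resp (_↭_.trans p q) uq        = unique-resp q (unique-resp p uq)

unique-++⁻ : ∀ {A : Set} (xs : List A) {ys} → Unique (xs ++ ys) →
             Unique xs × Unique ys × (∀ {w} → w ∈ xs → w ∉ ys)
unique-++⁻ []       uq        = [] , uq , λ ()
unique-++⁻ (x ∷ xs) (x∉ ∷ uq) =
  let uxs , uys , disjoint = unique-++⁻ xs uq in
  All.tabulate (λ y∈ → All.lookup x∉ (∈-++⁺ˡ y∈)) ∷ uxs , uys ,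
  λ { (here refl) w∈ → All.lookup x∉ (∈-++⁺ʳ xs w∈) refl ; (there w∈) → disjoint w∈ }

unique-select : ∀ {A : Set} (p : A → Bool) xs → Unique xs → Unique (select p xs)
unique-select p []       _         = []
unique-select p (x ∷ xs) (x∉ ∷ uq) with p x
... | true  = All.tabulate (λ y∈ → All.lookup x∉ (proj₁ (∈-select⁻ p xs y∈))) ∷ unique-select p xs uq
... | false = unique-select p xs uq

count≤∣∣ : ∀ {n} (M : Subset n) xs → Unique xs → count (lookup M) xs ≤ Subset.∣ M ∣
count≤∣∣ M []       _         = z≤n
count≤∣∣ M (x ∷ xs) (x∉ ∷ uq) with lookup M x in eq
... | false = count≤∣∣ M xs uq
... | true  = ≤-trans (s≤s (≤-trans (count-mono xs removed) (count≤∣∣ (M Subset.- x) xs uq)))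
                      (x∈p⇒∣p-x∣<∣p∣ (lookup⇒[]= x M eq))
  where
  removed : ∀ {y} → y ∈ xs → lookup M y ≡ true → lookup (M Subset.- x) y ≡ true
  removed {y} y∈ My = []=⇒lookup
    (x∈p∧x≢y⇒x∈p-y (lookup⇒[]= y M My) (λ { refl → All.lookup x∉ y∈ refl }))

module Greedy {v : ℕ} (G : Graph v) (s : Fin v) where
  open Graph G
  open Machine G
  open Setup G
  open Injectivity G

  Clique : List (Fin v) → Set
  Clique xs = ∀ {u w} → u ∈ xs → w ∈ xs → u ≢ w → adj u w ≡ true

  data Paired : List (Fin v) → Set where
    []   : Paired []
    pair : ∀ {u x Y} → adj x u ≡ false → Paired Y → Paired (u ∷ x ∷ Y)

  notSource : Fin v → Bool
  notSource x = not (eqᵇ (encV x) (encV s))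

  find-nothing : ∀ x K → findNon x K ≡ nothing → ∀ {u} → u ∈ K → adj x u ≡ true
  find-nothing x (y ∷ ys) eq u∈ with adj x y in x~y
  ... | true with findNon x ys in eq′
  find-nothing x (y ∷ ys) eq (here refl) | true | nothing = x~y
  find-nothing x (y ∷ ys) eq (there u∈)  | true | nothing = find-nothing x ys eq′ u∈

  find-just : ∀ x K {u us} → findNon x K ≡ just (u , us) → K ↭ u ∷ us × adj x u ≡ false
  find-just x (y ∷ ys) eq with adj x y in x~y
  find-just x (y ∷ ys) refl | false = ↭-refl , x~y
  ... | true with findNon x ys in eq′
  find-just x (y ∷ ys) refl | true | just (w , ws) =
    let p , x≁w = find-just x ys eq′ in ↭-trans (prep y p) (swap y w ↭-refl) , x≁w

  -- One permutation carries all the facts on the partition: disjointness, absence of duplicates,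
  -- and that no vertex except the source is lost.
  record Result (xs K Y : List (Fin v)) (R : List (Fin v) × List (Fin v)) : Set where
    constructor result
    field
      clique : Clique (proj₁ R)
      paired : Paired (proj₂ R)
      perm   : proj₁ R ++ proj₂ R ↭ K ++ (Y ++ select notSource xs)

  private
    clique-∷ : ∀ {x K} → Clique K → (∀ {u} → u ∈ K → adj x u ≡ true) → Clique (x ∷ K)
    clique-∷ cK ~K (here refl) (here refl) u≢w = contradiction refl u≢w
    clique-∷ cK ~K (here refl) (there w∈)  _   = ~K w∈
    clique-∷ {x} cK ~K {u} (there u∈)  (here refl) _   = trans (adj-sym u x) (~K u∈)
    clique-∷ cK ~K (there u∈)  (there w∈)  u≢w = cK u∈ w∈ u≢w

    select-drop : ∀ x xs → notSource x ≡ false → select notSource (x ∷ xs) ≡ select notSource xs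
    select-drop x xs eq rewrite eq = refl

    select-keep : ∀ x xs → notSource x ≡ true → select notSource (x ∷ xs) ≡ x ∷ select notSource xs
    select-keep x xs eq rewrite eq = refl

    rest≡ : ∀ {L : List (Fin v)} K Y {zs zs′} → zs ≡ zs′ → L ↭ K ++ (Y ++ zs′) → L ↭ K ++ (Y ++ zs)
    rest≡ K Y refl p = p

    move₁ : ∀ (x : Fin v) K Y xs → (x ∷ K) ++ (Y ++ xs) ↭ K ++ (Y ++ x ∷ xs)
    move₁ x K Y xs = ↭-sym (↭-trans (Perm.++⁺ˡ K (Perm.shift x Y xs)) (Perm.shift x K (Y ++ xs)))

    move₂ : ∀ (u x : Fin v) {K us} Y xs → K ↭ u ∷ us →
            us ++ ((u ∷ x ∷ Y) ++ xs) ↭ K ++ (Y ++ x ∷ xs)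
    move₂ u x {K} {us} Y xs p = ↭-trans (Perm.shift u us (x ∷ Y ++ xs))
      (↭-trans (Perm.++⁺ʳ (x ∷ Y ++ xs) (↭-sym p)) (Perm.++⁺ˡ K (↭-sym (Perm.shift x Y xs))))

  greedy-result : ∀ xs K Y → Clique K → Paired Y → Result xs K Y (greedy s xs K Y)
  greedy-result [] K Y cK pY = result cK pY (Perm.++⁺ˡ K (↭-sym (Perm.++-identityʳ Y)))
  greedy-result (x ∷ xs) K Y cK pY with eqᵇ (encV x) (encV s) in source
  ... | true with greedy-result xs K Y cK pY
  ...   | result clique paired perm =
    result clique paired (rest≡ K Y (select-drop x xs (cong not source)) perm)
  greedy-result (x ∷ xs) K Y cK pY | false with findNon x K in eq
  ... | nothing with greedy-result xs (x ∷ K) Y (clique-∷ cK (find-nothing x K eq)) pY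
  ...   | result clique paired perm =
    result clique paired (rest≡ K Y (select-keep x xs (cong not source))
      (↭-trans perm (move₁ x K Y (select notSource xs))))
  greedy-result (x ∷ xs) K Y cK pY | false | just (u , us) with find-just x K eq
  ... | p , x≁u with greedy-result xs us (u ∷ x ∷ Y)
        (λ u∈ w∈ → cK (Perm.∈-resp-↭ (↭-sym p) (there u∈)) (Perm.∈-resp-↭ (↭-sym p) (there w∈)))
        (pair x≁u pY)
  ...   | result clique paired perm =
    result clique paired (rest≡ K Y (select-keep x xs (cong not source))
      (↭-trans perm (move₂ u x Y (select notSource xs) p)))

  K Y X : List (Fin v)
  K = proj₁ (greedy s (allFin v) [] [])
  Y = proj₂ (greedy s (allFin v) [] [])
  X = s ∷ Y

  private
    final : Result (allFin v) [] [] (greedy s (allFin v) [] [])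
    final = greedy-result (allFin v) [] [] (λ ()) []

    split : Unique K × Unique Y × (∀ {w} → w ∈ K → w ∉ Y)
    split = unique-++⁻ K (unique-resp (↭-sym (Result.perm final))
              (unique-select notSource (allFin v) (allFin⁺ v)))

    s∉ : s ∉ K ++ Y
    s∉ s∈ with ∈-select⁻ notSource (allFin v) (Perm.∈-resp-↭ (Result.perm final) s∈)
    ... | _ , eq rewrite eqᵇ-refl (encV s) = contradiction eq (λ ())

  K-clique : Clique K
  K-clique = Result.clique final

  K-unique : Unique K
  K-unique = proj₁ split

  X-unique : Unique X
  X-unique = ¬Any⇒All¬ Y (s∉ ∘ ∈-++⁺ʳ K) ∷ proj₁ (proj₂ split)

  K∩X : ∀ {w} → w ∈ K → w ∉ X
  K∩X w∈K (here refl) = s∉ (∈-++⁺ˡ w∈K)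
  K∩X w∈K (there w∈Y) = proj₂ (proj₂ split) w∈K w∈Y

  K∪X : ∀ w → w ∈ K ⊎ w ∈ X
  K∪X w with w Fin.≟ s
  ... | yes refl = inj₂ (here refl)
  ... | no w≢s with ∈-++⁻ K (Perm.∈-resp-↭ (↭-sym (Result.perm final))
                     (∈-select⁺ notSource (∈-allFin w) different))
    where
    different : notSource w ≡ true
    different with eqᵇ (encV w) (encV s) in eq
    ... | false = refl
    ... | true  = contradiction (encV-injective (eqᵇ-sound _ _ eq)) w≢s
  ...   | inj₁ w∈K = inj₁ w∈K
  ...   | inj₂ w∈Y = inj₂ (there w∈Y)

  K+X≤v : length K + length X ≤ v
  K+X≤v = ≤-trans (≤-reflexive lengths)
    (≤-trans (unique-⊆-length {ys = allFin v} all-unique (λ {w} _ → ∈-allFin w))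
             (≤-reflexive (length-tabulate id)))
    where
    lengths : length K + length X ≡ length (s ∷ (K ++ Y))
    lengths = trans (+-suc _ _) (cong suc (sym (length-++ K)))
    all-unique : Unique (s ∷ (K ++ Y))
    all-unique = ¬Any⇒All¬ (K ++ Y) s∉ ∷
      unique-resp (↭-sym (Result.perm final)) (unique-select notSource (allFin v) (allFin⁺ v))

  half : ∀ M → IsModulator G M → ∀ {Z} → Unique Z → Paired Z → length Z ≤ 2 * count (lookup M) Z
  half M mod _ [] = z≤n
  half M mod {u ∷ x ∷ Z} ((u≢x ∷ _) ∷ _ ∷ uq) (pair x≁u p)
    with lookup M u in Mu | lookup M x in Mx | half M mod uq p
  ... | true  | true  | ih = ≤-trans (s≤s (s≤s ih)) (slack 2 (arith (count (lookup M) Z)))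
    where
    arith : ∀ c → suc (suc (2 * c)) + 2 ≡ 2 * suc (suc c)
    arith = solve-∀
  ... | true  | false | ih = ≤-trans (s≤s (s≤s ih)) (slack 0 (arith (count (lookup M) Z)))
    where
    arith : ∀ c → suc (suc (2 * c)) + 0 ≡ 2 * suc c
    arith = solve-∀
  ... | false | true  | ih = ≤-trans (s≤s (s≤s ih)) (slack 0 (arith (count (lookup M) Z)))
    where
    arith : ∀ c → suc (suc (2 * c)) + 0 ≡ 2 * suc c
    arith = solve-∀
  ... | false | false | ih = contradiction
    (trans (sym (T⇒≡ (mod x u (false⇒∉ Mx) (false⇒∉ Mu) (λ eq → u≢x (sym eq))))) x≁u) true≢false

  -- Each pair put aside is a non-edge, so every modulator contains one of its ends.
  Y≤2k : ∀ M → IsModulator G M → length Y ≤ 2 * Subset.∣ M ∣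
  Y≤2k M mod = ≤-trans (half M mod (proj₁ (proj₂ split)) (Result.paired final))
                       (*-monoʳ-≤ 2 (count≤∣∣ M Y (proj₁ (proj₂ split))))

-- The number and the size of the states

length-cartesianProductWith : ∀ {A B C : Set} (f : A → B → C) xs ys →
                              length (cartesianProductWith f xs ys) ≡ length xs * length ys
length-cartesianProductWith f []       ys = refl
length-cartesianProductWith f (x ∷ xs) ys = trans (length-++ (map (f x) ys))
  (cong₂ _+_ (length-map (f x) ys) (length-cartesianProductWith f xs ys))

sublists : ∀ {A : Set} → List A → List (List A)
sublists []       = [] ∷ []
sublists (x ∷ xs) = map (x ∷_) (sublists xs) ++ sublists xs

length-sublists : ∀ {A : Set} (xs : List A) → length (sublists xs) ≡ 2 ^ length xs
length-sublists []       = refl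
length-sublists (x ∷ xs) = trans (length-++ (map (x ∷_) (sublists xs)))
  (trans (cong (_+ length (sublists xs)) (length-map (x ∷_) (sublists xs)))
         (trans (cong₂ _+_ (length-sublists xs) (length-sublists xs))
                (cong (2 ^ length xs +_) (sym (+-identityʳ _)))))

∈-sublists-∷⁻ : ∀ {A : Set} (x : A) xs {σ} → σ ∈ sublists (x ∷ xs) →
                (∃[ τ ] (σ ≡ x ∷ τ × τ ∈ sublists xs)) ⊎ σ ∈ sublists xs
∈-sublists-∷⁻ x xs σ∈ with ∈-++⁻ (map (x ∷_) (sublists xs)) σ∈
... | inj₂ σ∈′ = inj₂ σ∈′
... | inj₁ σ∈′ with ∈-map⁻ (x ∷_) σ∈′
...   | τ , τ∈ , eq = inj₁ (τ , eq , τ∈)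

∈-sublists-keep : ∀ {A : Set} (x : A) xs {τ} → τ ∈ sublists xs → x ∷ τ ∈ sublists (x ∷ xs)
∈-sublists-keep x xs τ∈ = ∈-++⁺ˡ (∈-map⁺ (x ∷_) τ∈)

∈-sublists-skip : ∀ {A : Set} (x : A) xs {τ} → τ ∈ sublists xs → τ ∈ sublists (x ∷ xs)
∈-sublists-skip x xs τ∈ = ∈-++⁺ʳ (map (x ∷_) (sublists xs)) τ∈

[]∈sublists : ∀ {A : Set} (xs : List A) → [] ∈ sublists xs
[]∈sublists []       = here refl
[]∈sublists (x ∷ xs) = ∈-sublists-skip x xs ([]∈sublists xs)

self∈sublists : ∀ {A : Set} (xs : List A) → xs ∈ sublists xs
self∈sublists []       = here refl
self∈sublists (x ∷ xs) = ∈-sublists-keep x xs (self∈sublists xs)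

singleton∈sublists : ∀ {A : Set} {x : A} {xs} → x ∈ xs → x ∷ [] ∈ sublists xs
singleton∈sublists (here {xs = xs} refl) = ∈-sublists-keep _ xs ([]∈sublists xs)
singleton∈sublists (there {x = y} {xs} x∈) = ∈-sublists-skip y xs (singleton∈sublists x∈)

-- The links of a label start as a sublist of `X` and are only filtered afterwards, so `2^q` lists
-- cover all that can occur.
select∈sublists : ∀ {A : Set} (p : A → Bool) xs {σ} → σ ∈ sublists xs → select p σ ∈ sublists xs
select∈sublists p []       (here refl) = here refl
select∈sublists p (x ∷ xs) σ∈ with ∈-sublists-∷⁻ x xs σ∈
... | inj₂ σ∈′ = ∈-sublists-skip x xs (select∈sublists p xs σ∈′)
... | inj₁ (τ , refl , τ∈) with p x
...   | true  = ∈-sublists-keep x xs (select∈sublists p xs τ∈)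
...   | false = ∈-sublists-skip x xs (select∈sublists p xs τ∈)

length-sublist : ∀ {A : Set} (xs : List A) {σ} → σ ∈ sublists xs → length σ ≤ length xs
length-sublist []       (here refl) = z≤n
length-sublist (x ∷ xs) σ∈ with ∈-sublists-∷⁻ x xs σ∈
... | inj₂ σ∈′             = m≤n⇒m≤1+n (length-sublist xs σ∈′)
... | inj₁ (τ , refl , τ∈) = s≤s (length-sublist xs τ∈)

suffixes : ∀ {A : Set} → List A → List (List A)
suffixes []       = [] ∷ []
suffixes (x ∷ xs) = (x ∷ xs) ∷ suffixes xs

length-suffixes : ∀ {A : Set} (xs : List A) → length (suffixes xs) ≡ suc (length xs)
length-suffixes []       = refl
length-suffixes (x ∷ xs) = cong suc (length-suffixes xs)

self∈suffixes : ∀ {A : Set} (xs : List A) → xs ∈ suffixes xs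
self∈suffixes []       = here refl
self∈suffixes (x ∷ xs) = here refl

tail∈suffixes : ∀ {A : Set} {y : A} {ys} xs → y ∷ ys ∈ suffixes xs → ys ∈ suffixes xs
tail∈suffixes (x ∷ xs) (here refl) = there (self∈suffixes xs)
tail∈suffixes (x ∷ xs) (there p)   = there (tail∈suffixes xs p)
tail∈suffixes []       (here ())

length-suffix : ∀ {A : Set} (xs : List A) {ys} → ys ∈ suffixes xs → length ys ≤ length xs
length-suffix []       (here refl) = z≤n
length-suffix (x ∷ xs) (here refl) = ≤-refl
length-suffix (x ∷ xs) (there p)   = m≤n⇒m≤1+n (length-suffix xs p)

infixl 4 _⊛_
_⊛_ : ∀ {A B : Set} → List (A → B) → List A → List B
_⊛_ = cartesianProductWith _$_

size-unary : ∀ n → size (encodeUnary n) ≡ 1 + 2 * n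
size-unary zero    = refl
size-unary (suc n) = trans (cong (2 +_) (size-unary n)) (arith n)
  where
  arith : ∀ n → 2 + (1 + 2 * n) ≡ 1 + 2 * suc n
  arith = solve-∀

size-list : ∀ {A : Set} (enc : A → Tree) b xs → (∀ {x} → x ∈ xs → size (enc x) ≤ b) →
            size (encodeList (map enc xs)) ≤ 1 + length xs * (1 + b)
size-list enc b []       _  = ≤-refl
size-list enc b (x ∷ xs) ≤b =
  ≤-trans (s≤s (+-mono-≤ (≤b (here refl)) (size-list enc b xs (≤b ∘ there))))
          (≤-reflexive (arith b (length xs * (1 + b))))
  where
  arith : ∀ b y → suc (b + (1 + y)) ≡ 1 + ((1 + b) + y)
  arith = solve-∀

module Universe {v : ℕ} (G : Graph v) (s : Fin v) (K Y : List (Fin v)) (T : ℕ) where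
  open Graph G
  open Machine G
  open Setup G
  open Labels G s K Y T using (X; ∈-consAll⁻; ∈-addVariant⁻)

  descs : List Desc
  descs = map pt X ++ map cl (sublists X)

  modes : List Mode
  modes = map assign (suffixes K) ++ map hold descs

  cellsUpTo : ℕ → List Cell
  cellsUpTo b = map cell descs ⊛ ns ⊛ ns ⊛ ns ⊛ ns
    where ns = upTo (suc b)

  rows : List ℕ → List (List Cell)
  rows []       = [] ∷ []
  rows (b ∷ bs) = cartesianProductWith _∷_ (cellsUpTo b) (rows bs)

  -- Only the first cell, that of `plain`, has a bound of order `n`. The three cells of each `x`
  -- share the bound `suc T`, which dominates both `T` and `1`; their number may therefore appear in
  -- the exponent.
  bounds : List (Fin v) → List ℕ
  bounds []       = []
  bounds (x ∷ xs) = suc T ∷ suc T ∷ suc T ∷ bounds xs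

  universe : List State
  universe = cartesianProductWith _,_ (cartesianProductWith _,_ (upTo (suc T)) modes)
                                      (rows (length K ∷ bounds X))

  -- A labelling move passes a unit from `room` to `uninf` and a call one from `uninf` to `inf`, so
  -- the total is invariant under all moves.
  record CellOK (b : ℕ) (c : Cell) : Set where
    constructor cellOK
    field
      desc∈  : desc c ∈ descs
      total≤ : room c + (uninf c + inf c) ≤ b
      avail≤ : avail c ≤ inf c

  data CellsOK : List ℕ → List Cell → Set where
    []  : CellsOK [] []
    _∷_ : ∀ {b bs c cs} → CellOK b c → CellsOK bs cs → CellsOK (b ∷ bs) (c ∷ cs)

  CtlOK : Ctl → Set
  CtlOK (r , m) = r ≤ T × m ∈ modes

  Inv : State → Set
  Inv (k , cs) = CtlOK k × CellsOK (length K ∷ bounds X) cs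

  ∈-descs⁻ : ∀ {d} → d ∈ descs → (∃[ x ] (d ≡ pt x)) ⊎ (∃[ σ ] (σ ∈ sublists X × d ≡ cl σ))
  ∈-descs⁻ d∈ with ∈-++⁻ (map pt X) d∈
  ... | inj₁ p = let x , _ , eq = ∈-map⁻ pt p in inj₁ (x , eq)
  ... | inj₂ p = inj₂ (∈-map⁻ cl p)

  cl∈descs : ∀ {σ} → σ ∈ sublists X → cl σ ∈ descs
  cl∈descs σ∈ = ∈-++⁺ʳ (map pt X) (∈-map⁺ cl σ∈)

  pt∈descs : ∀ {x} → x ∈ X → pt x ∈ descs
  pt∈descs x∈ = ∈-++⁺ˡ (∈-map⁺ pt x∈)

  assign∈modes : ∀ {xs} → xs ∈ suffixes K → assign xs ∈ modes
  assign∈modes xs∈ = ∈-++⁺ˡ (∈-map⁺ assign xs∈)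

  hold∈modes : ∀ {d} → d ∈ descs → hold d ∈ modes
  hold∈modes d∈ = ∈-++⁺ʳ (map assign (suffixes K)) (∈-map⁺ hold d∈)

  ∈-modes⁻ : ∀ {m} → m ∈ modes → (∃[ xs ] (xs ∈ suffixes K × m ≡ assign xs)) ⊎
                                 (∃[ d ] (d ∈ descs × m ≡ hold d))
  ∈-modes⁻ m∈ with ∈-++⁻ (map assign (suffixes K)) m∈
  ... | inj₁ p = inj₁ (∈-map⁻ assign p)
  ... | inj₂ p = inj₂ (∈-map⁻ hold p)

  done∈suffixes : ∀ {A : Set} (xs : List A) → [] ∈ suffixes xs
  done∈suffixes []       = here refl
  done∈suffixes (x ∷ xs) = there (done∈suffixes xs)

  rule-inv : ∀ {k b c k′ c′} → CtlOK k → CellOK b c → rule k c ≡ just (k′ , c′) →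
             CtlOK k′ × CellOK b c′
  rule-inv {r , assign []} {c = cell d o u i (suc a)} (r≤ , _) (cellOK d∈ t≤ a≤) refl =
    (r≤ , hold∈modes d∈) , cellOK d∈ t≤ (≤-trans (n≤1+n a) a≤)
  rule-inv {r , assign (x ∷ xs)} {c = cell (cl σ) (suc o) u i a} (r≤ , m∈) (cellOK d∈ t≤ a≤) refl
    with ∈-modes⁻ m∈ | ∈-descs⁻ d∈
  ... | inj₁ (_ , xs∈ , refl) | inj₂ (_ , σ∈ , refl) =
    (r≤ , assign∈modes (tail∈suffixes K xs∈)) ,
    cellOK (cl∈descs (select∈sublists (adj x) X σ∈)) (≤-trans (≤-reflexive (+-suc o (u + i))) t≤) a≤
  rule-inv {r , hold h} {c = cell d o (suc u) i a} (r≤ , _) (cellOK d∈ t≤ a≤) eq with edge h d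
  rule-inv {r , hold h} {c = cell d o (suc u) i a} (r≤ , _) (cellOK d∈ t≤ a≤) refl | true =
    (r≤ , assign∈modes (done∈suffixes K)) ,
    cellOK d∈ (≤-trans (≤-reflexive (cong (o +_) (+-suc u i))) t≤) (m≤n⇒m≤1+n a≤)

  variants-inv : ∀ {bs k cs k′ cs′} → CtlOK k → CellsOK bs cs → (k′ , cs′) ∈ variants k cs →
                 CtlOK k′ × CellsOK bs cs′
  variants-inv {k = k} {c ∷ cs} okk (okc ∷ okcs) t∈
    with ∈-addVariant⁻ (rule k c) cs (consAll c (variants k cs)) t∈
  ... | inj₁ (_ , _ , eq , refl) = let okk′ , okc′ = rule-inv okk okc eq in okk′ , okc′ ∷ okcs
  ... | inj₂ t∈′ with ∈-consAll⁻ c (variants k cs) t∈′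
  ...   | _ , refl , t∈″ = let okk′ , okcs′ = variants-inv okk okcs t∈″ in okk′ , okc ∷ okcs′

  reset-inv : ∀ {bs cs} → CellsOK bs cs → CellsOK bs (map reset cs)
  reset-inv []                             = []
  reset-inv (cellOK d∈ t≤ a≤ ∷ okcs) = cellOK d∈ t≤ ≤-refl ∷ reset-inv okcs

  tick-inv : ∀ {k cs ss t} → Inv (k , cs) → t ∈ tick k cs ss → Inv t ⊎ t ∈ ss
  tick-inv {zero , m}             inv t∈ = inj₂ t∈
  tick-inv {suc r , assign []}    ((r≤ , m∈) , okcs) (here refl) =
    inj₁ ((≤-trans (n≤1+n r) r≤ , m∈) , reset-inv okcs)
  tick-inv {suc r , assign []}    inv (there t∈) = inj₂ t∈
  tick-inv {suc r , assign (_ ∷ _)} inv t∈ = inj₂ t∈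
  tick-inv {suc r , hold d}       inv t∈ = inj₂ t∈

  inv-succs : ∀ {t t′} → Inv t → t′ ∈ succs t → Inv t′
  inv-succs inv (here refl) = inv
  inv-succs inv@(okk , okcs) (there t∈) with tick-inv inv t∈
  ... | inj₁ inv′ = inv′
  ... | inj₂ t∈′  = variants-inv okk okcs t∈′

  inv-init : Inv (initial s K Y T)
  inv-init = (≤-refl , assign∈modes (self∈suffixes K)) ,
    cellOK (cl∈descs ([]∈sublists X)) (≤-reflexive (+-identityʳ (length K))) z≤n ∷
    cellOK (pt∈descs (here refl)) (s≤s z≤n) z≤n ∷
    cellOK (cl∈descs (singleton∈sublists {xs = X} (here refl))) T+0≤ z≤n ∷
    cellOK (cl∈descs (self∈sublists X)) (s≤s z≤n) z≤n ∷
    base-inv Y there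
    where
    T+0≤ : T + 0 ≤ suc T
    T+0≤ = ≤-trans (≤-reflexive (+-identityʳ T)) (n≤1+n T)
    base-inv : ∀ ys → (∀ {y} → y ∈ ys → y ∈ X) → CellsOK (bounds ys) (baseCells ys X T)
    base-inv []       _   = []
    base-inv (y ∷ ys) ys⊆ =
      cellOK (pt∈descs (ys⊆ (here refl))) (s≤s z≤n) z≤n ∷
      cellOK (cl∈descs (singleton∈sublists (ys⊆ (here refl)))) T+0≤ z≤n ∷
      cellOK (cl∈descs (self∈sublists X)) (s≤s z≤n) z≤n ∷
      base-inv ys (ys⊆ ∘ there)

  cell∈ : ∀ {b c} → CellOK b c → c ∈ cellsUpTo b
  cell∈ {b} {cell d o u i a} (cellOK d∈ t≤ a≤) =
    pick (pick (pick (pick (∈-map⁺ cell d∈) (≤-trans (m≤m+n o (u + i)) t≤))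
      (≤-trans (m≤m+n u i) ui≤)) i≤) (≤-trans a≤ i≤)
    where
    pick : ∀ {B : Set} {fs : List (ℕ → B)} {f n} → f ∈ fs → n ≤ b → f n ∈ (fs ⊛ upTo (suc b))
    pick f∈ n≤ = ∈-cartesianProductWith⁺ _$_ f∈ (∈-upTo⁺ (s≤s n≤))
    ui≤ : u + i ≤ b
    ui≤ = ≤-trans (m≤n+m (u + i) o) t≤
    i≤ : i ≤ b
    i≤ = ≤-trans (m≤n+m i u) ui≤

  row∈ : ∀ {bs cs} → CellsOK bs cs → cs ∈ rows bs
  row∈ []           = here refl
  row∈ (okc ∷ okcs) = ∈-cartesianProductWith⁺ _∷_ (cell∈ okc) (row∈ okcs)

  inv⇒∈ : ∀ {t} → Inv t → t ∈ universe
  inv⇒∈ ((r≤ , m∈) , okcs) =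
    ∈-cartesianProductWith⁺ _,_ (∈-cartesianProductWith⁺ _,_ (∈-upTo⁺ (s≤s r≤)) m∈) (row∈ okcs)

  inv-length : ∀ ss → Unique ss → All Inv ss → length ss ≤ length universe
  inv-length ss uq inv = unique-⊆-length uq (λ t∈ → inv⇒∈ (All.lookup inv t∈))

  q N D : ℕ
  q = length X
  N = length K
  D = q + 2 ^ q

  perCell : ℕ → ℕ
  perCell b = D * suc b * suc b * suc b * suc b

  length-⊛ : ∀ {A B : Set} (fs : List (A → B)) xs → length (fs ⊛ xs) ≡ length fs * length xs
  length-⊛ = length-cartesianProductWith _$_

  length-descs : length descs ≡ D
  length-descs = trans (length-++ (map pt X))
    (cong₂ _+_ (length-map pt X) (trans (length-map cl (sublists X)) (length-sublists X)))

  length-cells : ∀ b → length (cellsUpTo b) ≡ perCell b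
  length-cells b =
    trans (length-⊛ (map cell descs ⊛ ns ⊛ ns ⊛ ns) ns) (cong₂ _*_
      (trans (length-⊛ (map cell descs ⊛ ns ⊛ ns) ns) (cong₂ _*_
        (trans (length-⊛ (map cell descs ⊛ ns) ns) (cong₂ _*_
          (trans (length-⊛ (map cell descs) ns) (cong₂ _*_
            (trans (length-map cell descs) length-descs) len)) len)) len)) len)
    where
    ns = upTo (suc b)
    len : length ns ≡ suc b
    len = length-upTo (suc b)

  length-bounds : ∀ xs → length (bounds xs) ≡ length xs * 3
  length-bounds []       = refl
  length-bounds (x ∷ xs) = cong (3 +_) (length-bounds xs)

  length-rows : ∀ xs → length (rows (bounds xs)) ≡ perCell (suc T) ^ (length xs * 3)
  length-rows []       = refl
  length-rows (x ∷ xs) = three (length-rows xs)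
    where
    one : ∀ bs → length (rows (suc T ∷ bs)) ≡ perCell (suc T) * length (rows bs)
    one bs = trans (length-cartesianProductWith _∷_ (cellsUpTo (suc T)) (rows bs))
                   (cong (_* length (rows bs)) (length-cells (suc T)))
    three : ∀ {n} → length (rows (bounds xs)) ≡ n →
            length (rows (bounds (x ∷ xs))) ≡ perCell (suc T) * (perCell (suc T) * (perCell (suc T) * n))
    three refl = trans (one (suc T ∷ suc T ∷ bounds xs)) (cong (perCell (suc T) *_)
      (trans (one (suc T ∷ bounds xs)) (cong (perCell (suc T) *_) (one (bounds xs)))))

  -- The factors count the rounds left, the modes, the cell of `plain`, and the other `3q` cells.
  states : ℕ
  states = suc T * (suc N + D) * (perCell N * perCell (suc T) ^ (q * 3))

  length-universe : length universe ≡ states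
  length-universe = trans (length-cartesianProductWith _,_ ctls (rows (N ∷ bounds X)))
    (cong₂ _*_
      (trans (length-cartesianProductWith _,_ (upTo (suc T)) modes)
        (cong₂ _*_ (length-upTo (suc T)) (trans (length-++ (map assign (suffixes K)))
          (cong₂ _+_ (trans (length-map assign (suffixes K)) (length-suffixes K))
                     (trans (length-map hold descs) length-descs)))))
      (trans (length-cartesianProductWith _∷_ (cellsUpTo N) (rows (bounds X)))
        (cong₂ _*_ (length-cells N) (length-rows X))))
    where
    ctls = cartesianProductWith _,_ (upTo (suc T)) modes

  -- For `sizeV`, a unary index takes at most `1 + 2v` nodes and a row at most `1 + 4v`: an entry
  -- has at most three, and its list cell one more.
  sizeV sizeD sizeC sizeS : ℕ
  sizeV = 3 + 6 * v
  sizeD = 5 + (q * (1 + sizeV) + sizeV)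
  sizeC = 8 + (sizeD + 8 * (N + suc T))
  sizeS = 8 + (2 * T + (N * (1 + sizeV) + sizeD) + (1 + q * 3) * (1 + sizeC))

  size-encV : ∀ x → size (encV x) ≤ sizeV
  size-encV x = ≤-trans (s≤s (+-mono-≤ id≤ row≤)) (≤-reflexive (arith v))
    where
    id≤ : size (encodeUnary (toℕ x)) ≤ 1 + 2 * v
    id≤ = ≤-trans (≤-reflexive (size-unary (toℕ x))) (s≤s (*-monoʳ-≤ 2 (<⇒≤ (toℕ<n x))))
    bool≤ : ∀ b → size (encodeBool b) ≤ 3
    bool≤ false = s≤s z≤n
    bool≤ true  = ≤-refl
    row≤ : size (encodeRow x) ≤ 1 + v * 4
    row≤ = ≤-trans (size-list (λ y → encodeBool (adj x y)) 3 (allFin v) (λ {y} _ → bool≤ (adj x y)))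
                   (s≤s (*-monoˡ-≤ 4 {length (allFin v)} {v} (≤-reflexive (length-tabulate id))))
    arith : ∀ v → suc ((1 + 2 * v) + (1 + v * 4)) ≡ 3 + 6 * v
    arith = solve-∀

  size-encVs : ∀ m xs → length xs ≤ m → size (encVs xs) ≤ 1 + m * (1 + sizeV)
  size-encVs m xs ≤m = ≤-trans (size-list encV sizeV xs (λ {x} _ → size-encV x))
                               (s≤s (*-monoˡ-≤ (1 + sizeV) ≤m))

  size-encDesc : ∀ {d} → d ∈ descs → size (encDesc d) ≤ sizeD
  size-encDesc d∈ with ∈-descs⁻ d∈
  ... | inj₁ (x , refl) = ≤-trans (s≤s (s≤s (size-encV x)))
    (s≤s (s≤s (≤-trans (m≤n+m sizeV (q * (1 + sizeV))) (m≤n+m _ 3))))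
  ... | inj₂ (σ , σ∈ , refl) = +-monoʳ-≤ 4 (≤-trans (size-encVs q σ (length-sublist X σ∈))
    (s≤s (m≤m+n _ sizeV)))

  size-encCell : ∀ {b c} → b ≤ N + suc T → CellOK b c → size (encCell c) ≤ sizeC
  size-encCell {b} {cell d o u i a} b≤ (cellOK d∈ t≤ a≤) =
    ≤-trans (s≤s (+-mono-≤ (size-encDesc d∈) (s≤s (+-mono-≤ (unary≤ o≤)
              (s≤s (+-mono-≤ (unary≤ u≤) (s≤s (+-mono-≤ (unary≤ i≤) (unary≤ (≤-trans a≤ i≤))))))))))
            (≤-reflexive (arith sizeD (N + suc T)))
    where
    o≤ : o ≤ N + suc T
    o≤ = ≤-trans (≤-trans (m≤m+n o (u + i)) t≤) b≤
    u≤ : u ≤ N + suc T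
    u≤ = ≤-trans (≤-trans (m≤m+n u i) (≤-trans (m≤n+m (u + i) o) t≤)) b≤
    i≤ : i ≤ N + suc T
    i≤ = ≤-trans (≤-trans (m≤n+m i u) (≤-trans (m≤n+m (u + i) o) t≤)) b≤
    unary≤ : ∀ {n} → n ≤ N + suc T → size (encodeUnary n) ≤ 1 + 2 * (N + suc T)
    unary≤ {n} n≤ = ≤-trans (≤-reflexive (size-unary n)) (s≤s (*-monoʳ-≤ 2 n≤))
    arith : ∀ d b → suc (d + suc ((1 + 2 * b) + suc ((1 + 2 * b) + suc ((1 + 2 * b) + (1 + 2 * b))))) ≡
            8 + (d + 8 * b)
    arith = solve-∀

  cells-size : ∀ {bs cs} → All (_≤ N + suc T) bs → CellsOK bs cs →
               length cs ≡ length bs × (∀ {c} → c ∈ cs → size (encCell c) ≤ sizeC)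
  cells-size []         []           = refl , λ ()
  cells-size (b≤ ∷ bs≤) (okc ∷ okcs) =
    let len , small = cells-size bs≤ okcs in
    cong suc len , λ { (here refl) → size-encCell b≤ okc ; (there c∈) → small c∈ }

  inv-size : ∀ {t} → Inv t → size (encState t) ≤ sizeS
  inv-size {(r , m) , cs} ((r≤ , m∈) , okcs) =
    ≤-trans (s≤s (+-mono-≤ (s≤s (+-mono-≤ r-size (mode-size (∈-modes⁻ m∈)))) cs-size))
            (≤-reflexive (arith T (N * (1 + sizeV)) sizeD ((1 + q * 3) * (1 + sizeC))))
    where
    bounds≤ : ∀ xs → All (_≤ N + suc T) (bounds xs)
    bounds≤ []       = []
    bounds≤ (x ∷ xs) = m≤n+m (suc T) N ∷ m≤n+m (suc T) N ∷ m≤n+m (suc T) N ∷ bounds≤ xs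
    r-size : size (encodeUnary r) ≤ 1 + 2 * T
    r-size = ≤-trans (≤-reflexive (size-unary r)) (s≤s (*-monoʳ-≤ 2 r≤))
    mode-size : ∀ {m} → (∃[ xs ] (xs ∈ suffixes K × m ≡ assign xs)) ⊎
                        (∃[ d ] (d ∈ descs × m ≡ hold d)) →
                size (encMode m) ≤ 4 + (N * (1 + sizeV) + sizeD)
    mode-size (inj₁ (xs , xs∈ , refl)) = ≤-trans (+-monoʳ-≤ 2 (size-encVs N xs (length-suffix K xs∈)))
      (+-monoʳ-≤ 3 (≤-trans (m≤m+n _ sizeD) (n≤1+n _)))
    mode-size (inj₂ (d , d∈ , refl)) = +-monoʳ-≤ 4 (≤-trans (size-encDesc d∈) (m≤n+m sizeD _))
    cs-size : size (encCells cs) ≤ 1 + (1 + q * 3) * (1 + sizeC)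
    cs-size with cells-size (m≤m+n N (suc T) ∷ bounds≤ X) okcs
    ... | len , small = ≤-trans (size-list encCell sizeC cs small)
      (s≤s (*-monoˡ-≤ (1 + sizeC) {length cs} {1 + q * 3}
        (≤-reflexive (trans len (cong suc (length-bounds X))))))
    arith : ∀ t a d c → suc (suc ((1 + 2 * t) + (4 + (a + d))) + (1 + c)) ≡ 8 + (2 * t + (a + d) + c)
    arith = solve-∀

-- Growth

-- Lets the quadratic exponent absorb linear terms in `k`.
n≤n² : ∀ n → n ≤ n ^ 2
n≤n² zero    = z≤n
n≤n² (suc n) = ≤-trans (m≤m*n (suc n) (suc n)) (≤-reflexive (arith (suc n)))
  where
  arith : ∀ m → m * m ≡ m * (m * 1)
  arith = solve-∀

n≤2^n : ∀ n → n ≤ 2 ^ n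
n≤2^n zero    = z≤n
n≤2^n (suc n) = ≤-trans (+-mono-≤ (m^n>0 2 n) (n≤2^n n)) (+-monoʳ-≤ (2 ^ n) (m≤m+n (2 ^ n) 0))

suc≤2^ : ∀ n → suc n ≤ 2 ^ n
suc≤2^ zero    = ≤-refl
suc≤2^ (suc n) = ≤-trans (+-mono-≤ (m^n>0 2 n) (suc≤2^ n)) (+-monoʳ-≤ (2 ^ n) (m≤m+n (2 ^ n) 0))

^-distribʳ-* : ∀ a b n → (a * b) ^ n ≡ a ^ n * b ^ n
^-distribʳ-* a b zero    = refl
^-distribʳ-* a b (suc n) = trans (cong (a * b *_) (^-distribʳ-* a b n)) (arith a b (a ^ n) (b ^ n))
  where
  arith : ∀ a b x y → a * b * (x * y) ≡ a * x * (b * y)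
  arith = solve-∀

-- Write y ≤ q (1 + y / q) ≤ q 2^(y / q) and raise to the power q.
power≤ : ∀ y q .{{_ : NonZero q}} → y ^ q ≤ q ^ q * 2 ^ y
power≤ y q = begin
  y ^ q                         ≤⟨ ^-monoˡ-≤ q y≤ ⟩
  (q * 2 ^ (y / q)) ^ q         ≡⟨ ^-distribʳ-* q (2 ^ (y / q)) q ⟩
  q ^ q * (2 ^ (y / q)) ^ q     ≡⟨ cong (q ^ q *_) (^-*-assoc 2 (y / q) q) ⟩
  q ^ q * 2 ^ (y / q * q)       ≤⟨ *-monoʳ-≤ (q ^ q) (^-monoʳ-≤ 2 (m/n*n≤m y q)) ⟩
  q ^ q * 2 ^ y                 ∎
  where
  open ≤-Reasoning
  y≤ : y ≤ q * 2 ^ (y / q)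
  y≤ = begin
    y                       ≡⟨ m≡m%n+[m/n]*n y q ⟩
    y % q + y / q * q       ≤⟨ +-monoˡ-≤ _ (<⇒≤ (m%n<n y q)) ⟩
    suc (y / q) * q         ≡⟨ *-comm (suc (y / q)) q ⟩
    q * suc (y / q)         ≤⟨ *-monoʳ-≤ q (suc≤2^ (y / q)) ⟩
    q * 2 ^ (y / q)         ∎

module Growth {I : Set} (κ ν : I → ℕ) (ν>0 : ∀ i → 1 ≤ ν i) where

  bound : ℕ → ℕ → ℕ → I → ℕ
  bound C a d i = C * 2 ^ (a * κ i ^ 2) * ν i ^ d

  -- The class `2^O(κ²) ν^O(1)` with constants uniform in `i`. Bringing two bounds to common
  -- exponents raises the power of `ν`, which is monotone because `ν` is positive.
  Small : (I → ℕ) → Set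
  Small g = Σ[ C ∈ ℕ ] Σ[ a ∈ ℕ ] Σ[ d ∈ ℕ ] (∀ i → g i ≤ bound C a d i)

  bound-mono : ∀ {C C′ a a′ d d′} → C ≤ C′ → a ≤ a′ → d ≤ d′ → ∀ i → bound C a d i ≤ bound C′ a′ d′ i
  bound-mono C≤ a≤ d≤ i = *-mono-≤ (*-mono-≤ C≤ (^-monoʳ-≤ 2 (*-monoˡ-≤ (κ i ^ 2) a≤)))
                                   (^-monoʳ-≤ (ν i) {{>-nonZero (ν>0 i)}} d≤)

  small-≤ : ∀ {f g : I → ℕ} → (∀ i → f i ≤ g i) → Small g → Small f
  small-≤ f≤g (C , a , d , g≤) = C , a , d , λ i → ≤-trans (f≤g i) (g≤ i)

  small-con : ∀ c → Small (λ _ → c)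
  small-con c = c , 0 , 0 , λ i → ≤-reflexive (arith c)
    where
    arith : ∀ c → c ≡ c * 1 * 1
    arith = solve-∀

  small-ν : Small ν
  small-ν = 1 , 0 , 1 , λ i → ≤-reflexive (arith (ν i))
    where
    arith : ∀ n → n ≡ 1 * 1 * (n * 1)
    arith = solve-∀

  small-2^ : ∀ (e : I → ℕ) A B → (∀ i → e i ≤ A * κ i ^ 2 + B) → Small (λ i → 2 ^ e i)
  small-2^ e A B e≤ = 2 ^ B , A , 0 , λ i → ≤-trans (^-monoʳ-≤ 2 (e≤ i)) (≤-reflexive (begin
    2 ^ (A * κ i ^ 2 + B)         ≡⟨ ^-distribˡ-+-* 2 (A * κ i ^ 2) B ⟩
    2 ^ (A * κ i ^ 2) * 2 ^ B     ≡⟨ *-comm (2 ^ (A * κ i ^ 2)) (2 ^ B) ⟩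
    2 ^ B * 2 ^ (A * κ i ^ 2)     ≡⟨ *-identityʳ _ ⟨
    2 ^ B * 2 ^ (A * κ i ^ 2) * 1 ∎))
    where open ≡-Reasoning

  small-κ : Small κ
  small-κ = small-≤ (λ i → n≤2^n (κ i))
    (small-2^ κ 1 0 (λ i → ≤-trans (n≤n² (κ i)) (≤-reflexive (arith (κ i ^ 2)))))
    where
    arith : ∀ n → n ≡ 1 * n + 0
    arith = solve-∀

  small-+ : ∀ {f g : I → ℕ} → Small f → Small g → Small (λ i → f i + g i)
  small-+ {f} {g} (C , a , d , f≤) (C′ , a′ , d′ , g≤) = C + C′ , a + a′ , d + d′ , λ i →
    ≤-trans (+-mono-≤
      (≤-trans (f≤ i) (bound-mono (≤-refl {C}) (m≤m+n a a′) (m≤m+n d d′) i))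
      (≤-trans (g≤ i) (bound-mono (≤-refl {C′}) (m≤n+m a′ a) (m≤n+m d′ d) i)))
      (≤-reflexive (arith C C′ (2 ^ ((a + a′) * κ i ^ 2)) (ν i ^ (d + d′))))
    where
    arith : ∀ C C′ x y → C * x * y + C′ * x * y ≡ (C + C′) * x * y
    arith = solve-∀

  small-* : ∀ {f g : I → ℕ} → Small f → Small g → Small (λ i → f i * g i)
  small-* {f} {g} (C , a , d , f≤) (C′ , a′ , d′ , g≤) = C * C′ , a + a′ , d + d′ , λ i →
    ≤-trans (*-mono-≤ (f≤ i) (g≤ i)) (≤-reflexive (begin
      bound C a d i * bound C′ a′ d′ i
        ≡⟨ arith C C′ (2 ^ (a * κ i ^ 2)) (2 ^ (a′ * κ i ^ 2)) (ν i ^ d) (ν i ^ d′) ⟩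
      C * C′ * (2 ^ (a * κ i ^ 2) * 2 ^ (a′ * κ i ^ 2)) * (ν i ^ d * ν i ^ d′)
        ≡⟨ cong₂ (λ x y → C * C′ * x * y) (^-distribˡ-+-* 2 (a * κ i ^ 2) (a′ * κ i ^ 2))
                                          (^-distribˡ-+-* (ν i) d d′) ⟨
      C * C′ * 2 ^ (a * κ i ^ 2 + a′ * κ i ^ 2) * ν i ^ (d + d′)
        ≡⟨ cong (λ e → C * C′ * 2 ^ e * ν i ^ (d + d′)) (*-distribʳ-+ (κ i ^ 2) a a′) ⟨
      bound (C * C′) (a + a′) (d + d′) i ∎))
    where
    open ≡-Reasoning
    arith : ∀ C C′ x x′ y y′ → C * x * y * (C′ * x′ * y′) ≡ C * C′ * (x * x′) * (y * y′)
    arith = solve-∀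

  small-^ : ∀ {g : I → ℕ} n → Small g → Small (λ i → g i ^ n)
  small-^ zero    sg = small-con 1
  small-^ (suc n) sg = small-* sg (small-^ n sg)

  small-poly : ∀ p {g : I → ℕ} → Small g → Small (λ i → ⟦ p ⟧ (g i))
  small-poly X′      sg = sg
  small-poly (con c) sg = small-con c
  small-poly (p ⊕ q) sg = small-+ (small-poly p sg) (small-poly q sg)
  small-poly (p ⊗ q) sg = small-* (small-poly p sg) (small-poly q sg)

-- The decision problem

digits : ℕᵇ → List Bool
digits 0ᵇ       = []
digits 1+[2 x ] = false ∷ digits x
digits 2[1+ x ] = true ∷ digits x

encodeBits-digits : ∀ x → encodeBits (digits x) ≡ encodeBinary x
encodeBits-digits 0ᵇ       = refl
encodeBits-digits 1+[2 x ] = cong (nil ∙_) (encodeBits-digits x)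
encodeBits-digits 2[1+ x ] = cong ((nil ∙ nil) ∙_) (encodeBits-digits x)

value-digits : ∀ x → value (digits x) ≡ Binary.toℕ x
value-digits 0ᵇ       = refl
value-digits 1+[2 x ] rewrite value-digits x = arith (Binary.toℕ x)
  where
  arith : ∀ n → 1 + (n + n) ≡ suc (2 * n)
  arith = solve-∀
value-digits 2[1+ x ] rewrite value-digits x = arith (Binary.toℕ x)
  where
  arith : ∀ n → 2 + (n + n) ≡ 2 * suc n
  arith = solve-∀

value-take-≤ : ∀ l ds → value (take l ds) ≤ value ds
value-take-≤ zero    ds           = z≤n
value-take-≤ (suc l) []           = z≤n
value-take-≤ (suc l) (false ∷ ds) = +-monoʳ-≤ 1 (+-mono-≤ (value-take-≤ l ds) (value-take-≤ l ds))
value-take-≤ (suc l) (true ∷ ds)  = +-monoʳ-≤ 2 (+-mono-≤ (value-take-≤ l ds) (value-take-≤ l ds))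

-- In bijective base 2 every digit contributes at least 1. So either `l` digits remain, with value
-- at least `l`, or nothing was cut.
value-take-≥ : ∀ l ds → l ⊓ value ds ≤ value (take l ds)
value-take-≥ zero    ds       = z≤n
value-take-≥ (suc l) []       = z≤n
value-take-≥ (suc l) (d ∷ ds) = digit d
  where
  V = value ds
  W = value (take l ds)
  step : ∀ c → suc l ⊓ (suc c + (V + V)) ≤ suc c + (W + W)
  step c with ≤-total l V
  ... | inj₁ l≤V = ≤-trans (m⊓n≤m (suc l) _) (s≤s (≤-trans l≤W (≤-trans (m≤m+n W W) (m≤n+m _ c))))
    where
    l≤W : l ≤ W
    l≤W = ≤-trans (≤-reflexive (sym (m≤n⇒m⊓n≡m l≤V))) (value-take-≥ l ds)
  ... | inj₂ V≤l = ≤-trans (m⊓n≤n (suc l) _) (+-monoʳ-≤ (suc c) (+-mono-≤ V≤W V≤W))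
    where
    V≤W : V ≤ W
    V≤W = ≤-trans (≤-reflexive (sym (m≥n⇒m⊓n≡n V≤l))) (value-take-≥ l ds)
  digit : ∀ d → suc l ⊓ value (d ∷ ds) ≤ value (take (suc l) (d ∷ ds))
  digit false = step 0
  digit true  = step 1

-- The extreme case has all digits equal to 1 and value `2^l - 1` for `l` digits.
2^length≤ : ∀ ds → 2 ^ length ds ≤ suc (value ds)
2^length≤ []       = ≤-refl
2^length≤ (d ∷ ds) = ≤-trans (*-monoʳ-≤ 2 (2^length≤ ds)) (digit d)
  where
  digit : ∀ d → 2 * suc (value ds) ≤ suc (value (d ∷ ds))
  digit false = slack 0 (arith (value ds))
    where
    arith : ∀ n → 2 * suc n + 0 ≡ suc (1 + (n + n))
    arith = solve-∀
  digit true = slack 1 (arith (value ds))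
    where
    arith : ∀ n → 2 * suc n + 1 ≡ suc (2 + (n + n))
    arith = solve-∀

-- A yes-instance has to exhibit the minimum `b(G, s)`, which constructively requires a decidable
-- predicate; the search itself provides this in `broadcast?`.
least : ∀ {P : ℕ → Set} → (∀ n → Dec (P n)) → ∀ n → P n → ∃[ b ] (IsMinimum P b × b ≤ n)
least {P} P? n Pn with search n
  where
  search : ∀ n → (∃[ b ] (IsMinimum P b × b ≤ n)) ⊎ (∀ j → j ≤ n → ¬ P j)
  search zero with P? zero
  ... | yes P0 = inj₁ (0 , (P0 , λ _ _ → z≤n) , z≤n)
  ... | no ¬P0 = inj₂ λ { zero _ → ¬P0 }
  search (suc n) with search n
  ... | inj₁ (b , min , b≤n) = inj₁ (b , min , m≤n⇒m≤1+n b≤n)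
  ... | inj₂ none with P? (suc n)
  ...   | yes Pn = inj₁ (suc n , (Pn , λ j Pj → ≰⇒> (λ j≤n → none j j≤n Pj)) , ≤-refl)
  ...   | no ¬Pn = inj₂ λ j j≤ Pj → [ (λ { (s≤s j≤n) → none j j≤n Pj }) , (λ { refl → ¬Pn Pj }) ]′
                                      (m≤n⇒m<n∨m≡n j≤)
... | inj₁ found = found
... | inj₂ none  = contradiction Pn (none n ≤-refl)

module Decision {v : ℕ} (G : Graph v) (connected : Connected G) (s : Fin v) where
  open Machine G
  open Search G
  open Setup G
  open Greedy G s
  open Runs G
  open Reachability G

  Broadcast : ℕ → Set
  Broadcast r = Rounds G r ⁅ s ⁆ ⊤

  module _ (T : ℕ) where
    open Labels G s K Y T using (start)
    open Start G s K Y T X-unique using (start≡initial)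
    open Simulation G s K Y T X-unique K-unique K∩X K∪X K-clique

    answer⇒broadcast : answerAt s K Y T ≡ true → Broadcast T
    answer⇒broadcast eq with search-sound (searchTime K T) (initial s K Y T ∷ []) eq
    ... | _ , here refl , p =
      run⇒rounds (sound _ (subst (Path (searchTime K T)) (sym start≡initial) p))

    broadcast⇒answer : Broadcast T → answerAt s K Y T ≡ true
    broadcast⇒answer rs = search-complete (searchTime K T) (initial s K Y T ∷ []) (here refl)
      (subst (Path (searchTime K T)) start≡initial (complete (rounds⇒run rs ⊥) K+X≤v))

    broadcast? : Dec (Broadcast T)
    broadcast? with answerAt s K Y T in eq
    ... | true  = yes (answer⇒broadcast eq)
    ... | false = no λ rs → contradiction (trans (sym (broadcast⇒answer rs)) eq) true≢false

  wait : ∀ m {r} → Broadcast r → Broadcast (m + r)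
  wait zero    rs = rs
  wait (suc m) rs = next idleRound (wait m rs)

  limit : Broadcast (roundLimit K Y)
  limit = run⇒rounds (UpperBound.limit-run G connected s K Y X-unique K-unique K∪X K-clique)

  -- The broadcast time never exceeds the round limit, so comparing it with `t` or with the horizon
  -- gives the same answer; idle rounds fill the difference.
  decides : ∀ t → broadcastable s (digits (fromℕ t)) ≡ true ⇔
                  (∃[ b ] (IsBroadcastTime G s b × b ≤ t))
  decides t = mk⇔ to from
    where
    ds = digits (fromℕ t)
    T = horizon K Y ds
    value≡t : value ds ≡ t
    value≡t = trans (value-digits (fromℕ t)) (toℕ-fromℕ t)
    to : answerAt s K Y T ≡ true → ∃[ b ] (IsBroadcastTime G s b × b ≤ t)
    to eq with least broadcast? T (answer⇒broadcast T eq)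
    ... | b , min , b≤T = b , min , ≤-trans b≤T (≤-trans (m⊓n≤n (roundLimit K Y) _)
      (≤-trans (value-take-≤ (roundLimit K Y) ds) (≤-reflexive value≡t)))
    from : ∃[ b ] (IsBroadcastTime G s b × b ≤ t) → answerAt s K Y T ≡ true
    from (b , (rs , min) , b≤t) =
      broadcast⇒answer T (subst Broadcast (m∸n+n≡m b≤T) (wait (T ∸ b) rs))
      where
      b≤lim : b ≤ roundLimit K Y
      b≤lim = min _ limit
      b≤T : b ≤ T
      b≤T = ⊓-glb b≤lim (≤-trans (⊓-glb b≤lim (≤-trans b≤t (≤-reflexive (sym value≡t))))
                                (value-take-≥ (roundLimit K Y) ds))

  module Cost (ds : List Bool) where
    open Total G s ds using (T; lim; units)
    open Universe G s K Y T

    -- `Z` stays opaque, so that costs are compared as polynomials in it; `Z≡` is the only access to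
    -- its value.
    abstract
      Z : ℕ
      Z = states + (sizeS + (lim + (units + (v + sizeV))))

      Z≡ : Z ≡ states + (sizeS + (lim + (units + (v + sizeV))))
      Z≡ = refl

    private
      rest₁ : sizeS + (lim + (units + (v + sizeV))) ≤ Z
      rest₁ = ≤-trans (m≤n+m _ states) (≤-reflexive (sym Z≡))
      rest₂ : lim + (units + (v + sizeV)) ≤ Z
      rest₂ = ≤-trans (m≤n+m _ sizeS) rest₁
      rest₃ : units + (v + sizeV) ≤ Z
      rest₃ = ≤-trans (m≤n+m _ lim) rest₂
      states≤Z : states ≤ Z
      states≤Z = ≤-trans (m≤m+n states _) (≤-reflexive (sym Z≡))
      v≤Z : v ≤ Z
      v≤Z = ≤-trans (≤-trans (m≤m+n v sizeV) (m≤n+m _ units)) rest₃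
      N≤v : length K ≤ v
      N≤v = ≤-trans (m≤m+n _ _) K+X≤v

    runs : (encodeGraph G ∙ encodeUnary (toℕ s) ∙ encodeBits ds) ∷ []
           ⊢ Program.main broadcaster ↦ encodeBool (broadcastable s ds) # ⟦ totalPoly ⟧ Z
    runs = Total.TotalCost.broadcastable-ok G s ds Z v≤Z
      (λ x → ≤-trans (size-encV x) (≤-trans (≤-trans (m≤n+m sizeV v) (m≤n+m _ units)) rest₃))
      (≤-trans N≤v v≤Z)
      (≤-trans (m≤m+n lim _) rest₂) (≤-trans (m≤m+n units _) rest₃)
      Inv inv-succs
      (λ inv → ≤-trans (inv-size inv) (≤-trans (m≤m+n sizeS _) rest₁))
      (λ ss uq inv → ≤-trans (inv-length ss uq inv)
        (≤-trans (≤-reflexive length-universe) states≤Z))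
      inv-init

-- Bounds in terms of the modulator size and the order

module Measures (x : BroadcastInstance) where
  open BroadcastInstance x renaming (t to deadline)
  open Decision graph connected source public
  open Setup graph using (roundLimit; broadcastable) public
  open Greedy graph source public using (K; Y; X; K+X≤v; Y≤2k)

  ds : List Bool
  ds = digits (fromℕ deadline)

  open Total graph source ds public using (T; lim; units)
  open Universe graph source K Y T public using (q; N; D; perCell; states; sizeV; sizeD; sizeC; sizeS)
  open Cost ds public using (Z; Z≡; runs)

  len : ℕ
  len = length (bits N)

  N≤order : N ≤ order
  N≤order = ≤-trans (m≤m+n N _) K+X≤v

  len≤order : len ≤ order
  len≤order = ≤-trans (length-bits N) N≤order

  T≤lim : T ≤ lim
  T≤lim = m⊓n≤m lim units

  2^len≤ : 2 ^ len ≤ suc order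
  2^len≤ = ≤-trans (2^length≤ (bits N)) (s≤s (≤-trans (≤-reflexive (value-bits N)) N≤order))

  -- Since `lim` is `q + 1` plus a logarithm, its exponential is `2^O(q)` times a linear factor in
  -- the order.
  2^lim≤ : ∀ c → 2 ^ (c + lim) ≤ 2 ^ (suc c + q) * suc order
  2^lim≤ c = begin
    2 ^ (c + (q + suc len))   ≡⟨ cong (2 ^_) (arith c q len) ⟩
    2 ^ ((suc c + q) + len)   ≡⟨ ^-distribˡ-+-* 2 (suc c + q) len ⟩
    2 ^ (suc c + q) * 2 ^ len ≤⟨ *-monoʳ-≤ (2 ^ (suc c + q)) 2^len≤ ⟩
    2 ^ (suc c + q) * suc order ∎
    where
    open ≤-Reasoning
    arith : ∀ c q l → c + (q + suc l) ≡ (suc c + q) + l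
    arith = solve-∀

  -- The price of the conversion to unary: `lim` digits are worth less than `2^(1 + lim)`.
  units≤ : units ≤ 2 ^ (1 + lim)
  units≤ = ≤-trans (m≤n+m units 2) (≤-trans (value<2^ (take lim ds))
    (^-monoʳ-≤ 2 (s≤s (≤-trans (≤-reflexive (length-take lim ds)) (m⊓n≤m lim _)))))

  D≤ : D ≤ 2 ^ (1 + q)
  D≤ = +-mono-≤ (n≤2^n q) (m≤m+n (2 ^ q) 0)

  -- The decisive estimate. Four counters in each of `3q` cells give the power `12q` of `T + 2`;
  -- `power≤` trades its `q`-th power for `q^q` and one exponential of `lim`, and `q^q` is at most
  -- `2^(q²)`.
  cells≤ : perCell (suc T) ^ (q * 3) ≤
           2 ^ ((1 + q) * (q * 3)) * (2 ^ (q * q) * 2 ^ (2 + lim)) ^ 12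
  cells≤ = begin
    perCell (suc T) ^ (q * 3)
      ≡⟨ cong (_^ (q * 3)) (arith D c) ⟩
    (D * c ^ 4) ^ (q * 3)
      ≡⟨ ^-distribʳ-* D (c ^ 4) (q * 3) ⟩
    D ^ (q * 3) * (c ^ 4) ^ (q * 3)
      ≤⟨ *-mono-≤ (^-monoˡ-≤ (q * 3) D≤) (≤-reflexive regroup) ⟩
    (2 ^ (1 + q)) ^ (q * 3) * (c ^ q) ^ 12
      ≡⟨ cong (_* (c ^ q) ^ 12) (^-*-assoc 2 (1 + q) (q * 3)) ⟩
    2 ^ ((1 + q) * (q * 3)) * (c ^ q) ^ 12
      ≤⟨ *-monoʳ-≤ (2 ^ ((1 + q) * (q * 3))) (^-monoˡ-≤ 12 c^q≤) ⟩
    2 ^ ((1 + q) * (q * 3)) * (2 ^ (q * q) * 2 ^ (2 + lim)) ^ 12 ∎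
    where
    open ≤-Reasoning
    c = suc (suc T)
    arith : ∀ d c → d * c * c * c * c ≡ d * (c * (c * (c * (c * 1))))
    arith = solve-∀
    regroup : (c ^ 4) ^ (q * 3) ≡ (c ^ q) ^ 12
    regroup = trans (^-*-assoc c 4 (q * 3))
      (trans (cong (c ^_) (exponents q)) (sym (^-*-assoc c q 12)))
      where
      exponents : ∀ q → 4 * (q * 3) ≡ q * 12
      exponents = solve-∀
    c^q≤ : c ^ q ≤ 2 ^ (q * q) * 2 ^ (2 + lim)
    c^q≤ = begin
      c ^ q                              ≤⟨ ^-monoˡ-≤ q (+-monoʳ-≤ 2 T≤lim) ⟩
      (2 + lim) ^ q                      ≤⟨ power≤ (2 + lim) q ⟩
      q ^ q * 2 ^ (2 + lim)              ≤⟨ *-monoˡ-≤ (2 ^ (2 + lim)) (^-monoˡ-≤ q (n≤2^n q)) ⟩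
      (2 ^ q) ^ q * 2 ^ (2 + lim)        ≡⟨ cong (_* 2 ^ (2 + lim)) (^-*-assoc 2 q q) ⟩
      2 ^ (q * q) * 2 ^ (2 + lim)        ∎

  time : ℕ
  time = weight (Program.main broadcaster) + ⟦ totalPoly ⟧ Z * 100

  open _⊢_↦_#_ runs using (steps; derivation; bounded)

  on-encoding : ∀ {a answer} → encodeBits ds ≡ a →
                broadcaster on encodeGraph graph ∙ encodeUnary (toℕ source) ∙ encodeBits ds
                  outputs answer in-time steps →
                broadcaster on encodeGraph graph ∙ encodeUnary (toℕ source) ∙ a
                  outputs answer in-time steps
  on-encoding refl run = run

  decidesWithin : ∀ {b} → time ≤ b → DecidesWithin TelephoneBroadcast broadcaster x b
  decidesWithin time≤b =
    broadcastable source ds , steps ,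
    on-encoding (encodeBits-digits (fromℕ deadline)) derivation ,
    decides deadline ,
    ≤-trans bounded time≤b

-- The bound in terms of k and |V| - k

Parameterized : Set
Parameterized =
  Σ[ x ∈ BroadcastInstance ] Σ[ k ∈ ℕ ] IsDistanceToClique (BroadcastInstance.graph x) k

κ ν order : Parameterized → ℕ
κ (_ , k , _) = k
order (x , _) = BroadcastInstance.order x
ν i = order i ∸ κ i

-- All vertices but the source form a modulator, as a single vertex is a clique. Thus `ν` is
-- positive; for `ν = 0` a bound with the factor `ν^d` would vanish.
κ<order : ∀ i → κ i < order i
κ<order (record { order = suc n ; graph = G ; source = s } , k , _ , min) =
  s≤s (min n (Subset.∁ ⁅ s ⁆ , modulator , trans (∣∁p∣≡n∸∣p∣ ⁅ s ⁆) (cong (suc n ∸_) (∣⁅x⁆∣≡1 s))))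
  where
  is-s : ∀ {y} → y Subset.∉ Subset.∁ ⁅ s ⁆ → y ≡ s
  is-s y∉ = x∈⁅y⁆⇒x≡y s (x∉∁p⇒x∈p y∉)
  modulator : IsModulator G (Subset.∁ ⁅ s ⁆)
  modulator y z y∉ z∉ y≢z = contradiction (trans (is-s y∉) (sym (is-s z∉))) y≢z

ν>0 : ∀ i → 1 ≤ ν i
ν>0 i = m<n⇒0<n∸m (κ<order i)

open Growth κ ν ν>0

module At (i : Parameterized) = Measures (proj₁ i)

q≤ : ∀ i → At.q i ≤ 1 + 2 * κ i
q≤ (x , k , (M , modulator , ∣M∣≡k) , _) =
  s≤s (≤-trans (Measures.Y≤2k x M modulator) (≤-reflexive (cong (2 *_) ∣M∣≡k)))

q≤κ² : ∀ i c → c + At.q i ≤ 2 * κ i ^ 2 + (1 + c)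
q≤κ² i c = ≤-trans (+-monoʳ-≤ c (≤-trans (q≤ i) (s≤s (*-monoʳ-≤ 2 (n≤n² (κ i))))))
                   (≤-reflexive (arith c (κ i ^ 2)))
  where
  arith : ∀ c m → c + (1 + 2 * m) ≡ 2 * m + (1 + c)
  arith = solve-∀

q²≤ : ∀ i → At.q i * At.q i ≤ 8 * κ i ^ 2 + 1
q²≤ i = ≤-trans (*-mono-≤ (q≤ i) (q≤ i))
  (≤-trans (≤-reflexive (expand (κ i)))
    (≤-trans (+-monoˡ-≤ 1 (+-monoʳ-≤ (4 * κ i ^ 2) (*-monoʳ-≤ 4 (n≤n² (κ i)))))
      (≤-reflexive (collect (κ i ^ 2)))))
  where
  expand : ∀ k → (1 + 2 * k) * (1 + 2 * k) ≡ 4 * (k * (k * 1)) + 4 * k + 1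
  expand = solve-∀
  collect : ∀ m → 4 * m + 4 * m + 1 ≡ 8 * m + 1
  collect = solve-∀

cell-exponent≤ : ∀ i → (1 + At.q i) * (At.q i * 3) ≤ 30 * κ i ^ 2 + 6
cell-exponent≤ i = ≤-trans (≤-reflexive (expand (At.q i)))
  (≤-trans (+-mono-≤ (*-monoʳ-≤ 3 (q≤κ² i 0)) (*-monoʳ-≤ 3 (q²≤ i)))
    (≤-reflexive (collect (κ i ^ 2))))
  where
  expand : ∀ q → (1 + q) * (q * 3) ≡ 3 * q + 3 * (q * q)
  expand = solve-∀
  collect : ∀ m → 3 * (2 * m + 1) + 3 * (8 * m + 1) ≡ 30 * m + 6
  collect = solve-∀

-- This replaces `|V|` by `|V| - k` in every bound: the difference `k` is absorbed by the factor
-- exponential in `k²`.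
small-order : Small order
small-order = small-≤ (λ i → ≤-reflexive (sym (m∸n+n≡m (<⇒≤ (κ<order i))))) (small-+ small-ν small-κ)

small-q : Small At.q
small-q = small-≤ q≤ (small-+ (small-con 1) (small-* (small-con 2) small-κ))

small-2^q : ∀ c → Small (λ i → 2 ^ (c + At.q i))
small-2^q c = small-2^ (λ i → c + At.q i) 2 (1 + c) (λ i → q≤κ² i c)

small-2^lim : ∀ c → Small (λ i → 2 ^ (c + At.lim i))
small-2^lim c = small-≤ (λ i → At.2^lim≤ i c)
  (small-* (small-2^q (suc c)) (small-+ (small-con 1) small-order))

small-N : Small At.N
small-N = small-≤ At.N≤order small-order

small-lim : Small At.lim
small-lim = small-≤ (λ i → +-monoʳ-≤ (At.q i) (s≤s (At.len≤order i)))
  (small-+ small-q (small-+ (small-con 1) small-order))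

small-T : Small At.T
small-T = small-≤ At.T≤lim small-lim

small-units : Small At.units
small-units = small-≤ At.units≤ (small-2^lim 1)

small-D : Small At.D
small-D = small-≤ At.D≤ (small-2^q 1)

small-perCell : ∀ {b} → Small b → Small (λ i → At.perCell i (b i))
small-perCell {b} sb = small-* (small-* (small-* (small-* small-D sb′) sb′) sb′) sb′
  where
  sb′ : Small (λ i → suc (b i))
  sb′ = small-+ (small-con 1) sb

small-states : Small At.states
small-states = small-*
  (small-* (small-+ (small-con 1) small-T) (small-+ (small-+ (small-con 1) small-N) small-D))
  (small-* (small-perCell small-N)
    (small-≤ At.cells≤ (small-*
      (small-2^ (λ i → (1 + At.q i) * (At.q i * 3)) 30 6 cell-exponent≤)
      (small-^ 12 (small-* (small-2^ (λ i → At.q i * At.q i) 8 1 q²≤) (small-2^lim 2))))))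

small-sizeV : Small At.sizeV
small-sizeV = small-+ (small-con 3) (small-* (small-con 6) small-order)

small-sizeS : Small At.sizeS
small-sizeS =
  small-+ (small-+ (small-con 8) (small-+ (small-* (small-con 2) small-T)
      (small-+ (small-* small-N 1+V) sizeD)))
    (small-* (small-+ (small-con 1) (small-* small-q (small-con 3))) (small-+ (small-con 1) sizeC))
  where
  1+V : Small (λ i → 1 + At.sizeV i)
  1+V = small-+ (small-con 1) small-sizeV
  sizeD : Small At.sizeD
  sizeD = small-+ (small-con 5) (small-+ (small-* small-q 1+V) small-sizeV)
  sizeC : Small At.sizeC
  sizeC = small-+ (small-con 8) (small-+ sizeD
    (small-* (small-con 8) (small-+ small-N (small-+ (small-con 1) small-T))))

small-Z : Small At.Z
small-Z = small-≤ (λ i → ≤-reflexive (At.Z≡ i)) (small-+ small-states (small-+ small-sizeS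
  (small-+ small-lim (small-+ small-units (small-+ small-order small-sizeV)))))

small-time : Small At.time
small-time = small-+ (small-con (weight (Program.main broadcaster))) (small-* (small-poly totalPoly small-Z) (small-con 100))

solvable : Small At.time → Σ[ C ∈ ℕ ] Σ[ a ∈ ℕ ] Σ[ d ∈ ℕ ]
           SolvableInTime TelephoneBroadcast
             (λ x k → C * 2 ^ (a * k ^ 2) * (BroadcastInstance.order x ∸ k) ^ d)
solvable (C , a , d , time≤) =
  C , a , d , broadcaster , λ x k dist → Measures.decidesWithin x (time≤ (x , k , dist))

order≤size : ∀ x → BroadcastInstance.order x ≤ size (ParameterizedProblem.encode TelephoneBroadcast x)
order≤size x = ≤-trans (≤-reflexive (sym (length-tabulate id)))
  (≤-trans (length-map≤size (Machine.encodeRow graph) (allFin order′))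
           (size-head (encodeGraph graph) (encodeUnary (toℕ source) ∙ encodeBinary (fromℕ t))))
  where open BroadcastInstance x renaming (order to order′)

-- `|V| - k` is at most `|V|`, the number of rows of the encoded matrix, and so at most the size of
-- the input.
tractable : Small At.time → FixedParameterTractable TelephoneBroadcast
tractable (C , a , d , time≤) =
  (λ k → C * 2 ^ (a * k ^ 2)) , d , broadcaster , λ x k dist →
  Measures.decidesWithin x (≤-trans (time≤ (x , k , dist))
    (*-monoʳ-≤ (C * 2 ^ (a * k ^ 2)) (^-monoˡ-≤ d (≤-trans (m∸n≤m _ k) (order≤size x)))))

theorem18 : FixedParameterTractable TelephoneBroadcast
    × (Σ[ C ∈ ℕ ] Σ[ a ∈ ℕ ] Σ[ d ∈ ℕ ]
    SolvableInTime TelephoneBroadcast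
    (λ x k → C * 2 ^ (a * k ^ 2) * (BroadcastInstance.order x ∸ k) ^ d))
theorem18 = tractable small-time , solvable small-time
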